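{- As a formal power series in $q$, the area generating function $PA^{(3)}(q)=\sum_{n\ge 1}PA^{(3)}_n q^n$ of 3-sided prudent polygons (where $PA^{(3)}_n$ is the number of 3-sided prudent polygons of area $n$) is $$PA^{(3)}(q)=\frac{ -2q^3(1-q)^2}{(1-2q)^2}\sum_{m=1}^{\infty}\frac{(-1)^m q^{2m}}{(1-2q)^m(1-q-q^{m+1})}\prod_{k=1}^{m-1}\frac{1-q-q^k+q^{k+1}-q^{k+2}}{1-q-q^{k+1}}+\frac{2q(3-10q+9q^2-q^3)}{(1-2q)^2(1-q)}$$ $$=6q+10q^2+20q^3+42q^4+92q^5+204q^6+454q^7+1010q^8+2242q^9+4962q^{10}+\cdots$$
   Context: All walks are on the square lattice $\mathbb{Z}^2$, start at $(0,0)$ and take unit steps north, south, east, west. A walk $\omega$ is prudent if it is self-avoiding and never takes a step towards an already occupied site: if a step goes from $p$ to $p+d$ (with $d$ a unit direction vector), then none of the points $p+kd$, $k\ge1$, has been visited before that step. Let $\omega_i$ be the walk formed by the first $i$ steps and $b_i$ its bounding box (the smallest, possibly degenerate, lattice rectangle containing $\omega_i$). A prudent walk $\omega$ of length $N$ is 3-sided if for each $i=0,1,\dots,N$ the walk $\omega_i$ ends on the north, east or west side of $b_i$, with the additional convention that the walk never steps from the south-east corner of its current box (the box before the step) to its south-west corner, or vice versa, when this box has width one and non-zero height. (Equivalently, two types of steps are forbidden: when the box has non-zero width, a south step may not be followed by a west (resp. east) step when the walk is on the east (resp. west) side of the box.) A prudent polygon is a prudent walk, with more than one step, that ends at a lattice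 site adjacent to its starting point $(0,0)$; the polygon is the closed curve obtained by adding the edge joining the endpoint to $(0,0)$. Polygons are counted as walks, i.e. they are rooted at $(0,0)$ and oriented. The polygon is 3-sided if the underlying prudent walk is 3-sided. Its area is the number of unit cells enclosed. An empty product equals 1. -}

module Defs where

open import Data.Integer as ℤ using (ℤ; +_; 0ℤ; 1ℤ; -1ℤ)
import Data.Integer.Properties as ℤ
open import Data.List using (List; []; _∷_; _++_; [_]; drop; filter; foldl; length; map; take; zip)
open import Data.List.Extrema ℤ.≤-totalOrder using (min; max)
open import Data.List.Membership.Propositional using (_∈_; _∉_)
open import Data.List.Relation.Unary.Unique.Propositional using (Unique)
open import Data.Nat as ℕ using (ℕ; zero; suc; _∸_; _≤_; _<_)
open import Data.Nat.Divisibility using (_∤_)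
open import Data.Product using (_×_; _,_; ∃-syntax; proj₁; proj₂)
open import Data.Sum using (_⊎_)
open import Function.Bundles using (_⇔_)
open import Relation.Binary.PropositionalEquality using (_≡_; _≢_; cong; trans)
open import Relation.Nullary using (¬_; Dec)
open import Relation.Nullary.Decidable using (_×-dec_)

HasCard : {A : Set} → (A → Set) → ℕ → Set
HasCard {A} P n = ∃[ xs ] (Unique {A = A} xs × length xs ≡ n × (∀ x → (x ∈ xs) ⇔ P x))

------------------------------------------------------------------------
-- Walks

Point : Set
Point = ℤ × ℤ

origin : Point
origin = 0ℤ , 0ℤ

data Dir : Set where
  north south east west : Dir

-- advance p k d is the point p + k d.
advance : Point → ℕ → Dir → Point
advance (x , y) k north = x , y ℤ.+ + k
advance (x , y) k south = x , y ℤ.- + k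
advance (x , y) k east  = x ℤ.+ + k , y
advance (x , y) k west  = x ℤ.- + k , y

step : Point → Dir → Point
step p d = advance p 1 d

Adjacent : Point → Point → Set
Adjacent p q = ∃[ d ] step p d ≡ q

-- The successive steps, starting from the origin.
Walk : Set
Walk = List Dir

end : Walk → Point
end = foldl step origin

verticesFrom : Point → Walk → List Point
verticesFrom p []      = [ p ]
verticesFrom p (d ∷ w) = p ∷ verticesFrom (step p d) w

vertices : Walk → List Point
vertices = verticesFrom origin

SelfAvoiding : Walk → Set
SelfAvoiding w = Unique (vertices w)

Prudent : Walk → Set
Prudent w = SelfAvoiding w ×
  (∀ u d v → w ≡ u ++ d ∷ v → ∀ k → 1 ≤ k → advance (end u) k d ∉ vertices u)

-- The bounding box.  The default value 0ℤ of the extrema is harmless, since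
-- every walk visits the origin.
left right bottom top : Walk → ℤ
left   w = min 0ℤ (map proj₁ (vertices w))
right  w = max 0ℤ (map proj₁ (vertices w))
bottom w = min 0ℤ (map proj₂ (vertices w))
top    w = max 0ℤ (map proj₂ (vertices w))

width height : Walk → ℤ
width  w = right w ℤ.- left w
height w = top w ℤ.- bottom w

southEast southWest : Walk → Point
southEast w = right w , bottom w
southWest w = left w , bottom w

EndsOnNorth EndsOnEast EndsOnWest : Walk → Set
EndsOnNorth w = proj₂ (end w) ≡ top w
EndsOnEast  w = proj₁ (end w) ≡ right w
EndsOnWest  w = proj₁ (end w) ≡ left w

-- u is followed by a step d between the two southern corners of its box.
SouthCornerStep : Walk → Dir → Set
SouthCornerStep u d =
    (end u ≡ southEast u × step (end u) d ≡ southWest u)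
  ⊎ (end u ≡ southWest u × step (end u) d ≡ southEast u)

ThreeSided : Walk → Set
ThreeSided w =
    (∀ i → i ≤ length w →
       EndsOnNorth (take i w) ⊎ EndsOnEast (take i w) ⊎ EndsOnWest (take i w))
  × (∀ u d v → w ≡ u ++ d ∷ v → width u ≡ 1ℤ → height u ≢ 0ℤ → ¬ SouthCornerStep u d)

PrudentPolygon : Walk → Set
PrudentPolygon w = Prudent w × 1 < length w × Adjacent (end w) origin

ThreeSidedPrudentPolygon : Walk → Set
ThreeSidedPrudentPolygon w = PrudentPolygon w × ThreeSided w

------------------------------------------------------------------------
-- Area

Edge : Set
Edge = Point × Point

-- The edges of the closed curve, including the one from the last vertex back
-- to the origin.
edges : Walk → List Edge
edges w = zip (vertices w) (drop 1 (vertices w) ++ [ origin ])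

-- (a , b) stands for the unit cell [a , a + 1] × [b , b + 1].
Cell : Set
Cell = ℤ × ℤ

-- The horizontal ray going east from the centre of the cell crosses the
-- (unit-length) edge.
Crosses : Cell → Edge → Set
Crosses (a , b) ((x₁ , y₁) , (x₂ , y₂)) = x₁ ≡ x₂ × a ℤ.< x₁ × y₁ ℤ.⊓ y₂ ≡ b

crosses? : ∀ c e → Dec (Crosses c e)
crosses? (a , b) ((x₁ , y₁) , (x₂ , y₂)) =
  (x₁ ℤ.≟ x₂) ×-dec ((a ℤ.<? x₁) ×-dec ((y₁ ℤ.⊓ y₂) ℤ.≟ b))

-- The interior of a simple closed polygon, by the even–odd rule: a point is
-- inside iff a ray from it to infinity crosses the curve an odd number of times.
Encloses : Walk → Cell → Set
Encloses w c = 2 ∤ length (filter (crosses? c) (edges w))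

HasArea : Walk → ℕ → Set
HasArea w n = HasCard (Encloses w) n

------------------------------------------------------------------------
-- Formal power series over ℤ, as coefficient sequences

ℤ⟦q⟧ : Set
ℤ⟦q⟧ = ℕ → ℤ

infix  4 _≈_
infixl 6 _+_ _-_
infixl 7 _*_ _/_
infixr 8 _^_
infix  9 #_

_≈_ : ℤ⟦q⟧ → ℤ⟦q⟧ → Set
f ≈ g = ∀ n → f n ≡ g n

tail : ℤ⟦q⟧ → ℤ⟦q⟧
tail f n = f (suc n)

#_ : ℤ → ℤ⟦q⟧
(# c) zero    = c
(# c) (suc _) = 0ℤ

q : ℤ⟦q⟧
q 1 = 1ℤ
q _ = 0ℤ

_+_ _-_ _*_ : ℤ⟦q⟧ → ℤ⟦q⟧ → ℤ⟦q⟧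
(f + g) n = f n ℤ.+ g n
(f - g) n = f n ℤ.- g n

-- t 0 + t 1 + ⋯ + t n
∑₀ : ℕ → (ℕ → ℤ) → ℤ
∑₀ zero    t = t 0
∑₀ (suc n) t = t 0 ℤ.+ ∑₀ n (λ k → t (suc k))

(f * g) n = ∑₀ n (λ k → f k ℤ.* g (n ∸ k))

_^_ : ℤ⟦q⟧ → ℕ → ℤ⟦q⟧
f ^ zero  = # 1ℤ
f ^ suc n = f * f ^ n

-- Long division, meaningful when the divisor has constant term 1 (as shown by
-- /-*-cancel); it is only applied to such divisors.
_/_ : ℤ⟦q⟧ → ℤ⟦q⟧ → ℤ⟦q⟧
(f / g) zero    = f 0
(f / g) (suc n) = ((tail f - (λ k → f 0 ℤ.* tail g k)) / g) n

/-*-cancel : ∀ f g → g 0 ≡ 1ℤ → (f / g) * g ≈ f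
/-*-cancel f g g₀ zero    = trans (cong (λ z → f 0 ℤ.* z) g₀) (ℤ.*-identityʳ (f 0))
/-*-cancel f g g₀ (suc n) =
  trans (cong (λ z → a ℤ.+ z) (/-*-cancel (tail f - (λ k → f 0 ℤ.* tail g k)) g g₀ n))
  (trans (ℤ.+-comm a (b ℤ.- a))
  (trans (ℤ.+-assoc b (ℤ.- a) a)
  (trans (cong (λ z → b ℤ.+ z) (ℤ.+-inverseˡ a)) (ℤ.+-identityʳ b))))
  where
  a b : ℤ
  a = f 0 ℤ.* g (suc n)
  b = f (suc n)

-- t 1 + t 2 + ⋯ + t n
∑₁ : ℕ → (ℕ → ℤ⟦q⟧) → ℤ⟦q⟧
∑₁ zero    t = # 0ℤ
∑₁ (suc n) t = ∑₁ n t + t (suc n)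

-- t 1 * t 2 * ⋯ * t n
∏₁ : ℕ → (ℕ → ℤ⟦q⟧) → ℤ⟦q⟧
∏₁ zero    t = # 1ℤ
∏₁ (suc n) t = ∏₁ n t * t (suc n)

-- s is the sum of the series t 1 + t 2 + ⋯ : every coefficient of the partial
-- sums is eventually equal to that of s.
_SumsTo_ : (ℕ → ℤ⟦q⟧) → ℤ⟦q⟧ → Set
t SumsTo s = ∀ n → ∃[ M ] (∀ K → M ≤ K → ∑₁ K t n ≡ s n)

-- ∑_{n ≥ 1} a n qⁿ
generatingFunction : (ℕ → ℕ) → ℤ⟦q⟧
generatingFunction a zero    = 0ℤ
generatingFunction a (suc n) = + a (suc n)

summand : ℕ → ℤ⟦q⟧
summand m =
    ((# -1ℤ) ^ m * q ^ (2 ℕ.* m))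
      / ((# 1ℤ - # (+ 2) * q) ^ m * (# 1ℤ - q - q ^ (m ℕ.+ 1)))
  * ∏₁ (m ∸ 1) (λ k →
      (# 1ℤ - q - q ^ k + q ^ (k ℕ.+ 1) - q ^ (k ℕ.+ 2))
        / (# 1ℤ - q - q ^ (k ℕ.+ 1)))

prefactor : ℤ⟦q⟧
prefactor =
  (# (ℤ.- + 2) * q ^ 3 * (# 1ℤ - q) ^ 2) / (# 1ℤ - # (+ 2) * q) ^ 2

rationalPart : ℤ⟦q⟧
rationalPart =
  (# (+ 2) * q * (# (+ 3) - # (+ 10) * q + # (+ 9) * q ^ 2 - q ^ 3))
    / ((# 1ℤ - # (+ 2) * q) ^ 2 * (# 1ℤ - q))

{-# OPTIONS --safe #-}
module Submission where

-- Reading a 3-sided prudent polygon along its walk and up to the reflection in the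
-- y-axis, each time the walk opens a new top row the column in which it does so is
-- unconstrained by the past, and the walk forgets everything but the width w of its
-- box; between two such moments it runs within the top row, or leaves the box on the
-- west side by columns of arbitrary depth.  Let F w and X w be the area generating
-- functions of the walks of width w that have just opened a row, respectively
-- extended the box to the west.  Then X 0 = 1 and
--
--   F w = (q + ⋯ + q^(w+1)) F w + q^(w+1) X w,    X (w+1) = F w + X w / (1 − q).
--
-- For φ(x) = ∑ F w x^w, eliminating X gives the functional equation
--
--   (1−2q) (1−q−qx) φ(x) = q (1−q)² − q² (1 − q − x + qx − q²x) φ(qx),
--
-- which is iterated from x = 1, one factor of the product for each power of q.
-- Besides the polygons counted by φ(1) there are only bargraphs hanging from
-- the row of the origin, and single columns.

-- What brings a polygon into one half-plane is its end. The walk stops next to the origin, and its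
-- last straight run uses a column or row that prudence requires to be still free ahead; together
-- with the three permitted sides this confines everything before that run to a half-plane, up to
-- reflection. Inside the half-plane the walks are exactly the runs of a deterministic automaton.
--
-- An unfinished walk encloses nothing, so it is given the area that it would have after being
-- closed up in a standard way, and each step changes this area by an explicit strip of cells. A row
-- opened i columns west of the origin adds i + 1 cells: the extra one lies between x = 0 and x = 1,
-- where the polygon comes down again. Hence q + ⋯ + q^(w+1) for a box of width w.
--
-- No series in two variables is formed. The argument x is itself a series in q, the sums over w are
-- cut off, and every equation is proved modulo a power of q beyond which the discarded terms begin.

open import Defs
open import Algebra.Bundles using (CommutativeRing)
import Algebra.Properties.Group as GroupProperties
import Algebra.Solver.Ring as RingSolver
open import Algebra.Solver.Ring.AlmostCommutativeRing using (AlmostCommutativeRing; fromCommutativeRing; _-Raw-AlmostCommutative⟶_)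
open import Data.Bool using (Bool; true; false; _∧_; _xor_; if_then_else_; not)
open import Data.Bool.Properties using (xor-comm; xor-assoc; xor-same; xor-identityʳ)
open import Data.Empty using (⊥; ⊥-elim)
open import Data.Integer as ℤ using (ℤ; +_; -[1+_]; 0ℤ; 1ℤ; -1ℤ)
import Data.Integer.Properties as ℤ
open import Data.Integer.Tactic.RingSolver using (solve-∀)
open import Data.List using (List; []; _∷_; _++_; _∷ʳ_; [_]; applyUpTo; downFrom; drop; filter; foldl; foldr; length; map; replicate; reverse; take; zip)
import Data.List.Extrema ℤ.≤-totalOrder as Extrema
open import Data.List.Membership.Propositional using (_∈_; _∉_)
open import Data.List.Membership.Propositional.Properties using (∈-map⁺; ∈-map⁻; ∈-∃++; ∈-++⁺ˡ; ∈-++⁺ʳ; ∈-++⁻)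
open import Data.List.Properties using (++-assoc; foldl-∷ʳ; length-++; length-map; length-reverse; reverse-++; reverse-involutive; take++drop≡id; unfold-reverse)
open import Data.List.Relation.Unary.All as All using (All; []; _∷_)
open import Data.List.Relation.Unary.AllPairs using ([]; _∷_)
open import Data.List.Relation.Unary.Any using (here; there)
open import Data.List.Relation.Unary.Any.Properties using (reverse⁺; reverse⁻)
open import Data.List.Relation.Unary.Unique.Propositional using (Unique)
import Data.List.Relation.Unary.All.Properties as All
import Data.List.Relation.Unary.Unique.Propositional.Properties as Unique
open import Data.Maybe using (Maybe; just; nothing)
open import Data.Nat as ℕ using (ℕ; zero; suc; _≤_; _<_; _∸_; z≤n; s≤s)
open import Data.Nat.Divisibility using (_∣_; _∤_; _∣0; ∣1⇒≡1; ∣-refl; ∣m∣n⇒∣m+n; ∣m+n∣m⇒∣n)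
open import Data.Nat.Induction using (<-rec)
open import Data.Nat.ListAction using (sum)
import Data.Nat.Properties as ℕ
open import Data.Product using (_×_; _,_; ∃-syntax; proj₁; proj₂)
open import Data.Sum as Sum using (_⊎_; inj₁; inj₂)
open import Data.Unit using (⊤; tt)
open import Function using (_∘_; case_of_; id)
open import Function.Bundles using (_⇔_; mk⇔; Equivalence)
open import Level using (0ℓ)
open import Relation.Binary.Definitions using (tri<; tri≈; tri>)
open import Relation.Binary.PropositionalEquality using (_≡_; _≢_; refl; sym; trans; cong; cong₂; subst; subst₂)
open import Relation.Nullary using (¬_; yes; no; does)

-- Linear arithmetic

module LinearArithmetic where

  infix  5 _:≤_ _:<_ _:≡_ _:≤ⁿ_ _:≡ⁿ_
  infixl 6 _⊕_ _⊖_
  infix  7 ⊝_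
  infixr 3 _⇒_
  infix  4 ⊢_

  data ℕExpr : Set where
    var con : ℕ → ℕExpr
    suc     : ℕExpr → ℕExpr
    _⊕_    : ℕExpr → ℕExpr → ℕExpr

  data ℤExpr : Set where
    var  : ℕ → ℤExpr
    con  : ℤ → ℤExpr
    nat  : ℕExpr → ℤExpr
    ⊝_  : ℤExpr → ℤExpr
    _⊕_ _⊖_ : ℤExpr → ℤExpr → ℤExpr

  data Constraint : Set where
    _:≤_ _:<_ _:≡_ : ℤExpr → ℤExpr → Constraint
    _:≤ⁿ_ _:≡ⁿ_ : ℕExpr → ℕExpr → Constraint
    absurd : Constraint

  data Problem : Set where
    ⊢_  : Constraint → Problem
    _⇒_ : Constraint → Problem → Problem

  at : {A : Set} → A → List A → ℕ → A
  at a []       _       = a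
  at a (x ∷ xs) zero    = x
  at a (x ∷ xs) (suc n) = at a xs n

  record Linear : Set where
    constructor linear
    field
      zs ns : List ℤ
      k : ℤ
  open Linear

  dot : List ℤ → List ℤ → ℤ
  dot []       _        = 0ℤ
  dot (_ ∷ _)  []       = 0ℤ
  dot (c ∷ cs) (z ∷ zs) = c ℤ.* z ℤ.+ dot cs zs

  infixl 6 _⊞_ _⊞ₗ_
  _⊞_ : List ℤ → List ℤ → List ℤ
  []       ⊞ ds       = ds
  (c ∷ cs) ⊞ []       = c ∷ cs
  (c ∷ cs) ⊞ (d ∷ ds) = (c ℤ.+ d) ∷ (cs ⊞ ds)

  _⊞ₗ_ : Linear → Linear → Linear
  linear a b c ⊞ₗ linear a′ b′ c′ = linear (a ⊞ a′) (b ⊞ b′) (c ℤ.+ c′)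

  scale : ℤ → Linear → Linear
  scale m (linear a b c) = linear (map (m ℤ.*_) a) (map (m ℤ.*_) b) (m ℤ.* c)

  unit : ℕ → List ℤ
  unit zero    = 1ℤ ∷ []
  unit (suc n) = 0ℤ ∷ unit n

  dot-⊞ : ∀ cs ds zs → dot (cs ⊞ ds) zs ≡ dot cs zs ℤ.+ dot ds zs
  dot-⊞ [] ds zs = sym (ℤ.+-identityˡ _)
  dot-⊞ (c ∷ cs) [] zs = sym (ℤ.+-identityʳ _)
  dot-⊞ (c ∷ cs) (d ∷ ds) [] = refl
  dot-⊞ (c ∷ cs) (d ∷ ds) (z ∷ zs) =
    trans (cong (λ t → (c ℤ.+ d) ℤ.* z ℤ.+ t) (dot-⊞ cs ds zs)) (lemma c d z (dot cs zs) (dot ds zs))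
    where
    lemma : ∀ c d z x y → (c ℤ.+ d) ℤ.* z ℤ.+ (x ℤ.+ y) ≡ (c ℤ.* z ℤ.+ x) ℤ.+ (d ℤ.* z ℤ.+ y)
    lemma = solve-∀

  dot-scale : ∀ m cs zs → dot (map (m ℤ.*_) cs) zs ≡ m ℤ.* dot cs zs
  dot-scale m [] zs = sym (ℤ.*-zeroʳ m)
  dot-scale m (c ∷ cs) [] = sym (ℤ.*-zeroʳ m)
  dot-scale m (c ∷ cs) (z ∷ zs) =
    trans (cong (λ t → m ℤ.* c ℤ.* z ℤ.+ t) (dot-scale m cs zs)) (lemma m c z (dot cs zs))
    where
    lemma : ∀ m c z x → m ℤ.* c ℤ.* z ℤ.+ m ℤ.* x ≡ m ℤ.* (c ℤ.* z ℤ.+ x)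
    lemma = solve-∀

  dot-unit : ∀ n zs → dot (unit n) zs ≡ at 0ℤ zs n
  dot-unit zero    []       = refl
  dot-unit zero    (z ∷ zs) = trans (ℤ.+-identityʳ _) (ℤ.*-identityˡ z)
  dot-unit (suc n) []       = refl
  dot-unit (suc n) (z ∷ zs) = trans (cong (ℤ._+ dot (unit n) zs) (ℤ.*-zeroˡ z)) (trans (ℤ.+-identityˡ _) (dot-unit n zs))

  dot-zero : ∀ cs zs → All (_≡ 0ℤ) cs → dot cs zs ≡ 0ℤ
  dot-zero [] zs _ = refl
  dot-zero (c ∷ cs) [] _ = refl
  dot-zero (_ ∷ cs) (z ∷ zs) (refl ∷ p) = trans (cong (ℤ._+ dot cs zs) (ℤ.*-zeroˡ z)) (trans (ℤ.+-identityˡ _) (dot-zero cs zs p))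

  linearℕ : ℕExpr → Linear
  linearℕ (var x)  = linear [] (unit x) 0ℤ
  linearℕ (con c)  = linear [] [] (+ c)
  linearℕ (suc e)  = linear [] [] 1ℤ ⊞ₗ linearℕ e
  linearℕ (d ⊕ e) = linearℕ d ⊞ₗ linearℕ e

  linearℤ : ℤExpr → Linear
  linearℤ (var x)  = linear (unit x) [] 0ℤ
  linearℤ (con c)  = linear [] [] c
  linearℤ (nat e)  = linearℕ e
  linearℤ (⊝ e)   = scale -1ℤ (linearℤ e)
  linearℤ (d ⊕ e) = linearℤ d ⊞ₗ linearℤ e
  linearℤ (d ⊖ e) = linearℤ d ⊞ₗ scale -1ℤ (linearℤ e)

  -- Integrality enters only here and in `negations`, by reading a strict inequality as a gap of at
  -- least one; everything else is linear algebra over the rationals.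
  nonNegatives : Constraint → List Linear
  nonNegatives (a :≤ b) = linearℤ b ⊞ₗ scale -1ℤ (linearℤ a) ∷ []
  nonNegatives (a :< b) = linearℤ b ⊞ₗ scale -1ℤ (linear [] [] 1ℤ ⊞ₗ linearℤ a) ∷ []
  nonNegatives (a :≡ b) = linearℤ b ⊞ₗ scale -1ℤ (linearℤ a) ∷ linearℤ a ⊞ₗ scale -1ℤ (linearℤ b) ∷ []
  nonNegatives (a :≤ⁿ b) = linearℕ b ⊞ₗ scale -1ℤ (linearℕ a) ∷ []
  nonNegatives (a :≡ⁿ b) = linearℕ b ⊞ₗ scale -1ℤ (linearℕ a) ∷ linearℕ a ⊞ₗ scale -1ℤ (linearℕ b) ∷ []
  nonNegatives absurd   = []

  negations : Constraint → List Constraint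
  negations (a :≤ b) = (b :< a) ∷ []
  negations (a :< b) = (b :≤ a) ∷ []
  negations (a :≡ b) = (a :< b) ∷ (b :< a) ∷ []
  negations (a :≤ⁿ b) = (suc b :≤ⁿ a) ∷ []
  negations (a :≡ⁿ b) = (suc a :≤ⁿ b) ∷ (suc b :≤ⁿ a) ∷ []
  -- A true statement: the contradiction must then come from the hypotheses alone.
  negations absurd   = (con 0 :≤ⁿ con 0) ∷ []

  atomBounds : ℕ → List Linear
  atomBounds zero    = []
  atomBounds (suc n) = linear [] (unit n) 0ℤ ∷ atomBounds n

  rows : ℕ → List Constraint → List Linear
  rows n []       = atomBounds n
  rows n (c ∷ cs) = nonNegatives c ++ rows n cs

  combine : List ℕ → List Linear → Linear
  combine (m ∷ ms) (l ∷ ls) = scale (+ m) l ⊞ₗ combine ms ls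
  combine _        _        = linear [] [] 0ℤ

  zeros : List ℤ → Bool
  zeros [] = true
  zeros (+ 0 ∷ cs) = zeros cs
  zeros (_ ∷ cs) = false

  negative : ℤ → Bool
  negative (+ _) = false
  negative -[1+ _ ] = true

  -- A Farkas certificate: a non-negative combination of non-negative quantities cannot be a
  -- negative constant.
  contradictory : Linear → Bool
  contradictory l = zeros (zs l) ∧ zeros (ns l) ∧ negative (k l)

  -- Search for the multipliers by Fourier–Motzkin elimination.

  -- The last component records which combination of the original rows this row is. The elimination
  -- is not verified: only the multipliers that it returns are used, and `contradictory` checks them
  -- afresh.
  Row : Set
  Row = (List ℤ × ℤ) × List ℕ

  addMultipliers : List ℕ → List ℕ → List ℕ
  addMultipliers []       bs       = bs
  addMultipliers as       []       = as
  addMultipliers (a ∷ as) (b ∷ bs) = (a ℕ.+ b) ∷ addMultipliers as bs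

  resolve : ℕ → Row → Row → Row
  resolve v ((as , c) , ms) ((bs , d) , ns) =
    ((map (+ β ℤ.*_) as ⊞ map (+ α ℤ.*_) bs) , + β ℤ.* c ℤ.+ + α ℤ.* d) ,
    addMultipliers (map (β ℕ.*_) ms) (map (α ℕ.*_) ns)
    where
    α = ℤ.∣ at 0ℤ as v ∣
    β = ℤ.∣ at 0ℤ bs v ∣

  data Sign : Set where − ⓪ ＋ : Sign

  sign : ℤ → Sign
  sign (+ 0)     = ⓪
  sign (+ suc _) = ＋
  sign -[1+ _ ]  = −

  select : Sign → ℕ → List Row → List Row
  select s v [] = []
  select s v (r ∷ rs) with s | sign (at 0ℤ (proj₁ (proj₁ r)) v)
  ... | − | − = r ∷ select s v rs
  ... | ⓪ | ⓪ = r ∷ select s v rs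
  ... | ＋ | ＋ = r ∷ select s v rs
  ... | _ | _ = select s v rs

  eliminate : ℕ → List Row → List Row
  eliminate v rs = foldr (λ p acc → map (resolve v p) (select − v rs) ++ acc) (select ⓪ v rs) (select ＋ v rs)

  cost : ℕ → List Row → ℕ
  cost v rs = length (select ＋ v rs) ℕ.* length (select − v rs)

  cheapest : List ℕ → List Row → ℕ → ℕ
  cheapest []       rs best = best
  cheapest (v ∷ vs) rs best = cheapest vs rs (if cost v rs ℕ.<ᵇ cost best rs then v else best)

  remove : ℕ → List ℕ → List ℕ
  remove v []       = []
  remove v (u ∷ us) = if v ℕ.≡ᵇ u then us else u ∷ remove v us

  eliminateAll : ℕ → List ℕ → List Row → List Row
  eliminateAll (suc fuel) (v ∷ vs) rs = eliminateAll fuel (remove u (v ∷ vs)) (eliminate u rs)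
    where u = cheapest vs rs v
  eliminateAll _ _ rs = rs

  findNegative : List Row → List ℕ
  -- On failure the combination is zero, which `contradictory` rejects.
  findNegative [] = []
  findNegative (((_ , c) , ms) ∷ rs) = if negative c then ms else findNegative rs

  pad : ℕ → List ℤ → List ℤ
  pad zero    _        = []
  pad (suc n) []       = 0ℤ ∷ pad n []
  pad (suc n) (x ∷ xs) = x ∷ pad n xs

  toRows : ℕ → ℕ → List Linear → List Row
  toRows a i []       = []
  toRows a i (linear z n c ∷ ls) = ((pad a z ++ n , c) , replicate i 0 ++ 1 ∷ []) ∷ toRows a (suc i) ls

  certificate : ℕ → ℕ → List Constraint → List ℕ
  certificate a b cs = findNegative (eliminateAll (a ℕ.+ b) (downFrom (a ℕ.+ b)) (toRows a 0 (rows b cs)))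

  refuted : ℕ → ℕ → List Constraint → Bool
  refuted a b cs = contradictory (combine (certificate a b cs) (rows b cs))

  allRefuted : ℕ → ℕ → List Constraint → List Constraint → Bool
  allRefuted a b []       hs = true
  allRefuted a b (c ∷ cs) hs = refuted a b (c ∷ hs) ∧ allRefuted a b cs hs

  -- hs ⊢ p follows by linear arithmetic over ℚ, for a integer and b natural variables.
  valid : ℕ → ℕ → List Constraint → Problem → Bool
  valid a b hs (⊢ g)   = allRefuted a b (negations g) hs
  valid a b hs (h ⇒ p) = valid a b (h ∷ hs) p

  ∧-true : ∀ {a b} → a ∧ b ≡ true → a ≡ true × b ≡ true
  ∧-true {true} {true} _ = refl , refl

  -- Soundness of the certificates

  module Semantics (ρ : List ℤ) (σ : List ℕ) where

    ⟦_⟧ℕ : ℕExpr → ℕ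
    ⟦ var x ⟧ℕ = at 0 σ x
    ⟦ con c ⟧ℕ = c
    ⟦ suc e ⟧ℕ = suc ⟦ e ⟧ℕ
    ⟦ d ⊕ e ⟧ℕ = ⟦ d ⟧ℕ ℕ.+ ⟦ e ⟧ℕ

    ⟦_⟧ℤ : ℤExpr → ℤ
    ⟦ var x ⟧ℤ  = at 0ℤ ρ x
    ⟦ con c ⟧ℤ  = c
    ⟦ nat e ⟧ℤ  = + ⟦ e ⟧ℕ
    ⟦ ⊝ e ⟧ℤ   = ℤ.- ⟦ e ⟧ℤ
    ⟦ d ⊕ e ⟧ℤ = ⟦ d ⟧ℤ ℤ.+ ⟦ e ⟧ℤ
    ⟦ d ⊖ e ⟧ℤ = ⟦ d ⟧ℤ ℤ.- ⟦ e ⟧ℤ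

    ⟦_⟧ : Constraint → Set
    ⟦ a :≤ b ⟧  = ⟦ a ⟧ℤ ℤ.≤ ⟦ b ⟧ℤ
    ⟦ a :< b ⟧  = ⟦ a ⟧ℤ ℤ.< ⟦ b ⟧ℤ
    ⟦ a :≡ b ⟧  = ⟦ a ⟧ℤ ≡ ⟦ b ⟧ℤ
    ⟦ a :≤ⁿ b ⟧ = ⟦ a ⟧ℕ ℕ.≤ ⟦ b ⟧ℕ
    ⟦ a :≡ⁿ b ⟧ = ⟦ a ⟧ℕ ≡ ⟦ b ⟧ℕ
    ⟦ absurd ⟧  = ⊥

    ⟦_⟧ₚ : Problem → Set
    ⟦ ⊢ g ⟧ₚ   = ⟦ g ⟧
    ⟦ h ⇒ p ⟧ₚ = ⟦ h ⟧ → ⟦ p ⟧ₚ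

    ⟪_⟫ : Linear → ℤ
    ⟪ l ⟫ = dot (zs l) ρ ℤ.+ dot (ns l) (map +_ σ) ℤ.+ k l

    ⟪⟫-⊞ : ∀ l m → ⟪ l ⊞ₗ m ⟫ ≡ ⟪ l ⟫ ℤ.+ ⟪ m ⟫
    ⟪⟫-⊞ (linear a b c) (linear a′ b′ c′)
      rewrite dot-⊞ a a′ ρ | dot-⊞ b b′ (map +_ σ) =
      lemma (dot a ρ) (dot a′ ρ) (dot b (map +_ σ)) (dot b′ (map +_ σ)) c c′
      where
      lemma : ∀ a a′ b b′ c c′ → (a ℤ.+ a′) ℤ.+ (b ℤ.+ b′) ℤ.+ (c ℤ.+ c′) ≡ (a ℤ.+ b ℤ.+ c) ℤ.+ (a′ ℤ.+ b′ ℤ.+ c′)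
      lemma = solve-∀

    ⟪⟫-scale : ∀ m l → ⟪ scale m l ⟫ ≡ m ℤ.* ⟪ l ⟫
    ⟪⟫-scale m (linear a b c)
      rewrite dot-scale m a ρ | dot-scale m b (map +_ σ) = lemma m (dot a ρ) (dot b (map +_ σ)) c
      where
      lemma : ∀ m a b c → m ℤ.* a ℤ.+ m ℤ.* b ℤ.+ m ℤ.* c ≡ m ℤ.* (a ℤ.+ b ℤ.+ c)
      lemma = solve-∀

    ⟪⟫-neg : ∀ l → ⟪ scale -1ℤ l ⟫ ≡ ℤ.- ⟪ l ⟫
    ⟪⟫-neg l = trans (⟪⟫-scale -1ℤ l) (ℤ.-1*i≡-i _)

    at-map : ∀ σ x → at 0ℤ (map +_ σ) x ≡ + at 0 σ x
    at-map []      x       = refl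
    at-map (_ ∷ σ) zero    = refl
    at-map (_ ∷ σ) (suc x) = at-map σ x

    ⟪⟫-unit : ∀ x → ⟪ linear [] (unit x) 0ℤ ⟫ ≡ + at 0 σ x
    ⟪⟫-unit x = trans (ℤ.+-identityʳ _) (trans (ℤ.+-identityˡ _) (trans (dot-unit x (map +_ σ)) (at-map σ x)))

    linearℕ-correct : ∀ e → ⟪ linearℕ e ⟫ ≡ + ⟦ e ⟧ℕ
    linearℕ-correct (var x)  = ⟪⟫-unit x
    linearℕ-correct (con c)  = ℤ.+-identityˡ _
    linearℕ-correct (suc e)  = trans (⟪⟫-⊞ (linear [] [] 1ℤ) (linearℕ e)) (cong (λ t → 1ℤ ℤ.+ t) (linearℕ-correct e))
    linearℕ-correct (d ⊕ e) = trans (⟪⟫-⊞ (linearℕ d) (linearℕ e)) (cong₂ ℤ._+_ (linearℕ-correct d) (linearℕ-correct e))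

    linearℤ-correct : ∀ e → ⟪ linearℤ e ⟫ ≡ ⟦ e ⟧ℤ
    linearℤ-correct (var x)  = trans (ℤ.+-identityʳ _) (trans (ℤ.+-identityʳ _) (dot-unit x ρ))
    linearℤ-correct (con c)  = ℤ.+-identityˡ c
    linearℤ-correct (nat e)  = linearℕ-correct e
    linearℤ-correct (⊝ e)   = trans (⟪⟫-neg (linearℤ e)) (cong ℤ.-_ (linearℤ-correct e))
    linearℤ-correct (d ⊕ e) = trans (⟪⟫-⊞ (linearℤ d) (linearℤ e)) (cong₂ ℤ._+_ (linearℤ-correct d) (linearℤ-correct e))
    linearℤ-correct (d ⊖ e) = trans (⟪⟫-⊞ (linearℤ d) (scale -1ℤ (linearℤ e)))
      (cong₂ ℤ._+_ (linearℤ-correct d) (trans (⟪⟫-neg (linearℤ e)) (cong ℤ.-_ (linearℤ-correct e))))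

    NonNeg : Linear → Set
    NonNeg l = 0ℤ ℤ.≤ ⟪ l ⟫

    difference : ∀ {x y} l m → ⟪ l ⟫ ≡ x → ⟪ m ⟫ ≡ y → y ℤ.≤ x → NonNeg (l ⊞ₗ scale -1ℤ m)
    difference l m p q y≤x =
      subst (0ℤ ℤ.≤_) (sym (trans (⟪⟫-⊞ l (scale -1ℤ m)) (cong₂ ℤ._+_ p (trans (⟪⟫-neg m) (cong ℤ.-_ q))))) (ℤ.i≤j⇒0≤j-i y≤x)

    sound : ∀ c → ⟦ c ⟧ → All NonNeg (nonNegatives c)
    sound (a :≤ b) h = difference (linearℤ b) (linearℤ a) (linearℤ-correct b) (linearℤ-correct a) h ∷ []
    sound (a :< b) h =
      difference (linearℤ b) (linear [] [] 1ℤ ⊞ₗ linearℤ a) (linearℤ-correct b)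
        (trans (⟪⟫-⊞ (linear [] [] 1ℤ) (linearℤ a)) (cong (λ t → 1ℤ ℤ.+ t) (linearℤ-correct a))) (ℤ.i<j⇒suc[i]≤j h) ∷ []
    sound (a :≡ b) h =
      difference (linearℤ b) (linearℤ a) (linearℤ-correct b) (linearℤ-correct a) (ℤ.≤-reflexive h) ∷
      difference (linearℤ a) (linearℤ b) (linearℤ-correct a) (linearℤ-correct b) (ℤ.≤-reflexive (sym h)) ∷ []
    sound (a :≤ⁿ b) h = difference (linearℕ b) (linearℕ a) (linearℕ-correct b) (linearℕ-correct a) (ℤ.+≤+ h) ∷ []
    sound (a :≡ⁿ b) h =
      difference (linearℕ b) (linearℕ a) (linearℕ-correct b) (linearℕ-correct a) (ℤ.≤-reflexive (cong +_ h)) ∷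
      difference (linearℕ a) (linearℕ b) (linearℕ-correct a) (linearℕ-correct b) (ℤ.≤-reflexive (cong +_ (sym h))) ∷ []

    sound-atoms : ∀ n → All NonNeg (atomBounds n)
    sound-atoms zero    = []
    sound-atoms (suc n) = subst (0ℤ ℤ.≤_) (sym (⟪⟫-unit n)) (ℤ.+≤+ ℕ.z≤n) ∷ sound-atoms n

    sound-rows : ∀ n {cs} → All ⟦_⟧ cs → All NonNeg (rows n cs)
    sound-rows n []       = sound-atoms n
    sound-rows n (h ∷ hs) = All.++⁺ (sound _ h) (sound-rows n hs)

    sound-combine : ∀ ms {ls} → All NonNeg ls → NonNeg (combine ms ls)
    sound-combine []       _ = ℤ.≤-refl
    sound-combine (m ∷ ms) [] = ℤ.≤-refl
    sound-combine (m ∷ ms) (_∷_ {l} {ls} p ps) =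
      subst (0ℤ ℤ.≤_) (sym (trans (⟪⟫-⊞ (scale (+ m) l) (combine ms ls)) (cong (ℤ._+ ⟪ combine ms ls ⟫) (⟪⟫-scale (+ m) l))))
        (ℤ.+-mono-≤ (subst (ℤ._≤ + m ℤ.* ⟪ l ⟫) (ℤ.*-zeroʳ (+ m)) (ℤ.*-monoˡ-≤-nonNeg (+ m) p)) (sound-combine ms ps))

    zeros-sound : ∀ cs → zeros cs ≡ true → All (_≡ 0ℤ) cs
    zeros-sound [] _ = []
    zeros-sound (+ zero ∷ cs) p = refl ∷ zeros-sound cs p
    zeros-sound (+ suc _ ∷ cs) ()
    zeros-sound (-[1+ _ ] ∷ cs) ()

    contradiction-sound : ∀ l → contradictory l ≡ true → ¬ NonNeg l
    contradiction-sound (linear a b c) p q with ∧-true {zeros a} p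
    ... | pa , p′ with ∧-true {zeros b} p′
    ...   | pb , pc with c
    ...     | + _      = case pc of λ ()
    ...     | -[1+ n ] rewrite dot-zero a ρ (zeros-sound a pa) | dot-zero b (map +_ σ) (zeros-sound b pb) = case q of λ ()

    by-refutation : ∀ g → All (¬_ ∘ ⟦_⟧) (negations g) → ⟦ g ⟧
    by-refutation (a :≤ b) (p ∷ []) = ℤ.≮⇒≥ p
    by-refutation (a :< b) (p ∷ []) = ℤ.≰⇒> p
    by-refutation (a :≡ b) (p ∷ p′ ∷ []) = ℤ.≤-antisym (ℤ.≮⇒≥ p′) (ℤ.≮⇒≥ p)
    by-refutation (a :≤ⁿ b) (p ∷ []) = ℕ.≮⇒≥ p
    by-refutation (a :≡ⁿ b) (p ∷ p′ ∷ []) = ℕ.≤-antisym (ℕ.≮⇒≥ p′) (ℕ.≮⇒≥ p)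
    by-refutation absurd   (p ∷ []) = p ℕ.z≤n

    refutations : ∀ a b cs hs → allRefuted a b cs hs ≡ true → All ⟦_⟧ hs → All (¬_ ∘ ⟦_⟧) cs
    refutations a b []       hs p ps = []
    refutations a b (c ∷ cs) hs p ps with ∧-true {refuted a b (c ∷ hs)} p
    ... | p₁ , p₂ =
      (λ h → contradiction-sound (combine (certificate a b (c ∷ hs)) (rows b (c ∷ hs))) p₁
        (sound-combine (certificate a b (c ∷ hs)) (sound-rows b (h ∷ ps)))) ∷ refutations a b cs hs p₂ ps

    valid-sound : ∀ a b hs p → valid a b hs p ≡ true → All ⟦_⟧ hs → ⟦ p ⟧ₚ
    valid-sound a b hs (⊢ g)   v ps = by-refutation g (refutations a b (negations g) hs v ps)
    valid-sound a b hs (h ⇒ p) v ps = λ q → valid-sound a b (h ∷ hs) p v (q ∷ ps)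

  Open : ℕ → ℕ → Set
  Open zero    zero    = Problem
  Open zero    (suc b) = ℕExpr → Open zero b
  Open (suc a) b       = ℤExpr → Open a b

  instantiate : ∀ a b → ℕ → ℕ → Open a b → Problem
  instantiate zero    zero    i j p = p
  instantiate zero    (suc b) i j f = instantiate zero b i (suc j) (f (var j))
  instantiate (suc a) b       i j f = instantiate a b (suc i) j (f (var i))

  Closure : ℕ → ℕ → Problem → List ℤ → List ℕ → Set
  Closure zero    zero    p ρ σ = Semantics.⟦_⟧ₚ ρ σ p
  Closure zero    (suc b) p ρ σ = {n : ℕ} → Closure zero b p ρ (σ ++ [ n ])
  Closure (suc a) b       p ρ σ = {x : ℤ} → Closure a b p (ρ ++ [ x ]) σ

  -- Abstract, so that proofs are not unfolded during type checking.
  abstract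
    close : ∀ a b p → (∀ ρ σ → Semantics.⟦_⟧ₚ ρ σ p) → ∀ ρ σ → Closure a b p ρ σ
    close zero    zero    p h ρ σ = h ρ σ
    close zero    (suc b) p h ρ σ {n} = close zero b p h ρ (σ ++ [ n ])
    close (suc a) b       p h ρ σ {x} = close a b p h (ρ ++ [ x ]) σ

    lin : ∀ a b (f : Open a b) → let p = instantiate a b 0 0 f in valid a b [] p ≡ true → Closure a b p [] []
    lin a b f v = close a b (instantiate a b 0 0 f)
      (λ ρ σ → Semantics.valid-sound ρ σ a b [] (instantiate a b 0 0 f) v []) [] []

open LinearArithmetic using (lin; con; nat; suc; ⊝_; _⊕_; _⊖_; _:≤_; _:<_; _:≡_; _:≤ⁿ_; _:≡ⁿ_; absurd; _⇒_; ⊢_)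

-- Prudent walks

≰-pred : ∀ {x} → ¬ (x ℤ.≤ x ℤ.- 1ℤ)
≰-pred = lin 1 0 (λ x → x :≤ x ⊖ con 1ℤ ⇒ ⊢ absurd) refl

suc-≰ : ∀ {x} → ¬ (x ℤ.+ 1ℤ ℤ.≤ x)
suc-≰ = lin 1 0 (λ x → x ⊕ con 1ℤ :≤ x ⇒ ⊢ absurd) refl

≡-≤-trans : ∀ {x y z : ℤ} → x ≡ y → y ℤ.≤ z → x ℤ.≤ z
≡-≤-trans refl h = h

≤-≡-trans : ∀ {x y z : ℤ} → x ℤ.≤ z → y ≡ z → x ℤ.≤ y
≤-≡-trans h refl = h

-- A list of directions is read backwards from here on: its head is the last step.
pos : List Dir → Point
pos []      = origin
pos (d ∷ r) = step (pos r) d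

X Y : List Dir → ℤ
X r = proj₁ (pos r)
Y r = proj₂ (pos r)

trail : List Dir → List Point
trail []      = origin ∷ []
trail (d ∷ r) = pos (d ∷ r) ∷ trail r

origin∈ : ∀ r → origin ∈ trail r
origin∈ []      = here refl
origin∈ (d ∷ r) = there (origin∈ r)

pos∈ : ∀ r → pos r ∈ trail r
pos∈ []      = here refl
pos∈ (d ∷ r) = here refl

-- The start counts as heading west: every direction but east is then open, as after an
-- extension of the box to the west.
heading : List Dir → Dir
heading []      = west
heading (d ∷ r) = d

-- One inequality for all vertices on the line of the step replaces the condition on every `k`; the
-- current position satisfies it with equality. `clear-to` and `clear-from` compare it with
-- `Prudent`.
Clear : List Dir → Dir → Set
Clear r north = ∀ {p} → p ∈ trail r → proj₁ p ≡ X r → proj₂ p ℤ.≤ Y r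
Clear r south = ∀ {p} → p ∈ trail r → proj₁ p ≡ X r → Y r ℤ.≤ proj₂ p
Clear r east  = ∀ {p} → p ∈ trail r → proj₂ p ≡ Y r → proj₁ p ℤ.≤ X r
Clear r west  = ∀ {p} → p ∈ trail r → proj₂ p ≡ Y r → X r ℤ.≤ proj₁ p

OnNorth OnEast OnWest : List Dir → Set
OnNorth r = ∀ {p} → p ∈ trail r → proj₂ p ℤ.≤ Y r
OnEast  r = ∀ {p} → p ∈ trail r → proj₁ p ℤ.≤ X r
OnWest  r = ∀ {p} → p ∈ trail r → X r ℤ.≤ proj₁ p

Side : List Dir → Set
Side r = OnNorth r ⊎ OnEast r ⊎ OnWest r

-- Free of the extrema of the box: `lowest` and `taller` put the step in the bottom row of a box of
-- non-zero height, and by `narrow` and `opposite` this box consists of the current column and the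
-- target column.
record Corner (r : List Dir) (d : Dir) : Set where
  field
    level    : Y (d ∷ r) ≡ Y r
    lowest   : ∀ {p} → p ∈ trail r → Y r ℤ.≤ proj₂ p
    taller   : ∃[ p ] p ∈ trail r × Y r ℤ.< proj₂ p
    opposite : ∃[ p ] p ∈ trail r × proj₁ p ≡ X (d ∷ r)
    narrow   : ∀ {p} → p ∈ trail r → proj₁ p ≡ X r ⊎ proj₁ p ≡ X (d ∷ r)

record Allowed (r : List Dir) (d : Dir) : Set where
  constructor allowed
  field
    clear  : Clear r d
    side   : Side (d ∷ r)
    corner : ¬ Corner r d
open Allowed

infixr 5 _∷_
data Legal : List Dir → Set where
  []  : Legal []
  _∷_ : ∀ {d r} → Allowed r d → Legal r → Legal (d ∷ r)

fresh : ∀ {r} d → Clear r d → pos (d ∷ r) ∉ trail r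
fresh north c m = suc-≰ (c m refl)
fresh south c m = ≰-pred (c m refl)
fresh east  c m = suc-≰ (c m refl)
fresh west  c m = ≰-pred (c m refl)

-- A discrete intermediate value theorem: a coordinate that changes by at most one per step takes on
-- a trail all values between any two of its values. It supplies the vertices that block a step or
-- would be visited twice.
module Intermediate (f : Point → ℤ)
  (f-step : ∀ p d → (f p ℤ.- 1ℤ ℤ.≤ f (step p d)) × (f (step p d) ℤ.≤ f p ℤ.+ 1ℤ)) where

  Between : ℤ → ℤ → ℤ → Set
  Between a b c = (a ℤ.≤ c × c ℤ.≤ b) ⊎ (b ℤ.≤ c × c ℤ.≤ a)

  from-end : ∀ r {p} c → p ∈ trail r → Between (f p) (f (pos r)) c → ∃[ p′ ] p′ ∈ trail r × f p′ ≡ c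
  from-end [] c (here refl) (inj₁ (a , b)) = _ , here refl , ℤ.≤-antisym a b
  from-end [] c (here refl) (inj₂ (a , b)) = _ , here refl , ℤ.≤-antisym a b
  from-end (d ∷ r) c (here refl) (inj₁ (a , b)) = _ , here refl , ℤ.≤-antisym a b
  from-end (d ∷ r) c (here refl) (inj₂ (a , b)) = _ , here refl , ℤ.≤-antisym a b
  from-end (d ∷ r) {p} c (there m) b with ℤ.<-cmp (f (pos (d ∷ r))) c
  ... | tri≈ _ e _ = _ , here refl , e
  ... | tri< l _ _ = case-l b
    where
    case-l : Between (f p) (f (pos (d ∷ r))) c → _
    case-l (inj₁ (_ , u)) = ⊥-elim (ℤ.<⇒≱ l u)
    case-l (inj₂ (_ , u)) with from-end r c m (inj₂ (lin 3 0 (λ x y z → z :< y ⇒ x ⊕ con -1ℤ :≤ z ⇒ ⊢ x :≤ y) refl l (proj₁ (f-step (pos r) d)) , u))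
    ... | p′ , m′ , e = p′ , there m′ , e
  ... | tri> _ _ g = case-g b
    where
    case-g : Between (f p) (f (pos (d ∷ r))) c → _
    case-g (inj₂ (u , _)) = ⊥-elim (ℤ.<⇒≱ g u)
    case-g (inj₁ (u , _)) with from-end r c m (inj₁ (u , lin 3 0 (λ x y z → x :< z ⇒ z :≤ y ⊕ con 1ℤ ⇒ ⊢ x :≤ y) refl g (proj₂ (f-step (pos r) d))))
    ... | p′ , m′ , e = p′ , there m′ , e

  between : ∀ r {p p″} c → p ∈ trail r → p″ ∈ trail r → f p ℤ.≤ c → c ℤ.≤ f p″ → ∃[ p′ ] p′ ∈ trail r × f p′ ≡ c
  between r c m m″ a b with c ℤ.≤? f (pos r)
  ... | yes u = from-end r c m (inj₁ (a , u))
  ... | no  u = from-end r c m″ (inj₂ (ℤ.<⇒≤ (ℤ.≰⇒> u) , b))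

within : ∀ a → (a ℤ.- 1ℤ ℤ.≤ a × a ℤ.≤ a ℤ.+ 1ℤ) × a ℤ.- 1ℤ ℤ.≤ a ℤ.+ 1ℤ
within a = (ℤ.i-j≤i a 1ℤ , ℤ.i≤i+j a 1ℤ) , ℤ.≤-trans (ℤ.i-j≤i a 1ℤ) (ℤ.i≤i+j a 1ℤ)

proj₁-step : ∀ p d → (proj₁ p ℤ.- 1ℤ ℤ.≤ proj₁ (step p d)) × (proj₁ (step p d) ℤ.≤ proj₁ p ℤ.+ 1ℤ)
proj₁-step p north = proj₁ (within (proj₁ p))
proj₁-step p south = proj₁ (within (proj₁ p))
proj₁-step p east  = proj₂ (within (proj₁ p)) , ℤ.≤-refl
proj₁-step p west  = ℤ.≤-refl , proj₂ (within (proj₁ p))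

proj₂-step : ∀ p d → (proj₂ p ℤ.- 1ℤ ℤ.≤ proj₂ (step p d)) × (proj₂ (step p d) ℤ.≤ proj₂ p ℤ.+ 1ℤ)
proj₂-step p north = proj₂ (within (proj₂ p)) , ℤ.≤-refl
proj₂-step p south = ℤ.≤-refl , proj₂ (within (proj₂ p))
proj₂-step p east  = proj₁ (within (proj₂ p))
proj₂-step p west  = proj₁ (within (proj₂ p))

module Columns = Intermediate proj₁ proj₁-step
module Rows    = Intermediate proj₂ proj₂-step

all-or-any : ∀ {P : Point → Set} {Q : Point → Set} → (∀ p → P p ⊎ Q p) →
             ∀ ps → (∀ {p} → p ∈ ps → P p) ⊎ (∃[ p ] p ∈ ps × Q p)
all-or-any f [] = inj₁ λ ()
all-or-any f (x ∷ ps) with f x | all-or-any f ps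
... | inj₂ u | _ = inj₂ (x , here refl , u)
... | inj₁ _ | inj₂ (p , m , u) = inj₂ (p , there m , u)
... | inj₁ v | inj₁ g = inj₁ λ { (here refl) → v ; (there m) → g m }

≤⊎> : ∀ a b → a ℤ.≤ b ⊎ b ℤ.< a
≤⊎> a b with a ℤ.≤? b
... | yes p = inj₁ p
... | no  p = inj₂ (ℤ.≰⇒> p)

two-values : ∀ {a x} → a ℤ.≤ x → x ℤ.≤ a ℤ.+ 1ℤ → x ≡ a ⊎ x ≡ a ℤ.+ 1ℤ
two-values {a} {x} p q with x ℤ.≤? a
... | yes u = inj₁ (ℤ.≤-antisym u p)
... | no  u = inj₂ (ℤ.≤-antisym q (succ (ℤ.≰⇒> u)))
  where
  succ : a ℤ.< x → a ℤ.+ 1ℤ ℤ.≤ x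
  succ h = lin 2 0 (λ x y → x :< y ⇒ ⊢ x ⊕ con 1ℤ :≤ y) refl h

data Horizontal : Dir → Set where
  east : Horizontal east
  west : Horizontal west

across-blocked : ∀ {r d p} → Horizontal d → Clear r d → p ∈ trail r → proj₂ p ≡ Y r → proj₁ p ≢ X (d ∷ r)
across-blocked east c m e f = lin 2 0 (λ x y → x :≤ y ⇒ x :≡ y ⊕ con 1ℤ ⇒ ⊢ absurd) refl (c m e) f
across-blocked west c m e f = lin 2 0 (λ x y → x :≤ y ⇒ y :≡ x ⊖ con 1ℤ ⇒ ⊢ absurd) refl (c m e) f

horizontal-level : ∀ {d} r → Horizontal d → Y (d ∷ r) ≡ Y r
horizontal-level r east = refl
horizontal-level r west = refl

-- Below the top of a box of width one, the walk cannot change sides: the row it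
-- is in is the bottom row, or contains an earlier vertex.
width-one : ∀ {r d} → Legal r → Allowed r d → Horizontal d →
            (∀ {p} → p ∈ trail r → proj₁ p ≡ X r ⊎ proj₁ p ≡ X (d ∷ r)) →
            (∃[ p ] p ∈ trail r × proj₁ p ≡ X (d ∷ r)) →
            ¬ (∃[ p ] p ∈ trail r × Y r ℤ.< proj₂ p)
width-one {r} {d} lr a h narrow opp tall@(p , m , u)
  with all-or-any {P = λ p → Y r ℤ.≤ proj₂ p} {Q = λ p → proj₂ p ℤ.< Y r} (λ p → ≤⊎> (Y r) (proj₂ p)) (trail r)
... | inj₁ low = corner a record { level = horizontal-level r h ; lowest = low ; taller = tall ; opposite = opp ; narrow = narrow }
... | inj₂ (p′ , m′ , u′) = earlier lr m m′ refl
  where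
  earlier : ∀ {r′} → Legal r′ → p ∈ trail r′ → p′ ∈ trail r′ → r′ ≡ r → ⊥
  earlier [] (here refl) _ refl = lin 0 0 (con 0ℤ :< con 0ℤ ⇒ ⊢ absurd) refl u
  earlier (_ ∷ _) (here refl) _ refl = ℤ.<-irrefl refl u
  earlier (_ ∷ _) _ (here refl) refl = ℤ.<-irrefl refl u′
  earlier {d′ ∷ r′} (a′ ∷ lr′) (there m) (there m′) refl with Rows.between r′ (Y r) m′ m (ℤ.<⇒≤ u′) (ℤ.<⇒≤ u)
  ... | q , mq , e with narrow (there mq)
  ...   | inj₂ f = across-blocked h (clear a) (there mq) e f
  ...   | inj₁ f = fresh d′ (clear a′) (subst (_∈ trail r′) (cong₂ _,_ f e) mq)

-- The automaton

-- States of a walk in the half-plane x ≤ 0, where t is the top of its box and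
-- the last component the last direction:
--   exc w t e n d : on the west side of a box of width w, at height t − e;
--   crest i k t n d : in the newly opened top row, at x = − i, in a box of width i + k;
--   fin y n       : descending the column x = 1, at height y.
-- Once the walk is closed up by going straight to the top row, then east to
-- x = 1, and then down to (1 , 0), it has area n.
data State : Set where
  exc : (w t e n : ℕ) → Dir → State
  crest : (i k t n : ℕ) → Dir → State
  fin : (y n : ℕ) → State

-- What is added to `n` is the growth of the closed-up area. `col` adds a column of `e` cells below
-- the top row; `rise` and `lift` add the cells of the new row between the walk and x = 0, and one
-- cell between x = 0 and x = 1. The conditions on `d` only forbid reversals. That no step leads
-- east from `exc` or south from `crest` is justified in `exc-complete` and `top-complete`.
data Step : State → Dir → State → Set where
  col   : ∀ {w t e n d} → Step (exc w t e n d) west (exc (suc w) t e (e ℕ.+ n) west)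
  dig   : ∀ {w t e n d} → d ≢ north → Step (exc w t e n d) south (exc w t (suc e) n south)
  climb : ∀ {w t e n d} → d ≢ south → Step (exc w t (suc e) n d) north (exc w t e n north)
  rise  : ∀ {w t n d} → d ≢ south → Step (exc w t 0 n d) north (crest w 0 (suc t) (suc w ℕ.+ n) north)
  lift  : ∀ {i k t n d} → Step (crest i k t n d) north (crest i k (suc t) (suc i ℕ.+ n) north)
  back  : ∀ {i k t n d} → d ≢ west → Step (crest (suc i) k t n d) east (crest i (suc k) t n east)
  forth : ∀ {i k t n d} → d ≢ east → Step (crest i (suc k) t n d) west (crest (suc i) k t n west)
  over  : ∀ {i t n d} → d ≢ east → Step (crest i 0 t n d) west (exc (suc i) t 0 n west)
  exit  : ∀ {k t n d} → d ≢ west → Step (crest 0 k t n d) east (fin t n)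
  fall  : ∀ {y n} → Step (fin (suc y) n) south (fin y n)

initial : State
initial = exc 0 0 0 0 west

data Run : List Dir → State → Set where
  []  : Run [] initial
  _∷_ : ∀ {d r s s′} → Step s d s′ → Run r s → Run (d ∷ r) s′

step-deterministic : ∀ {s d s₁ s₂} → Step s d s₁ → Step s d s₂ → s₁ ≡ s₂
step-deterministic col col = refl
step-deterministic (dig _) (dig _) = refl
step-deterministic (climb _) (climb _) = refl
step-deterministic (rise _) (rise _) = refl
step-deterministic lift lift = refl
step-deterministic (back _) (back _) = refl
step-deterministic (forth _) (forth _) = refl
step-deterministic (over _) (over _) = refl
step-deterministic (exit _) (exit _) = refl
step-deterministic fall fall = refl

run-deterministic : ∀ {r s₁ s₂} → Run r s₁ → Run r s₂ → s₁ ≡ s₂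
run-deterministic [] [] = refl
run-deterministic (a ∷ as) (b ∷ bs) with run-deterministic as bs
... | refl = step-deterministic a b

-- `below` and `above` give the clearance of the western column, each suspended after a vertical
-- step the other way. `crown`, a vertex of the top row further east, is what prevents a return to
-- the east. `flat` records that the width is zero only during the initial descent.
record Exc (w t e : ℕ) (d : Dir) (r : List Dir) : Set where
  field
    heading≡ : heading r ≡ d
    x≡       : X r ≡ ℤ.- + w
    y≡       : Y r ≡ + t ℤ.- + e
    westmost : ∀ {p} → p ∈ trail r → ℤ.- + w ℤ.≤ proj₁ p
    eastmost : ∀ {p} → p ∈ trail r → proj₁ p ℤ.≤ 0ℤ
    topmost  : ∀ {p} → p ∈ trail r → proj₂ p ℤ.≤ + t
    below    : d ≢ north → ∀ {p} → p ∈ trail r → proj₁ p ≡ ℤ.- + w → Y r ℤ.≤ proj₂ p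
    above    : d ≢ south → ∀ {p} → p ∈ trail r → proj₁ p ≡ ℤ.- + w → proj₂ p ℤ.≤ Y r
    crown    : ∃[ p ] p ∈ trail r × proj₂ p ≡ + t × (w ≡ 0 ⊎ ℤ.- + w ℤ.< proj₁ p)
    flat     : w ≡ 0 → t ≡ 0

-- `positive` keeps the row above the origin, out of reach of the rule on southern corners. `foot`
-- blocks a descent at the west end of the box, as the origin does at the east end.
record Top (i k t : ℕ) (d : Dir) (r : List Dir) : Set where
  field
    heading≡ : heading r ≡ d
    x≡       : X r ≡ ℤ.- + i
    y≡       : Y r ≡ + t
    positive : 1 ℕ.≤ t
    westmost : ∀ {p} → p ∈ trail r → ℤ.- + (i ℕ.+ k) ℤ.≤ proj₁ p
    eastmost : ∀ {p} → p ∈ trail r → proj₁ p ℤ.≤ 0ℤ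
    topmost  : ∀ {p} → p ∈ trail r → proj₂ p ℤ.≤ + t
    ahead    : d ≢ east → ∀ {p} → p ∈ trail r → proj₂ p ≡ + t → ℤ.- + i ℤ.≤ proj₁ p
    behind   : d ≢ west → ∀ {p} → p ∈ trail r → proj₂ p ≡ + t → proj₁ p ℤ.≤ ℤ.- + i
    foot     : ∃[ p ] p ∈ trail r × proj₁ p ≡ ℤ.- + (i ℕ.+ k) × proj₂ p ℤ.< + t

record Fin (y : ℕ) (r : List Dir) : Set where
  field
    x≡       : X r ≡ 1ℤ
    y≡       : Y r ≡ + y
    eastmost : ∀ {p} → p ∈ trail r → proj₁ p ℤ.≤ 1ℤ
    below    : ∀ {p} → p ∈ trail r → proj₁ p ≡ 1ℤ → + y ℤ.≤ proj₂ p

Inv : State → List Dir → Set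
Inv (exc w t e n d) r = Exc w t e d r
Inv (crest i k t n d) r = Top i k t d r
Inv (fin y n)       r = Fin y r

vertical-no-corner : ∀ {r} → ¬ Corner r north × ¬ Corner r south
vertical-no-corner = (λ c → lin 1 0 (λ x → x ⊕ con 1ℤ :≡ x ⇒ ⊢ absurd) refl (Corner.level c)) , (λ c → lin 1 0 (λ x → x ⊖ con 1ℤ :≡ x ⇒ ⊢ absurd) refl (Corner.level c))

initial-inv : Inv initial []
initial-inv = record
  { heading≡ = refl ; x≡ = refl ; y≡ = refl
  ; westmost = λ { (here refl) → ℤ.≤-refl }
  ; eastmost = λ { (here refl) → ℤ.≤-refl }
  ; topmost = λ { (here refl) → ℤ.≤-refl }
  ; below = λ { _ (here refl) _ → ℤ.≤-refl }
  ; above = λ { _ (here refl) _ → ℤ.≤-refl }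
  ; crown = origin , here refl , refl , inj₁ refl
  ; flat = λ _ → refl }

step-sound : ∀ {s d s′ r} → Step s d s′ → Inv s r → Allowed r d × Inv s′ (d ∷ r)
step-sound {r = r} (col {t = t} {e = e}) v = allowed
    (λ m _ → ≡-≤-trans x≡ (westmost m))
    (inj₂ (inj₂ λ { (here refl) → ℤ.≤-refl ; (there m) → lin 2 1 (λ x y m → ⊝ nat m :≤ y ⇒ x :≡ ⊝ nat m ⇒ ⊢ x ⊖ con 1ℤ :≤ y) refl (westmost m) x≡ }))
    -- The target column lies outside the box, so this is no step between its corners.
    (λ c → let p , m , f = Corner.opposite c in lin 2 1 (λ x y m → ⊝ nat m :≤ x ⇒ y :≡ ⊝ nat m ⇒ x :≡ y ⊖ con 1ℤ ⇒ ⊢ absurd) refl (westmost m) x≡ f) ,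
  record
    { heading≡ = refl ; x≡ = lin 1 1 (λ x m → x :≡ ⊝ nat m ⇒ ⊢ x ⊖ con 1ℤ :≡ ⊝ nat (suc m)) refl x≡ ; y≡ = y≡
    ; westmost = λ { (here refl) → lin 1 1 (λ x m → x :≡ ⊝ nat m ⇒ ⊢ ⊝ nat (suc m) :≤ x ⊖ con 1ℤ) refl x≡ ; (there m) → lin 1 1 (λ x m → ⊝ nat m :≤ x ⇒ ⊢ ⊝ nat (suc m) :≤ x) refl (westmost m) }
    ; eastmost = λ { (here refl) → lin 1 1 (λ x m → x :≡ ⊝ nat m ⇒ ⊢ x ⊖ con 1ℤ :≤ con 0ℤ) refl x≡ ; (there m) → eastmost m }
    ; topmost = λ { (here refl) → lin 1 2 (λ x m n → x :≡ nat m ⊖ nat n ⇒ ⊢ x :≤ nat m) refl {_} {t} {e} y≡ ; (there m) → topmost m }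
    ; below = λ { _ (here refl) _ → ℤ.≤-refl ; _ (there m) f → ⊥-elim (lin 1 1 (λ x m → ⊝ nat m :≤ x ⇒ x :≡ ⊝ nat (suc m) ⇒ ⊢ absurd) refl (westmost m) f) }
    ; above = λ { _ (here refl) _ → ℤ.≤-refl ; _ (there m) f → ⊥-elim (lin 1 1 (λ x m → ⊝ nat m :≤ x ⇒ x :≡ ⊝ nat (suc m) ⇒ ⊢ absurd) refl (westmost m) f) }
    ; crown = let p , m , e , _ = crown in p , there m , e , inj₂ (lin 1 1 (λ x m → ⊝ nat m :≤ x ⇒ ⊢ ⊝ nat (suc m) :< x) refl (westmost m))
    ; flat = λ () }
  where open Exc v
step-sound (dig {t = t} {e = e} h) v = allowed
    (λ m f → below h m (trans f x≡))
    (inj₂ (inj₂ λ { (here refl) → ℤ.≤-refl ; (there m) → ≡-≤-trans x≡ (westmost m) }))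
    (proj₂ vertical-no-corner) ,
  record
    { heading≡ = refl ; x≡ = x≡ ; y≡ = lin 1 2 (λ x m n → x :≡ nat m ⊖ nat n ⇒ ⊢ x ⊖ con 1ℤ :≡ nat m ⊖ nat (suc n)) refl {_} {t} {e} y≡
    ; westmost = λ { (here refl) → ℤ.≤-reflexive (sym x≡) ; (there m) → westmost m }
    ; eastmost = λ { (here refl) → eastmost (pos∈ _) ; (there m) → eastmost m }
    ; topmost = λ { (here refl) → lin 1 2 (λ x m n → x :≡ nat m ⊖ nat n ⇒ ⊢ x ⊖ con 1ℤ :≤ nat m) refl {_} {t} {e} y≡ ; (there m) → topmost m }
    ; below = λ { _ (here refl) _ → ℤ.≤-refl ; _ (there m) f → lin 2 0 (λ x y → x :≤ y ⇒ ⊢ x ⊖ con 1ℤ :≤ y) refl (below h m f) }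
    ; above = λ q → ⊥-elim (q refl)
    ; crown = let p , m , e , f = crown in p , there m , e , f
    ; flat = flat }
  where open Exc v
step-sound (climb {t = t} {e = e} h) v = allowed
    (λ m f → above h m (trans f x≡))
    (inj₂ (inj₂ λ { (here refl) → ℤ.≤-refl ; (there m) → ≡-≤-trans x≡ (westmost m) }))
    (proj₁ vertical-no-corner) ,
  record
    { heading≡ = refl ; x≡ = x≡ ; y≡ = lin 1 2 (λ x m n → x :≡ nat m ⊖ nat (suc n) ⇒ ⊢ x ⊕ con 1ℤ :≡ nat m ⊖ nat n) refl {_} {t} {e} y≡
    ; westmost = λ { (here refl) → ℤ.≤-reflexive (sym x≡) ; (there m) → westmost m }
    ; eastmost = λ { (here refl) → eastmost (pos∈ _) ; (there m) → eastmost m }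
    ; topmost = λ { (here refl) → lin 1 2 (λ x m n → x :≡ nat m ⊖ nat (suc n) ⇒ ⊢ x ⊕ con 1ℤ :≤ nat m) refl {_} {t} {e} y≡ ; (there m) → topmost m }
    ; below = λ q → ⊥-elim (q refl)
    ; above = λ { _ (here refl) _ → ℤ.≤-refl ; _ (there m) f → lin 2 0 (λ x y → x :≤ y ⇒ ⊢ x :≤ y ⊕ con 1ℤ) refl (above h m f) }
    ; crown = let p , m , e , f = crown in p , there m , e , f
    ; flat = flat }
  where open Exc v
step-sound {r = r} (rise h) v = allowed
    (λ m f → above h m (trans f x≡))
    (inj₁ λ { (here refl) → ℤ.≤-refl ; (there m) → lin 2 1 (λ x y m → x :≤ nat m ⇒ y :≡ nat m ⊖ con 0ℤ ⇒ ⊢ x :≤ y ⊕ con 1ℤ) refl (topmost m) y≡ })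
    (proj₁ vertical-no-corner) ,
  record
    { heading≡ = refl ; x≡ = x≡ ; y≡ = lin 1 1 (λ x m → x :≡ nat m ⊖ con 0ℤ ⇒ ⊢ x ⊕ con 1ℤ :≡ nat (suc m)) refl y≡ ; positive = s≤s z≤n
    ; westmost = λ { (here refl) → lin 1 1 (λ x m → x :≡ ⊝ nat m ⇒ ⊢ ⊝ nat (m ⊕ con 0) :≤ x) refl x≡ ; (there m) → lin 1 1 (λ x m → ⊝ nat m :≤ x ⇒ ⊢ ⊝ nat (m ⊕ con 0) :≤ x) refl (westmost m) }
    ; eastmost = λ { (here refl) → eastmost (pos∈ _) ; (there m) → eastmost m }
    ; topmost = λ { (here refl) → lin 1 1 (λ x m → x :≡ nat m ⊖ con 0ℤ ⇒ ⊢ x ⊕ con 1ℤ :≤ nat (suc m)) refl y≡ ; (there m) → lin 1 1 (λ x m → x :≤ nat m ⇒ ⊢ x :≤ nat (suc m)) refl (topmost m) }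
    ; ahead = λ { _ (here refl) _ → ℤ.≤-reflexive (sym x≡) ; _ (there m) f → ⊥-elim (lin 1 1 (λ x m → x :≤ nat m ⇒ x :≡ nat (suc m) ⇒ ⊢ absurd) refl (topmost m) f) }
    ; behind = λ { _ (here refl) _ → ℤ.≤-reflexive x≡ ; _ (there m) f → ⊥-elim (lin 1 1 (λ x m → x :≤ nat m ⇒ x :≡ nat (suc m) ⇒ ⊢ absurd) refl (topmost m) f) }
    ; foot = pos r , there (pos∈ r) , lin 1 1 (λ x m → x :≡ ⊝ nat m ⇒ ⊢ x :≡ ⊝ nat (m ⊕ con 0)) refl x≡ , lin 1 1 (λ x m → x :≡ nat m ⊖ con 0ℤ ⇒ ⊢ x :< nat (suc m)) refl y≡ }
  where open Exc v
step-sound lift v = allowed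
    (λ m f → ≤-≡-trans (topmost m) y≡)
    (inj₁ λ { (here refl) → ℤ.≤-refl ; (there m) → lin 2 1 (λ x y m → x :≤ nat m ⇒ y :≡ nat m ⇒ ⊢ x :≤ y ⊕ con 1ℤ) refl (topmost m) y≡ })
    (proj₁ vertical-no-corner) ,
  record
    { heading≡ = refl ; x≡ = x≡ ; y≡ = lin 1 1 (λ x m → x :≡ nat m ⇒ ⊢ x ⊕ con 1ℤ :≡ nat (suc m)) refl y≡ ; positive = s≤s z≤n
    ; westmost = λ { (here refl) → lin 1 2 (λ x m n → x :≡ ⊝ nat m ⇒ ⊢ ⊝ nat (m ⊕ n) :≤ x) refl x≡ ; (there m) → westmost m }
    ; eastmost = λ { (here refl) → eastmost (pos∈ _) ; (there m) → eastmost m }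
    ; topmost = λ { (here refl) → lin 1 1 (λ x m → x :≡ nat m ⇒ ⊢ x ⊕ con 1ℤ :≤ nat (suc m)) refl y≡ ; (there m) → lin 1 1 (λ x m → x :≤ nat m ⇒ ⊢ x :≤ nat (suc m)) refl (topmost m) }
    ; ahead = λ { _ (here refl) _ → ℤ.≤-reflexive (sym x≡) ; _ (there m) f → ⊥-elim (lin 1 1 (λ x m → x :≤ nat m ⇒ x :≡ nat (suc m) ⇒ ⊢ absurd) refl (topmost m) f) }
    ; behind = λ { _ (here refl) _ → ℤ.≤-reflexive x≡ ; _ (there m) f → ⊥-elim (lin 1 1 (λ x m → x :≤ nat m ⇒ x :≡ nat (suc m) ⇒ ⊢ absurd) refl (topmost m) f) }
    ; foot = let p , m , e , u = foot in p , there m , e , lin 1 1 (λ x m → x :< nat m ⇒ ⊢ x :< nat (suc m)) refl u }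
  where open Top v
step-sound {r = r} (back h) v = allowed
    (λ m f → lin 2 1 (λ x y m → x :≤ ⊝ nat (suc m) ⇒ y :≡ ⊝ nat (suc m) ⇒ ⊢ x :≤ y) refl (behind h m (trans f y≡)) x≡)
    (inj₁ λ { (here refl) → ℤ.≤-refl ; (there m) → ≤-≡-trans (topmost m) y≡ })
    -- The origin lies below this row, which is therefore not the bottom row; likewise for the other
    -- steps along a crest.
    (λ c → lin 1 1 (λ x m → x :≤ con 0ℤ ⇒ x :≡ nat m ⇒ con 1 :≤ⁿ m ⇒ ⊢ absurd) refl (Corner.lowest c (origin∈ r)) y≡ positive) ,
  record
    { heading≡ = refl ; x≡ = lin 1 1 (λ x m → x :≡ ⊝ nat (suc m) ⇒ ⊢ x ⊕ con 1ℤ :≡ ⊝ nat m) refl x≡ ; y≡ = y≡ ; positive = positive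
    ; westmost = λ { (here refl) → lin 1 2 (λ x m n → x :≡ ⊝ nat (suc m) ⇒ ⊢ ⊝ nat (m ⊕ suc n) :≤ x ⊕ con 1ℤ) refl x≡ ; (there m) → lin 1 2 (λ x m n → ⊝ nat (suc (m ⊕ n)) :≤ x ⇒ ⊢ ⊝ nat (m ⊕ suc n) :≤ x) refl (westmost m) }
    ; eastmost = λ { (here refl) → lin 1 1 (λ x m → x :≡ ⊝ nat (suc m) ⇒ ⊢ x ⊕ con 1ℤ :≤ con 0ℤ) refl x≡ ; (there m) → eastmost m }
    ; topmost = λ { (here refl) → ℤ.≤-reflexive y≡ ; (there m) → topmost m }
    ; ahead = λ q → ⊥-elim (q refl)
    ; behind = λ { _ (here refl) _ → lin 1 1 (λ x m → x :≡ ⊝ nat (suc m) ⇒ ⊢ x ⊕ con 1ℤ :≤ ⊝ nat m) refl x≡ ; _ (there m) f → lin 1 1 (λ x m → x :≤ ⊝ nat (suc m) ⇒ ⊢ x :≤ ⊝ nat m) refl (behind h m f) }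
    ; foot = let p , m , e , u = foot in p , there m , lin 1 2 (λ x m n → x :≡ ⊝ nat (suc (m ⊕ n)) ⇒ ⊢ x :≡ ⊝ nat (m ⊕ suc n)) refl e , u }
  where open Top v
step-sound {r = r} (forth h) v = allowed
    (λ m f → ≡-≤-trans x≡ (ahead h m (trans f y≡)))
    (inj₁ λ { (here refl) → ℤ.≤-refl ; (there m) → ≤-≡-trans (topmost m) y≡ })
    (λ c → lin 1 1 (λ x m → x :≤ con 0ℤ ⇒ x :≡ nat m ⇒ con 1 :≤ⁿ m ⇒ ⊢ absurd) refl (Corner.lowest c (origin∈ r)) y≡ positive) ,
  record
    { heading≡ = refl ; x≡ = lin 1 1 (λ x m → x :≡ ⊝ nat m ⇒ ⊢ x ⊖ con 1ℤ :≡ ⊝ nat (suc m)) refl x≡ ; y≡ = y≡ ; positive = positive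
    ; westmost = λ { (here refl) → lin 1 2 (λ x m n → x :≡ ⊝ nat m ⇒ ⊢ ⊝ nat (suc (m ⊕ n)) :≤ x ⊖ con 1ℤ) refl x≡ ; (there m) → lin 1 2 (λ x m n → ⊝ nat (m ⊕ suc n) :≤ x ⇒ ⊢ ⊝ nat (suc (m ⊕ n)) :≤ x) refl (westmost m) }
    ; eastmost = λ { (here refl) → lin 1 1 (λ x m → x :≡ ⊝ nat m ⇒ ⊢ x ⊖ con 1ℤ :≤ con 0ℤ) refl x≡ ; (there m) → eastmost m }
    ; topmost = λ { (here refl) → ℤ.≤-reflexive y≡ ; (there m) → topmost m }
    ; ahead = λ { _ (here refl) _ → lin 1 1 (λ x m → x :≡ ⊝ nat m ⇒ ⊢ ⊝ nat (suc m) :≤ x ⊖ con 1ℤ) refl x≡ ; _ (there m) f → lin 1 1 (λ x m → ⊝ nat m :≤ x ⇒ ⊢ ⊝ nat (suc m) :≤ x) refl (ahead h m f) }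
    ; behind = λ q → ⊥-elim (q refl)
    ; foot = let p , m , e , u = foot in p , there m , lin 1 2 (λ x m n → x :≡ ⊝ nat (m ⊕ suc n) ⇒ ⊢ x :≡ ⊝ nat (suc (m ⊕ n))) refl e , u }
  where open Top v
step-sound {r = r} (over h) v = allowed
    (λ m f → ≡-≤-trans x≡ (ahead h m (trans f y≡)))
    (inj₁ λ { (here refl) → ℤ.≤-refl ; (there m) → ≤-≡-trans (topmost m) y≡ })
    (λ c → lin 1 1 (λ x m → x :≤ con 0ℤ ⇒ x :≡ nat m ⇒ con 1 :≤ⁿ m ⇒ ⊢ absurd) refl (Corner.lowest c (origin∈ r)) y≡ positive) ,
  record
    { heading≡ = refl ; x≡ = lin 1 1 (λ x m → x :≡ ⊝ nat m ⇒ ⊢ x ⊖ con 1ℤ :≡ ⊝ nat (suc m)) refl x≡ ; y≡ = lin 1 1 (λ x m → x :≡ nat m ⇒ ⊢ x :≡ nat m ⊖ con 0ℤ) refl y≡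
    ; westmost = λ { (here refl) → lin 1 1 (λ x m → x :≡ ⊝ nat m ⇒ ⊢ ⊝ nat (suc m) :≤ x ⊖ con 1ℤ) refl x≡ ; (there m) → lin 1 1 (λ x m → ⊝ nat (m ⊕ con 0) :≤ x ⇒ ⊢ ⊝ nat (suc m) :≤ x) refl (westmost m) }
    ; eastmost = λ { (here refl) → lin 1 1 (λ x m → x :≡ ⊝ nat m ⇒ ⊢ x ⊖ con 1ℤ :≤ con 0ℤ) refl x≡ ; (there m) → eastmost m }
    ; topmost = λ { (here refl) → ℤ.≤-reflexive y≡ ; (there m) → topmost m }
    ; below = λ { _ (here refl) _ → ℤ.≤-refl ; _ (there m) f → ⊥-elim (lin 1 1 (λ x m → ⊝ nat (m ⊕ con 0) :≤ x ⇒ x :≡ ⊝ nat (suc m) ⇒ ⊢ absurd) refl (westmost m) f) }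
    ; above = λ { _ (here refl) _ → ℤ.≤-refl ; _ (there m) f → ⊥-elim (lin 1 1 (λ x m → ⊝ nat (m ⊕ con 0) :≤ x ⇒ x :≡ ⊝ nat (suc m) ⇒ ⊢ absurd) refl (westmost m) f) }
    ; crown = pos r , there (pos∈ r) , y≡ , inj₂ (lin 1 1 (λ x m → x :≡ ⊝ nat m ⇒ ⊢ ⊝ nat (suc m) :< x) refl x≡)
    ; flat = λ () }
  where open Top v
step-sound {r = r} (exit h) v = allowed
    (λ m f → lin 2 0 (λ x y → x :≤ ⊝ con 0ℤ ⇒ y :≡ ⊝ con 0ℤ ⇒ ⊢ x :≤ y) refl (behind h m (trans f y≡)) x≡)
    (inj₁ λ { (here refl) → ℤ.≤-refl ; (there m) → ≤-≡-trans (topmost m) y≡ })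
    (λ c → lin 1 1 (λ x m → x :≤ con 0ℤ ⇒ x :≡ nat m ⇒ con 1 :≤ⁿ m ⇒ ⊢ absurd) refl (Corner.lowest c (origin∈ r)) y≡ positive) ,
  record
    { x≡ = lin 1 0 (λ x → x :≡ ⊝ con 0ℤ ⇒ ⊢ x ⊕ con 1ℤ :≡ con 1ℤ) refl x≡ ; y≡ = y≡
    ; eastmost = λ { (here refl) → lin 1 0 (λ x → x :≡ ⊝ con 0ℤ ⇒ ⊢ x ⊕ con 1ℤ :≤ con 1ℤ) refl x≡ ; (there m) → lin 1 0 (λ x → x :≤ con 0ℤ ⇒ ⊢ x :≤ con 1ℤ) refl (eastmost m) }
    ; below = λ { (here refl) _ → lin 1 1 (λ x m → x :≡ nat m ⇒ ⊢ nat m :≤ x) refl y≡ ; (there m) f → ⊥-elim (lin 1 0 (λ x → x :≤ con 0ℤ ⇒ x :≡ con 1ℤ ⇒ ⊢ absurd) refl (eastmost m) f) } }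
  where open Top v
step-sound fall v = allowed
    (λ m f → lin 2 1 (λ x y m → nat (suc m) :≤ y ⇒ x :≡ nat (suc m) ⇒ ⊢ x :≤ y) refl (below m (trans f x≡)) y≡)
    (inj₂ (inj₁ λ { (here refl) → ℤ.≤-refl ; (there m) → lin 2 0 (λ x y → x :≤ con 1ℤ ⇒ y :≡ con 1ℤ ⇒ ⊢ x :≤ y) refl (eastmost m) x≡ }))
    (proj₂ vertical-no-corner) ,
  record
    { x≡ = x≡ ; y≡ = lin 1 1 (λ x m → x :≡ nat (suc m) ⇒ ⊢ x ⊖ con 1ℤ :≡ nat m) refl y≡
    ; eastmost = λ { (here refl) → lin 1 0 (λ x → x :≡ con 1ℤ ⇒ ⊢ x :≤ con 1ℤ) refl x≡ ; (there m) → eastmost m }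
    ; below = λ { (here refl) _ → lin 1 1 (λ x m → x :≡ nat (suc m) ⇒ ⊢ nat m :≤ x ⊖ con 1ℤ) refl y≡ ; (there m) f → lin 1 1 (λ x m → nat (suc m) :≤ x ⇒ ⊢ nat m :≤ x) refl (below m f) } }
  where open Fin v

run-sound : ∀ {r s} → Run r s → Legal r × Inv s r
run-sound [] = [] , initial-inv
run-sound (st ∷ rn) with run-sound rn
... | lr , v with step-sound st v
... | a , v′ = (a ∷ lr) , v′

no-reversal : ∀ {r} → Clear r north → heading r ≢ south
no-reversal {south ∷ r} c refl = ≰-pred (c (there (pos∈ r)) (refl))

no-reversal′ : ∀ {r} → Clear r south → heading r ≢ north
no-reversal′ {north ∷ r} c refl = suc-≰ (c (there (pos∈ r)) (refl))

-- The condition on the height excludes the empty walk, whose heading is west by convention although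
-- there is no step to reverse.
no-reversal-east : ∀ {r} → Y r ≢ 0ℤ → Clear r east → heading r ≢ west
no-reversal-east {[]} h c = λ _ → h refl
no-reversal-east {west ∷ r} h c refl = ≰-pred (c (there (pos∈ r)) (refl))

no-reversal-west : ∀ {r} → Clear r west → heading r ≢ east
no-reversal-west {east ∷ r} c refl = suc-≰ (c (there (pos∈ r)) (refl))

-- The case to exclude is a step east. From x = 0 it leaves the half-plane, and in the top row
-- `crown` lies ahead. Lower down, the new end is on neither the north nor the west side, hence on
-- the east side; since x ≤ 0 and the origin is in the box, this forces a box of width one, and
-- `width-one` applies.
exc-complete : ∀ {w t e n d r} d′ → Legal r → Exc w t e d r → Allowed r d′ → X (d′ ∷ r) ℤ.≤ 0ℤ →
               ∃[ s ] Step (exc w t e n d) d′ s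
exc-complete north lr v a _ with no-reversal (Allowed.clear a)
exc-complete {e = zero}  north lr v a _ | h = _ , rise λ q → h (trans (Exc.heading≡ v) q)
exc-complete {e = suc _} north lr v a _ | h = _ , climb λ q → h (trans (Exc.heading≡ v) q)
exc-complete south lr v a _ = _ , dig λ q → no-reversal′ (Allowed.clear a) (trans (Exc.heading≡ v) q)
exc-complete west lr v a _ = _ , col
exc-complete {w} {t} {e} {r = r} east lr v a x≤0 = ⊥-elim (blocked e refl crown)
  where
  open Exc v
  blocked : ∀ e′ → e ≡ e′ → (∃[ p ] p ∈ trail r × proj₂ p ≡ + t × (w ≡ 0 ⊎ ℤ.- + w ℤ.< proj₁ p)) → ⊥
  blocked _ _ (p , m , f , inj₁ refl) = lin 1 0 (λ x → x :≡ ⊝ con 0ℤ ⇒ x ⊕ con 1ℤ :≤ con 0ℤ ⇒ ⊢ absurd) refl x≡ x≤0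
  blocked zero refl (p , m , f , inj₂ u) = lin 2 1 (λ x y m → x :≤ y ⇒ ⊝ nat m :< x ⇒ y :≡ ⊝ nat m ⇒ ⊢ absurd) refl (Allowed.clear a m (lin 2 1 (λ x y m → x :≡ nat m ⇒ y :≡ nat m ⊖ con 0ℤ ⇒ ⊢ x :≡ y) refl f y≡)) u x≡
  blocked (suc e′) refl (p , m , f , inj₂ u) = sides (Allowed.side a)
    where
    narrow : X (east ∷ r) ≡ 0ℤ → ∀ {p} → p ∈ trail r → proj₁ p ≡ X r ⊎ proj₁ p ≡ X (east ∷ r)
    narrow g m = two-values
      (≡-≤-trans x≡ (westmost m))
      (lin 2 0 (λ x y → x :≤ con 0ℤ ⇒ y :≡ con 0ℤ ⇒ ⊢ x :≤ y) refl (eastmost m) g)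
    sides : Side (east ∷ r) → ⊥
    sides (inj₁ n) = lin 2 2 (λ x y m n → x :≤ y ⇒ x :≡ nat m ⇒ y :≡ nat m ⊖ nat (suc n) ⇒ ⊢ absurd) refl (n (there m)) f y≡
    sides (inj₂ (inj₁ s)) = width-one lr a east (narrow g) (origin , origin∈ r , sym g) (p , m , lin 2 2 (λ x y m n → y :≡ nat m ⇒ x :≡ nat m ⊖ nat (suc n) ⇒ ⊢ x :< y) refl f y≡)
      where
      g : X (east ∷ r) ≡ 0ℤ
      g = ℤ.≤-antisym x≤0 (s (there (origin∈ r)))
    sides (inj₂ (inj₂ s)) = suc-≰ (s (there (pos∈ r)))

-- A step south leaves the top row, so it would have to end on the east or the west side, where the
-- origin or `foot` lies straight below.
top-complete : ∀ {i k t n d r} d′ → Top i k t d r → Allowed r d′ → ∃[ s ] Step (crest i k t n d) d′ s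
top-complete north v a = _ , lift
top-complete {i} {k} {t} {d = d} {r} south v a = ⊥-elim (sides (Allowed.side a))
  where
  open Top v
  sides : Side (south ∷ r) → ⊥
  sides (inj₁ n) = ≰-pred (n (there (pos∈ r)))
  sides (inj₂ (inj₁ s)) = lin 1 1 (λ x m → x :≤ con 0ℤ ⇒ x :≡ nat m ⇒ con 1 :≤ⁿ m ⇒ ⊢ absurd) refl (Allowed.clear a (origin∈ r) (ℤ.≤-antisym (s (there (origin∈ r))) (eastmost (pos∈ r)))) y≡ positive
  sides (inj₂ (inj₂ s)) = let p , m , e , u = foot in
    lin 2 1 (λ x y m → x :≤ y ⇒ x :≡ nat m ⇒ y :< nat m ⇒ ⊢ absurd) refl (Allowed.clear a m (ℤ.≤-antisym (lin 2 2 (λ x y m n → x :≡ ⊝ nat (m ⊕ n) ⇒ y :≡ ⊝ nat m ⇒ ⊢ x :≤ y) refl e x≡) (s (there m)))) y≡ u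
top-complete {i} {k} {t} {n} {d} {r} east v a = go i
  where
  open Top v
  y≢0 : Y r ≢ 0ℤ
  y≢0 q = lin 1 1 (λ x m → x :≡ con 0ℤ ⇒ x :≡ nat m ⇒ con 1 :≤ⁿ m ⇒ ⊢ absurd) refl q y≡ positive
  h : d ≢ west
  h q = no-reversal-east y≢0 (Allowed.clear a) (trans heading≡ q)
  go : ∀ i → ∃[ s ] Step (crest i k t n d) east s
  go zero    = _ , exit h
  go (suc i) = _ , back h
top-complete {i} {k} {t} {n} {d} {r} west v a = go k
  where
  open Top v
  h : d ≢ east
  h q = no-reversal-west (Allowed.clear a) (trans heading≡ q)
  go : ∀ k → ∃[ s ] Step (crest i k t n d) west s
  go zero    = _ , over h
  go (suc k) = _ , forth h

-- The half-plane excludes `fin`, whose column is x = 1; the two preceding lemmas treat the other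
-- states.
run-complete : ∀ {r} → Legal r → (∀ {p} → p ∈ trail r → proj₁ p ℤ.≤ 0ℤ) → ∃[ s ] Run r s × Inv s r
run-complete [] _ = _ , [] , initial-inv
run-complete {d ∷ r} (a ∷ lr) b with run-complete lr (λ m → b (there m))
... | exc w t e n d′ , rn , v with exc-complete d lr v a (b (here refl))
...   | s , st = s , st ∷ rn , proj₂ (step-sound st v)
run-complete {d ∷ r} (a ∷ lr) b | crest i k t n d′ , rn , v with top-complete d v a
...   | s , st = s , st ∷ rn , proj₂ (step-sound st v)
run-complete {d ∷ r} (a ∷ lr) b | fin y n , rn , v = ⊥-elim (lin 1 0 (λ x → x :≡ con 1ℤ ⇒ x :≤ con 0ℤ ⇒ ⊢ absurd) refl (Fin.x≡ v) (b (there (pos∈ r))))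

-- Classification of the polygons

flip : Dir → Dir
flip north = north
flip south = south
flip east  = west
flip west  = east

mirror : List Dir → List Dir
mirror = map flip

reflect : Point → Point
reflect (x , y) = ℤ.- x , y

flip-involutive : ∀ d → flip (flip d) ≡ d
flip-involutive north = refl
flip-involutive south = refl
flip-involutive east  = refl
flip-involutive west  = refl

mirror-involutive : ∀ r → mirror (mirror r) ≡ r
mirror-involutive []      = refl
mirror-involutive (d ∷ r) = cong₂ _∷_ (flip-involutive d) (mirror-involutive r)

reflect-involutive : ∀ p → reflect (reflect p) ≡ p
reflect-involutive (x , y) = cong (_, y) (ℤ.neg-involutive x)

step-reflect : ∀ p d → step (reflect p) (flip d) ≡ reflect (step p d)
step-reflect p north = refl
step-reflect p south = refl
step-reflect p east  = cong (_, proj₂ p) (lin 1 0 (λ x → ⊢ ⊝ x ⊖ con 1ℤ :≡ ⊝ (x ⊕ con 1ℤ)) refl {proj₁ p})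
step-reflect p west  = cong (_, proj₂ p) (lin 1 0 (λ x → ⊢ ⊝ x ⊕ con 1ℤ :≡ ⊝ (x ⊖ con 1ℤ)) refl {proj₁ p})

pos-mirror : ∀ r → pos (mirror r) ≡ reflect (pos r)
pos-mirror []      = refl
pos-mirror (d ∷ r) = trans (cong (λ p → step p (flip d)) (pos-mirror r)) (step-reflect (pos r) d)

∈-mirror : ∀ r {p} → p ∈ trail (mirror r) → reflect p ∈ trail r
∈-mirror []      (here refl) = here refl
∈-mirror (d ∷ r) (here refl) = here (trans (cong reflect (pos-mirror (d ∷ r))) (reflect-involutive (pos (d ∷ r))))
∈-mirror (d ∷ r) (there m)   = there (∈-mirror r m)

mirror-∈ : ∀ r {p} → p ∈ trail r → reflect p ∈ trail (mirror r)
mirror-∈ []      (here refl) = here refl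
mirror-∈ (d ∷ r) (here refl) = here (sym (pos-mirror (d ∷ r)))
mirror-∈ (d ∷ r) (there m)   = there (mirror-∈ r m)

X-mirror : ∀ r → X (mirror r) ≡ ℤ.- X r
X-mirror r = cong proj₁ (pos-mirror r)

Y-mirror : ∀ r → Y (mirror r) ≡ Y r
Y-mirror r = cong proj₂ (pos-mirror r)

clear-mirror : ∀ r d → Clear r d → Clear (mirror r) (flip d)
clear-mirror r north c m e = ≤-≡-trans (c (∈-mirror r m) (lin 3 0 (λ x y z → x :≡ z ⇒ z :≡ ⊝ y ⇒ ⊢ ⊝ x :≡ y) refl e (X-mirror r))) (Y-mirror r)
clear-mirror r south c m e = lin 3 0 (λ x y z → z :≤ y ⇒ x :≡ z ⇒ ⊢ x :≤ y) refl (c (∈-mirror r m) (lin 3 0 (λ x y z → x :≡ z ⇒ z :≡ ⊝ y ⇒ ⊢ ⊝ x :≡ y) refl e (X-mirror r))) (Y-mirror r)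
clear-mirror r east  c m e = lin 3 0 (λ x y z → ⊝ y :≤ z ⇒ x :≡ ⊝ z ⇒ ⊢ x :≤ y) refl (c (∈-mirror r m) (trans e (Y-mirror r))) (X-mirror r)
clear-mirror r west  c m e = lin 3 0 (λ x y z → z :≤ ⊝ x ⇒ y :≡ ⊝ z ⇒ ⊢ x :≤ y) refl (c (∈-mirror r m) (trans e (Y-mirror r))) (X-mirror r)

side-mirror : ∀ r → Side r → Side (mirror r)
side-mirror r (inj₁ s)        = inj₁ λ m → ≤-≡-trans (s (∈-mirror r m)) (Y-mirror r)
side-mirror r (inj₂ (inj₁ s)) = inj₂ (inj₂ λ m → lin 3 0 (λ x y z → ⊝ y :≤ z ⇒ x :≡ ⊝ z ⇒ ⊢ x :≤ y) refl (s (∈-mirror r m)) (X-mirror r))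
side-mirror r (inj₂ (inj₂ s)) = inj₂ (inj₁ λ m → lin 3 0 (λ x y z → z :≤ ⊝ x ⇒ y :≡ ⊝ z ⇒ ⊢ x :≤ y) refl (s (∈-mirror r m)) (X-mirror r))

corner-mirror : ∀ r d → Corner (mirror r) (flip d) → Corner r d
corner-mirror r d c = record
  { level = lin 4 0 (λ x y z u → z :≡ u ⇒ u :≡ y ⇒ z :≡ x ⇒ ⊢ x :≡ y) refl level (Y-mirror r) (Y-mirror (d ∷ r))
  ; lowest = λ m → lin 3 0 (λ x y z → z :≤ y ⇒ z :≡ x ⇒ ⊢ x :≤ y) refl (lowest (mirror-∈ r m)) (Y-mirror r)
  ; taller = let p , m , u = taller in reflect p , ∈-mirror r m , lin 3 0 (λ x y z → z :< y ⇒ z :≡ x ⇒ ⊢ x :< y) refl u (Y-mirror r)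
  ; opposite = let p , m , e = opposite in reflect p , ∈-mirror r m , lin 3 0 (λ x y z → x :≡ z ⇒ z :≡ ⊝ y ⇒ ⊢ ⊝ x :≡ y) refl e (X-mirror (d ∷ r))
  ; narrow = λ {p} m → narrow′ {p} (narrow (mirror-∈ r m)) }
  where
  open Corner c
  narrow′ : ∀ {p : Point} → ℤ.- proj₁ p ≡ X (mirror r) ⊎ ℤ.- proj₁ p ≡ X (mirror (d ∷ r)) →
            proj₁ p ≡ X r ⊎ proj₁ p ≡ X (d ∷ r)
  narrow′ (inj₁ e) = inj₁ (lin 3 0 (λ x y z → ⊝ x :≡ z ⇒ z :≡ ⊝ y ⇒ ⊢ x :≡ y) refl e (X-mirror r))
  narrow′ (inj₂ e) = inj₂ (lin 3 0 (λ x y z → ⊝ x :≡ z ⇒ z :≡ ⊝ y ⇒ ⊢ x :≡ y) refl e (X-mirror (d ∷ r)))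

allowed-mirror : ∀ {r d} → Allowed r d → Allowed (mirror r) (flip d)
allowed-mirror {r} {d} (allowed c s k) =
  allowed (clear-mirror r d c) (side-mirror (d ∷ r) s) (λ c′ → k (corner-mirror r d c′))

legal-mirror : ∀ {r} → Legal r → Legal (mirror r)
legal-mirror []       = []
legal-mirror (a ∷ lr) = allowed-mirror a ∷ legal-mirror lr

legal-side : ∀ {r} → Legal r → Side r
legal-side []      = inj₁ λ { (here refl) → ℤ.≤-refl }
legal-side (a ∷ _) = Allowed.side a

-- To come back from x = 1 to x = 0 below the row of the origin, the walk would have to
-- step between the southern corners of a box of width one.
no-return : ∀ {r} → Legal r → (∀ {p} → p ∈ trail r → proj₂ p ℤ.≤ 0ℤ) →
            (∀ {p} → p ∈ trail r → proj₁ p ℤ.≤ 0ℤ) ⊎ 1ℤ ℤ.≤ X r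
no-return [] _ = inj₁ λ { (here refl) → ℤ.≤-refl }
no-return {d ∷ r} (a ∷ lr) b with no-return lr (λ m → b (there m))
... | inj₁ h with ≤⊎> (X (d ∷ r)) 0ℤ
...   | inj₁ u = inj₁ λ { (here refl) → u ; (there m) → h m }
...   | inj₂ u = inj₂ (lin 1 0 (λ x → con 0ℤ :< x ⇒ ⊢ con 1ℤ :≤ x) refl u)
no-return {d ∷ r} (a ∷ lr) b | inj₂ g = inj₂ (go d a)
  where
  go : ∀ d → Allowed r d → 1ℤ ℤ.≤ X (d ∷ r)
  go north a = g
  go south a = g
  go east  a = lin 1 0 (λ x → con 1ℤ :≤ x ⇒ ⊢ con 1ℤ :≤ x ⊕ con 1ℤ) refl g
  go west  a with ≤⊎> 1ℤ (X (west ∷ r))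
  ... | inj₁ u = u
  ... | inj₂ u = ⊥-elim (sides (Allowed.side a) (legal-side lr))
    where
    x≡ : X r ≡ 1ℤ
    x≡ = lin 1 0 (λ x → x ⊕ con -1ℤ :< con 1ℤ ⇒ con 1ℤ :≤ x ⇒ ⊢ x :≡ con 1ℤ) refl u g
    deep : ¬ (0ℤ ℤ.≤ Y r)
    deep h = lin 1 0 (λ x → x :≤ con 0ℤ ⇒ x :≡ con 1ℤ ⇒ ⊢ absurd) refl (Allowed.clear a (origin∈ r) (lin 1 0 (λ x → con 0ℤ :≤ x ⇒ x :≤ con 0ℤ ⇒ ⊢ con 0ℤ :≡ x) refl h (b (there (pos∈ r))))) x≡
    sides : Side (west ∷ r) → Side r → ⊥
    sides (inj₁ s) _ = deep (s (there (origin∈ r)))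
    sides (inj₂ (inj₁ s)) _ = ≰-pred (s (there (pos∈ r)))
    sides (inj₂ (inj₂ s)) (inj₁ s′) = deep (s′ (origin∈ r))
    sides (inj₂ (inj₂ s)) (inj₂ (inj₂ s′)) = lin 1 0 (λ x → x :≤ con 0ℤ ⇒ x :≡ con 1ℤ ⇒ ⊢ absurd) refl (s′ (origin∈ r)) x≡
    sides (inj₂ (inj₂ s)) (inj₂ (inj₁ s′)) =
      width-one lr a west narrow (origin , origin∈ r , lin 1 0 (λ x → x :≡ con 1ℤ ⇒ ⊢ con 0ℤ :≡ x ⊖ con 1ℤ) refl x≡) (origin , origin∈ r , ℤ.≰⇒> deep)
      where
      narrow : ∀ {p} → p ∈ trail r → proj₁ p ≡ X r ⊎ proj₁ p ≡ X (west ∷ r)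
      narrow m with two-values (s (there m)) (lin 2 0 (λ x y → x :≤ y ⇒ ⊢ x :≤ y ⊖ con 1ℤ ⊕ con 1ℤ) refl (s′ m))
      ... | inj₁ e = inj₂ e
      ... | inj₂ e = inj₁ (lin 2 0 (λ x y → x :≡ y ⊕ con -1ℤ ⊕ con 1ℤ ⇒ ⊢ x :≡ y) refl e)

-- A hanging bargraph ends at (0 , 1), one cell short of the walk closed up as above.
data Accept : State → ℕ → Set where
  around  : ∀ {n} → Accept (fin 0 n) n
  hanging : ∀ {k n} → Accept (crest 0 k 1 (suc n) east) n
  column  : ∀ {n} → Accept (exc 1 0 0 n north) n

Accepted : ℕ → List Dir → Set
Accepted n r = ∃[ s ] Run r s × Accept s n

-- A vertex with x > 0 would yield one at x = 1. Clearance to the south and to the east puts that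
-- vertex strictly above the end of `u`, so `u` ends on the west side of its box. Between the origin
-- and that vertex the walk has already met its present row; clearance to the east and the west side
-- force this meeting to be the present end, against self-avoidance.
west-half : ∀ {y u} → Legal u → Allowed u east → Clear (east ∷ u) south → X u ≡ 0ℤ → Y u ≡ + suc y →
            ∀ {p} → p ∈ trail u → proj₁ p ℤ.≤ 0ℤ
west-half {y} {u} lu a c₂ x≡ y≡ with all-or-any {P = λ p → proj₁ p ℤ.≤ 0ℤ} {Q = λ p → 0ℤ ℤ.< proj₁ p} (λ p → ≤⊎> (proj₁ p) 0ℤ) (trail u)
... | inj₁ h = h
... | inj₂ (p , m , g) with Columns.between u 1ℤ (origin∈ u) m (ℤ.+≤+ z≤n) (ℤ.i<j⇒suc[i]≤j g)
...   | q , mq , e = ⊥-elim (earlier lu (legal-side lu) mq refl)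
  where
  high : Y u ℤ.< proj₂ q
  high = ℤ.≤∧≢⇒< (c₂ (there mq) (lin 2 0 (λ x y → x :≡ con 1ℤ ⇒ y :≡ con 0ℤ ⇒ ⊢ x :≡ y ⊕ con 1ℤ) refl e x≡)) λ f → lin 2 0 (λ x y → x :≤ y ⇒ x :≡ con 1ℤ ⇒ y :≡ con 0ℤ ⇒ ⊢ absurd) refl (Allowed.clear a mq (sym f)) e x≡
  earlier : ∀ {u′} → Legal u′ → Side u′ → q ∈ trail u′ → u′ ≡ u → ⊥
  earlier [] _ _ refl = lin 0 1 (λ m → con 0ℤ :≡ nat (suc m) ⇒ ⊢ absurd) refl y≡
  earlier (_ ∷ _) _ (here refl) refl = ℤ.<-irrefl refl high
  earlier (_ ∷ _) (inj₁ s) m refl = ℤ.<⇒≱ high (s m)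
  earlier (_ ∷ _) (inj₂ (inj₁ s)) m refl = lin 2 0 (λ x y → x :≤ y ⇒ y :≡ con 0ℤ ⇒ x :≡ con 1ℤ ⇒ ⊢ absurd) refl (s m) x≡ e
  earlier {d ∷ u′} (a′ ∷ _) (inj₂ (inj₂ s)) (there m) refl
    with Rows.between u′ (Y u) (origin∈ u′) m (lin 1 1 (λ x m → x :≡ nat (suc m) ⇒ ⊢ con 0ℤ :≤ x) refl y≡) (ℤ.<⇒≤ high)
  ... | q′ , m′ , e′ = fresh d (Allowed.clear a′)
    (subst (_∈ trail u′) (cong₂ _,_ (ℤ.≤-antisym (Allowed.clear a (there m′) e′) (s (there m′))) e′) m′)

-- Traced backwards, the run south was entered by an east step from x = 0: after a west step
-- followed by a south step the walk would be on none of the three sides, the origin lying to its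
-- west. What precedes the east step is confined by `west-half`, so that `run-complete` applies.
descend : ∀ {y} r → Legal (south ∷ r) → X r ≡ 1ℤ → Y r ≡ + suc y → ∃[ n ] Run r (fin (suc y) n)
descend [] _ () _
descend (north ∷ r) (a ∷ _) _ _ = ⊥-elim (no-reversal′ {north ∷ r} (Allowed.clear a) refl)
descend {y} (south ∷ r) (_ ∷ lr) x≡ y≡ with descend {suc y} r lr x≡ (lin 1 1 (λ x m → x ⊖ con 1ℤ :≡ nat (suc m) ⇒ ⊢ x :≡ nat (suc (suc m))) refl y≡)
... | n , rn = n , fall ∷ rn
descend (west ∷ r) (a ∷ lr) x≡ y≡ = ⊥-elim (sides (legal-side lr) (Allowed.side a))
  where
  sides : Side (west ∷ r) → Side (south ∷ west ∷ r) → ⊥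
  sides (inj₂ (inj₁ s)) _ = ≰-pred (s (there (pos∈ r)))
  sides (inj₂ (inj₂ s)) _ = lin 1 0 (λ x → x ⊖ con 1ℤ :≤ con 0ℤ ⇒ x ⊖ con 1ℤ :≡ con 1ℤ ⇒ ⊢ absurd) refl {X r} (s (there (origin∈ r))) x≡
  sides (inj₁ _) (inj₁ s) = ≰-pred (s (there (there (pos∈ r))))
  sides (inj₁ _) (inj₂ (inj₁ s)) = ≰-pred (s (there (there (pos∈ r))))
  sides (inj₁ _) (inj₂ (inj₂ s)) = lin 1 0 (λ x → x ⊖ con 1ℤ :≤ con 0ℤ ⇒ x ⊖ con 1ℤ :≡ con 1ℤ ⇒ ⊢ absurd) refl {X r} (s (there (there (origin∈ r)))) x≡
descend {y} (east ∷ u) (a₂ ∷ a ∷ lu) x≡ y≡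
  with run-complete lu (west-half lu a (Allowed.clear a₂) (lin 1 0 (λ x → x ⊕ con 1ℤ :≡ con 1ℤ ⇒ ⊢ x :≡ con 0ℤ) refl x≡) y≡)
... | exc zero t e n d , rn , v = ⊥-elim (lin 1 3 (λ x m n k → x :≡ nat m ⊖ nat n ⇒ x :≡ nat (suc k) ⇒ m :≡ⁿ con 0 ⇒ ⊢ absurd) refl {_} {t} {e} (Exc.y≡ v) y≡ (Exc.flat v refl))
... | exc (suc w) t e n d , rn , v = ⊥-elim (lin 1 1 (λ x m → x :≡ ⊝ nat (suc m) ⇒ x ⊕ con 1ℤ :≡ con 1ℤ ⇒ ⊢ absurd) refl (Exc.x≡ v) x≡)
... | fin y n , rn , v = ⊥-elim (lin 1 0 (λ x → x :≡ con 1ℤ ⇒ x ⊕ con 1ℤ :≡ con 1ℤ ⇒ ⊢ absurd) refl (Fin.x≡ v) x≡)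
... | crest (suc i) k t n d , rn , v = ⊥-elim (lin 1 1 (λ x m → x :≡ ⊝ nat (suc m) ⇒ x ⊕ con 1ℤ :≡ con 1ℤ ⇒ ⊢ absurd) refl (Top.x≡ v) x≡)
... | crest zero k t n d , rn , v with top-complete {n = n} east v a | t≡
  where
  t≡ : t ≡ suc y
  t≡ = lin 1 2 (λ x m n → x :≡ nat m ⇒ x :≡ nat (suc n) ⇒ ⊢ m :≡ⁿ suc n) refl (Top.y≡ v) y≡
...   | _ , exit h | refl = n , exit h ∷ rn

-- A run of width zero is vertical, hence fixed by the reflection.
run-mirror : ∀ {r t e n d} → Run r (exc 0 t e n d) → Run (mirror r) (exc 0 t e n d)
run-mirror []             = []
run-mirror (dig h ∷ rn)   = dig h ∷ run-mirror rn
run-mirror (climb h ∷ rn) = climb h ∷ run-mirror rn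

-- The counterpart of `west-half` below the origin, with the half-planes exchanged: a vertex at x =
-- -1 would lie strictly below the end of `u`, only the east side would be left for that end, and
-- its row would have been met before.
east-half : ∀ {h u} → Legal u → Allowed u west → Clear (west ∷ u) north → X u ≡ 0ℤ → Y u ≡ ℤ.- + suc h →
            ∀ {p} → p ∈ trail u → 0ℤ ℤ.≤ proj₁ p
east-half {h} {u} lu a c₂ x≡ y≡ with all-or-any {P = λ p → 0ℤ ℤ.≤ proj₁ p} {Q = λ p → proj₁ p ℤ.< 0ℤ} (λ p → ≤⊎> 0ℤ (proj₁ p)) (trail u)
... | inj₁ h = h
... | inj₂ (p , m , g) with Columns.between u -1ℤ m (origin∈ u) (lin 1 0 (λ x → x :< con 0ℤ ⇒ ⊢ x :≤ con -1ℤ) refl g) ℤ.-≤+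
...   | q , mq , e = ⊥-elim (earlier lu (legal-side lu) mq refl)
  where
  low : proj₂ q ℤ.< Y u
  low = ℤ.≤∧≢⇒< (c₂ (there mq) (lin 2 0 (λ x y → x :≡ con -1ℤ ⇒ y :≡ con 0ℤ ⇒ ⊢ x :≡ y ⊕ con -1ℤ) refl e x≡)) λ f → lin 2 0 (λ x y → x :≤ y ⇒ y :≡ con -1ℤ ⇒ x :≡ con 0ℤ ⇒ ⊢ absurd) refl (Allowed.clear a mq f) e x≡
  earlier : ∀ {u′} → Legal u′ → Side u′ → q ∈ trail u′ → u′ ≡ u → ⊥
  earlier [] _ _ refl = lin 0 1 (λ m → con 0ℤ :≡ ⊝ nat (suc m) ⇒ ⊢ absurd) refl y≡
  earlier (_ ∷ _) _ (here refl) refl = ℤ.<-irrefl refl low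
  earlier {d ∷ u′} (_ ∷ _) (inj₁ s) m refl = lin 1 1 (λ x m → con 0ℤ :≤ x ⇒ x :≡ ⊝ nat (suc m) ⇒ ⊢ absurd) refl (s (there (origin∈ u′))) y≡
  earlier (_ ∷ _) (inj₂ (inj₂ s)) m refl = lin 2 0 (λ x y → x :≤ y ⇒ x :≡ con 0ℤ ⇒ y :≡ con -1ℤ ⇒ ⊢ absurd) refl (s m) x≡ e
  earlier {d ∷ u′} (a′ ∷ _) (inj₂ (inj₁ s)) (there m) refl
    with Rows.between u′ (Y u) m (origin∈ u′) (ℤ.<⇒≤ low) (lin 1 1 (λ x m → x :≡ ⊝ nat (suc m) ⇒ ⊢ x :≤ con 0ℤ) refl y≡)
  ... | q′ , m′ , e′ = fresh d (Allowed.clear a′)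
    (subst (_∈ trail u′) (cong₂ _,_ (ℤ.≤-antisym (s (there m′)) (Allowed.clear a (there m′) e′)) e′) m′)

-- Before its last west step the walk lies in x ≥ 0 and ends on x = 0 below the origin. In the
-- mirror the automaton reaches such a point only by a straight descent, so a climb to (-1 , 0)
-- encloses a single column.
ascend : ∀ {h} r → Legal (north ∷ r) → X r ≡ -1ℤ → Y r ≡ ℤ.- + suc h →
         ∃[ n ] ∃[ d ] Run r (exc 1 0 (suc h) n d) × d ≢ south
ascend [] _ () _
ascend (south ∷ r) (a ∷ _) _ _ = ⊥-elim (no-reversal {south ∷ r} (Allowed.clear a) refl)
ascend {h} (north ∷ r) (_ ∷ lr) x≡ y≡ with ascend {suc h} r lr x≡ (lin 1 1 (λ x m → x ⊕ con 1ℤ :≡ ⊝ nat (suc m) ⇒ ⊢ x :≡ ⊝ nat (suc (suc m))) refl y≡)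
... | n , d , rn , f = n , north , climb f ∷ rn , λ ()
ascend (east ∷ r) (_ ∷ a ∷ _) x≡ y≡ = ⊥-elim (sides (Allowed.side a))
  where
  sides : Side (east ∷ r) → ⊥
  sides (inj₁ s) = lin 1 1 (λ x m → con 0ℤ :≤ x ⇒ x :≡ ⊝ nat (suc m) ⇒ ⊢ absurd) refl (s (there (origin∈ r))) y≡
  sides (inj₂ (inj₁ s)) = lin 1 0 (λ x → con 0ℤ :≤ x ⊕ con 1ℤ ⇒ x ⊕ con 1ℤ :≡ con -1ℤ ⇒ ⊢ absurd) refl {X r} (s (there (origin∈ r))) x≡
  sides (inj₂ (inj₂ s)) = suc-≰ (s (there (pos∈ r)))
ascend {h} (west ∷ u) (a₂ ∷ a ∷ lu) x≡ y≡
  with run-complete (legal-mirror lu) (λ m → lin 1 0 (λ x → con 0ℤ :≤ ⊝ x ⇒ ⊢ x :≤ con 0ℤ) refl (east-half lu a (Allowed.clear a₂) (lin 1 0 (λ x → x ⊖ con 1ℤ :≡ con -1ℤ ⇒ ⊢ x :≡ con 0ℤ) refl x≡) y≡ (∈-mirror u m)))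
... | exc zero t e n d , rn , v with Exc.flat v refl | e≡
  where
  e≡ : e ≡ suc h
  e≡ = lin 2 3 (λ x y m n k → x :≡ nat k ⊖ nat m ⇒ y :≡ ⊝ nat (suc n) ⇒ k :≡ⁿ con 0 ⇒ x :≡ y ⇒ ⊢ m :≡ⁿ suc n) refl (Exc.y≡ v) y≡ (Exc.flat v refl) (Y-mirror u)
...   | refl | refl = _ , west , col ∷ subst (λ r → Run r _) (mirror-involutive u) (run-mirror rn) , λ ()
ascend (west ∷ u) _ x≡ y≡ | exc (suc w) t e n d , rn , v = ⊥-elim (lin 2 1 (λ x y m → x :≡ ⊝ nat (suc m) ⇒ y ⊖ con 1ℤ :≡ con -1ℤ ⇒ x :≡ ⊝ y ⇒ ⊢ absurd) refl (Exc.x≡ v) x≡ (X-mirror u))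
ascend (west ∷ u) _ x≡ y≡ | fin y n , rn , v = ⊥-elim (lin 2 0 (λ x y → x :≡ con 1ℤ ⇒ y ⊖ con 1ℤ :≡ con -1ℤ ⇒ x :≡ ⊝ y ⇒ ⊢ absurd) refl (Fin.x≡ v) x≡ (X-mirror u))
ascend (west ∷ u) _ x≡ y≡ | crest i k t n d , rn , v = ⊥-elim (lin 2 2 (λ x y m n → x :≡ nat m ⇒ y :≡ ⊝ nat (suc n) ⇒ x :≡ y ⇒ ⊢ absurd) refl (Top.y≡ v) y≡ (Y-mirror u))

-- By clearance to the north and to the east a vertex at y = 1 would lie strictly west of the end of
-- `u`. That excludes the north and west sides for this end, and the origin excludes the east side.
lower-half : ∀ {i u} → Legal u → Clear u north → Clear (north ∷ u) east → X u ≡ ℤ.- + suc i → Y u ≡ 0ℤ →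
             ∀ {p} → p ∈ trail u → proj₂ p ℤ.≤ 0ℤ
lower-half {i} {u} lu c c₂ x≡ y≡ with all-or-any {P = λ p → proj₂ p ℤ.≤ 0ℤ} {Q = λ p → 0ℤ ℤ.< proj₂ p} (λ p → ≤⊎> (proj₂ p) 0ℤ) (trail u)
... | inj₁ h = h
... | inj₂ (p , m , g) with Rows.between u 1ℤ (origin∈ u) m (ℤ.+≤+ z≤n) (ℤ.i<j⇒suc[i]≤j g)
...   | q , mq , e = ⊥-elim (sides (legal-side lu))
  where
  beyond : proj₁ q ℤ.< X u
  beyond = ℤ.≤∧≢⇒< (c₂ (there mq) (lin 2 0 (λ x y → x :≡ con 1ℤ ⇒ y :≡ con 0ℤ ⇒ ⊢ x :≡ y ⊕ con 1ℤ) refl e y≡)) λ f → lin 2 0 (λ x y → x :≤ y ⇒ x :≡ con 1ℤ ⇒ y :≡ con 0ℤ ⇒ ⊢ absurd) refl (c mq f) e y≡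
  sides : Side u → ⊥
  sides (inj₁ s) = lin 2 0 (λ x y → x :≤ y ⇒ x :≡ con 1ℤ ⇒ y :≡ con 0ℤ ⇒ ⊢ absurd) refl (s mq) e y≡
  sides (inj₂ (inj₁ s)) = lin 1 1 (λ x m → con 0ℤ :≤ x ⇒ x :≡ ⊝ nat (suc m) ⇒ ⊢ absurd) refl (s (origin∈ u)) x≡
  sides (inj₂ (inj₂ s)) = lin 2 0 (λ x y → x :≤ y ⇒ y :< x ⇒ ⊢ absurd) refl (s mq) beyond

-- The run east along y = 1 was entered by a step north, since an entry from above contradicts the
-- sides or self-avoidance. `lower-half` and `no-return` put everything earlier into x ≤ 0, y ≤ 0,
-- where the automaton has t = 0: a bargraph hanging from the row of the origin.
sweep : ∀ {i} r → Legal (east ∷ r) → X r ≡ ℤ.- + suc i → Y r ≡ 1ℤ →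
        ∃[ k ] ∃[ n ] ∃[ d ] Run r (crest (suc i) k 1 (suc n) d) × d ≢ west
sweep [] _ () _
sweep (west ∷ r) (a ∷ _) x≡ y≡ = ⊥-elim (no-reversal-east {west ∷ r} (λ q → lin 1 0 (λ x → x :≡ con 0ℤ ⇒ x :≡ con 1ℤ ⇒ ⊢ absurd) refl q y≡) (Allowed.clear a) refl)
sweep {i} (east ∷ r) (_ ∷ lr) x≡ y≡ with sweep {suc i} r lr (lin 1 1 (λ x m → x ⊕ con 1ℤ :≡ ⊝ nat (suc m) ⇒ ⊢ x :≡ ⊝ nat (suc (suc m))) refl x≡) y≡
... | k , n , d , rn , f = suc k , n , east , back f ∷ rn , λ ()
sweep {i} (south ∷ u) (a₂ ∷ a ∷ lu) x≡ y≡ = ⊥-elim (sides (Allowed.side a₂) (Allowed.side a))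
  where
  sides : Side (east ∷ south ∷ u) → Side (south ∷ u) → ⊥
  sides (inj₁ s) _ = ≰-pred (s (there (there (pos∈ u))))
  sides (inj₂ (inj₂ s)) _ = suc-≰ (s (there (there (pos∈ u))))
  sides (inj₂ (inj₁ _)) (inj₁ s) = ≰-pred (s (there (pos∈ u)))
  sides (inj₂ (inj₁ _)) (inj₂ (inj₁ s)) = lin 1 1 (λ x m → con 0ℤ :≤ x ⇒ x :≡ ⊝ nat (suc m) ⇒ ⊢ absurd) refl (s (there (origin∈ u))) x≡
  sides (inj₂ (inj₁ s′)) (inj₂ (inj₂ s)) with Rows.between u 1ℤ (origin∈ u) (pos∈ u) (ℤ.+≤+ z≤n) (lin 1 0 (λ x → x ⊖ con 1ℤ :≡ con 1ℤ ⇒ ⊢ con 1ℤ :≤ x) refl y≡)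
  ... | q , m , e = fresh south (Allowed.clear a)
    (subst (_∈ trail u) (cong₂ _,_ (ℤ.≤-antisym (Allowed.clear a₂ (there m) y′) (s (there m))) y′) m)
    where
    y′ : proj₂ q ≡ Y (south ∷ u)
    y′ = lin 2 0 (λ x y → x :≡ con 1ℤ ⇒ y ⊖ con 1ℤ :≡ con 1ℤ ⇒ ⊢ x :≡ y ⊖ con 1ℤ) refl {proj₂ q} {Y u} e y≡
sweep {i} (north ∷ u) (a₂ ∷ a ∷ lu) x≡ y≡ = go (no-return lu low)
  where
  low : ∀ {p} → p ∈ trail u → proj₂ p ℤ.≤ 0ℤ
  low = lower-half lu (Allowed.clear a) (Allowed.clear a₂) x≡ (lin 1 0 (λ x → x ⊕ con 1ℤ :≡ con 1ℤ ⇒ ⊢ x :≡ con 0ℤ) refl y≡)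
  go : (∀ {p} → p ∈ trail u → proj₁ p ℤ.≤ 0ℤ) ⊎ 1ℤ ℤ.≤ X u →
       ∃[ k ] ∃[ n ] ∃[ d ] Run (north ∷ u) (crest (suc i) k 1 (suc n) d) × d ≢ west
  go (inj₂ g) = ⊥-elim (lin 1 1 (λ x m → con 1ℤ :≤ x ⇒ x :≡ ⊝ nat (suc m) ⇒ ⊢ absurd) refl g x≡)
  go (inj₁ h) with run-complete lu h
  ... | fin y n , rn , v = ⊥-elim (lin 1 1 (λ x m → x :≡ con 1ℤ ⇒ x :≡ ⊝ nat (suc m) ⇒ ⊢ absurd) refl (Fin.x≡ v) x≡)
  ... | crest i k t n d , rn , v = ⊥-elim (lin 1 1 (λ x m → x :≡ nat m ⇒ x ⊕ con 1ℤ :≡ con 1ℤ ⇒ con 1 :≤ⁿ m ⇒ ⊢ absurd) refl (Top.y≡ v) y≡ (Top.positive v))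
  ... | exc w t e n d , rn , v with w≡ | t≡ | e≡
    where
    w≡ : w ≡ suc i
    w≡ = lin 1 2 (λ x m n → x :≡ ⊝ nat m ⇒ x :≡ ⊝ nat (suc n) ⇒ ⊢ m :≡ⁿ suc n) refl (Exc.x≡ v) x≡
    t≡ : t ≡ 0
    t≡ = let p , m , f , _ = Exc.crown v in lin 1 1 (λ x m → x :≤ con 0ℤ ⇒ x :≡ nat m ⇒ ⊢ m :≡ⁿ con 0) refl (low m) f
    e≡ : e ≡ 0
    e≡ = lin 1 2 (λ x m n → x :≡ nat n ⊖ nat m ⇒ x ⊕ con 1ℤ :≡ con 1ℤ ⇒ n :≡ⁿ con 0 ⇒ ⊢ m :≡ⁿ con 0) refl (Exc.y≡ v) y≡ t≡
  ...   | refl | refl | refl with exc-complete {n = n} north lu v a (h (pos∈ u))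
  ...     | _ , rise f = 0 , _ , north , rise f ∷ rn , λ ()

-- The sides leave only a step from the west to the east side of a box of width one, below the
-- origin, and `width-one` forbids it.
no-undercut : ∀ r → Legal (east ∷ r) → X r ≡ -1ℤ → Y r ≢ -1ℤ
no-undercut r (a ∷ lr) x≡ y≡ = sides (Allowed.side a) (legal-side lr)
  where
  sides : Side (east ∷ r) → Side r → ⊥
  sides (inj₁ s) _ = lin 1 0 (λ x → con 0ℤ :≤ x ⇒ x :≡ con -1ℤ ⇒ ⊢ absurd) refl (s (there (origin∈ r))) y≡
  sides (inj₂ (inj₂ s)) _ = suc-≰ (s (there (pos∈ r)))
  sides (inj₂ (inj₁ _)) (inj₁ s) = lin 1 0 (λ x → con 0ℤ :≤ x ⇒ x :≡ con -1ℤ ⇒ ⊢ absurd) refl (s (origin∈ r)) y≡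
  sides (inj₂ (inj₁ _)) (inj₂ (inj₁ s)) = lin 1 0 (λ x → con 0ℤ :≤ x ⇒ x :≡ con -1ℤ ⇒ ⊢ absurd) refl (s (origin∈ r)) x≡
  sides (inj₂ (inj₁ s′)) (inj₂ (inj₂ s)) =
    width-one lr a east (λ m → two-values (s m) (s′ (there m)))
      (origin , origin∈ r , lin 1 0 (λ x → x :≡ con -1ℤ ⇒ ⊢ con 0ℤ :≡ x ⊕ con 1ℤ) refl x≡) (origin , origin∈ r , lin 1 0 (λ x → x :≡ con -1ℤ ⇒ ⊢ x :< con 0ℤ) refl y≡)

classify-oriented : ∀ {r} → Legal r → 1 ℕ.< length r →
  (X r ≡ 1ℤ × Y r ≡ 0ℤ × heading r ≡ south) ⊎ (X r ≡ -1ℤ × Y r ≡ 0ℤ × heading r ≡ north) ⊎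
  (X r ≡ 0ℤ × Y r ≡ 1ℤ × heading r ≡ east) ⊎ (X r ≡ 0ℤ × Y r ≡ -1ℤ × heading r ≡ east) →
  ∃[ n ] Accepted n r
classify-oriented {south ∷ r} lr _ (inj₁ (x≡ , y≡ , refl)) with descend {0} r lr x≡ (lin 1 0 (λ x → x ⊖ con 1ℤ :≡ con 0ℤ ⇒ ⊢ x :≡ con 1ℤ) refl y≡)
... | n , rn = n , _ , fall ∷ rn , around
classify-oriented {north ∷ r} lr _ (inj₂ (inj₁ (x≡ , y≡ , refl))) with ascend {0} r lr x≡ (lin 1 0 (λ x → x ⊕ con 1ℤ :≡ con 0ℤ ⇒ ⊢ x :≡ ⊝ con 1ℤ) refl y≡)
... | n , d , rn , f = n , _ , climb f ∷ rn , column
classify-oriented {east ∷ r} lr _ (inj₂ (inj₂ (inj₁ (x≡ , y≡ , refl)))) with sweep {0} r lr (lin 1 0 (λ x → x ⊕ con 1ℤ :≡ con 0ℤ ⇒ ⊢ x :≡ ⊝ con 1ℤ) refl x≡) y≡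
... | k , n , d , rn , f = n , _ , back f ∷ rn , hanging
classify-oriented {east ∷ r} lr _ (inj₂ (inj₂ (inj₂ (x≡ , y≡ , refl)))) = ⊥-elim (no-undercut r lr (lin 1 0 (λ x → x ⊕ con 1ℤ :≡ con 0ℤ ⇒ ⊢ x :≡ con -1ℤ) refl x≡) y≡)

not-back : ∀ {d r} → Legal (d ∷ r) → 1 ℕ.< length (d ∷ r) → pos r ≢ origin
not-back {r = []} _ (s≤s ()) _
not-back {r = d ∷ r} (_ ∷ a ∷ _) _ e = fresh d (Allowed.clear a) (subst (_∈ trail r) (sym e) (origin∈ r))

-- The last step is perpendicular to the closing edge: along it, it would either have come from the
-- origin, against `not-back`, or have headed towards the origin, against prudence. Of the eight
-- cases left, reflection identifies pairs, and four remain for `classify-oriented`.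
classify : ∀ {r} → Legal r → 1 ℕ.< length r → Adjacent (pos r) origin →
           ∃[ n ] (Accepted n r ⊎ Accepted n (mirror r))
classify {d ∷ r} lr@(a ∷ _) l (d′ , e) = go d d′ lr a l (not-back lr l) (cong proj₁ e) (cong proj₂ e)
  where
  direct : ∀ {r} → ∃[ n ] Accepted n r → ∃[ n ] (Accepted n r ⊎ Accepted n (mirror r))
  direct (n , x) = n , inj₁ x
  go : ∀ d d′ → Legal (d ∷ r) → Allowed r d → 1 ℕ.< length (d ∷ r) → pos r ≢ origin →
       proj₁ (step (pos (d ∷ r)) d′) ≡ 0ℤ → proj₂ (step (pos (d ∷ r)) d′) ≡ 0ℤ →
       ∃[ n ] (Accepted n (d ∷ r) ⊎ Accepted n (mirror (d ∷ r)))
  mirrored : ∀ d → Legal (d ∷ r) → 1 ℕ.< length (d ∷ r) → _ → ∃[ n ] (Accepted n (d ∷ r) ⊎ Accepted n (mirror (d ∷ r)))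
  mirrored d lr l h with classify-oriented {mirror (d ∷ r)} (legal-mirror lr) (subst (1 ℕ.<_) (sym len) l) h
    where
    len : length (mirror (d ∷ r)) ≡ length (d ∷ r)
    len = Data.List.Properties.length-map flip (d ∷ r)
      where import Data.List.Properties
  ... | n , x = n , inj₂ x
  go north south lr a l nb x y = ⊥-elim (nb (cong₂ _,_ x (lin 1 0 (λ x → x ⊕ con 1ℤ ⊖ con 1ℤ :≡ con 0ℤ ⇒ ⊢ x :≡ con 0ℤ) refl y)))
  go south north lr a l nb x y = ⊥-elim (nb (cong₂ _,_ x (lin 1 0 (λ x → x ⊖ con 1ℤ ⊕ con 1ℤ :≡ con 0ℤ ⇒ ⊢ x :≡ con 0ℤ) refl y)))
  go east  west  lr a l nb x y = ⊥-elim (nb (cong₂ _,_ (lin 1 0 (λ x → x ⊕ con 1ℤ ⊖ con 1ℤ :≡ con 0ℤ ⇒ ⊢ x :≡ con 0ℤ) refl x) y))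
  go west  east  lr a l nb x y = ⊥-elim (nb (cong₂ _,_ (lin 1 0 (λ x → x ⊖ con 1ℤ ⊕ con 1ℤ :≡ con 0ℤ ⇒ ⊢ x :≡ con 0ℤ) refl x) y))
  go north north lr a l nb x y = ⊥-elim (lin 1 0 (λ x → con 0ℤ :≤ x ⇒ x ⊕ con 1ℤ ⊕ con 1ℤ :≡ con 0ℤ ⇒ ⊢ absurd) refl (Allowed.clear a (origin∈ r) (sym x)) y)
  go south south lr a l nb x y = ⊥-elim (lin 1 0 (λ x → x :≤ con 0ℤ ⇒ x ⊖ con 1ℤ ⊖ con 1ℤ :≡ con 0ℤ ⇒ ⊢ absurd) refl (Allowed.clear a (origin∈ r) (sym x)) y)
  go east  east  lr a l nb x y = ⊥-elim (lin 1 0 (λ x → con 0ℤ :≤ x ⇒ x ⊕ con 1ℤ ⊕ con 1ℤ :≡ con 0ℤ ⇒ ⊢ absurd) refl (Allowed.clear a (origin∈ r) (sym y)) x)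
  go west  west  lr a l nb x y = ⊥-elim (lin 1 0 (λ x → x :≤ con 0ℤ ⇒ x ⊖ con 1ℤ ⊖ con 1ℤ :≡ con 0ℤ ⇒ ⊢ absurd) refl (Allowed.clear a (origin∈ r) (sym y)) x)
  go south west lr a l nb x y = direct (classify-oriented lr l (inj₁ (lin 1 0 (λ x → x ⊖ con 1ℤ :≡ con 0ℤ ⇒ ⊢ x :≡ con 1ℤ) refl x , y , refl)))
  go north east lr a l nb x y = direct (classify-oriented lr l (inj₂ (inj₁ (lin 1 0 (λ x → x ⊕ con 1ℤ :≡ con 0ℤ ⇒ ⊢ x :≡ con -1ℤ) refl x , y , refl))))
  go east south lr a l nb x y = direct (classify-oriented lr l (inj₂ (inj₂ (inj₁ (x , lin 1 0 (λ x → x ⊖ con 1ℤ :≡ con 0ℤ ⇒ ⊢ x :≡ con 1ℤ) refl y , refl)))))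
  go east north lr a l nb x y = direct (classify-oriented lr l (inj₂ (inj₂ (inj₂ (x , lin 1 0 (λ x → x ⊕ con 1ℤ :≡ con 0ℤ ⇒ ⊢ x :≡ con -1ℤ) refl y , refl)))))
  go south east lr a l nb x y = mirrored south lr l (inj₁ (lin 2 0 (λ x y → y ⊕ con 1ℤ :≡ con 0ℤ ⇒ x :≡ ⊝ y ⇒ ⊢ x :≡ con 1ℤ) refl x (X-mirror (south ∷ r)) , trans (Y-mirror (south ∷ r)) y , refl))
  go north west lr a l nb x y = mirrored north lr l (inj₂ (inj₁ (lin 2 0 (λ x y → y ⊖ con 1ℤ :≡ con 0ℤ ⇒ x :≡ ⊝ y ⇒ ⊢ x :≡ con -1ℤ) refl x (X-mirror (north ∷ r)) , trans (Y-mirror (north ∷ r)) y , refl)))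
  go west south lr a l nb x y = mirrored west lr l (inj₂ (inj₂ (inj₁ (trans (X-mirror (west ∷ r)) (cong ℤ.-_ x) , lin 2 0 (λ x y → y ⊖ con 1ℤ :≡ con 0ℤ ⇒ x :≡ y ⇒ ⊢ x :≡ con 1ℤ) refl y (Y-mirror (west ∷ r)) , refl))))
  go west north lr a l nb x y = mirrored west lr l (inj₂ (inj₂ (inj₂ (trans (X-mirror (west ∷ r)) (cong ℤ.-_ x) , lin 2 0 (λ x y → y ⊕ con 1ℤ :≡ con 0ℤ ⇒ x :≡ y ⇒ ⊢ x :≡ con -1ℤ) refl y (Y-mirror (west ∷ r)) , refl))))

-- Cardinalities

open Equivalence using (to; from)

private variable
  A B : Set
  P Q : A → Set
  m n : ℕ

card-resp : HasCard P n → (∀ {x} → P x → Q x) → (∀ {x} → Q x → P x) → HasCard Q n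
card-resp (xs , u , l , h) f g = xs , u , l , λ x → mk⇔ (λ m → f (to (h x) m)) (λ q → from (h x) (g q))

card-∅ : (∀ {x} → ¬ P x) → HasCard P 0
card-∅ f = [] , [] , refl , λ x → mk⇔ (λ ()) (λ p → ⊥-elim (f p))

card-singleton : (y : A) → HasCard (_≡ y) 1
card-singleton y = y ∷ [] , [] ∷ [] , refl , λ x → mk⇔ (λ { (here e) → e ; (there ()) }) here

card-⊎ : HasCard P m → HasCard Q n → (∀ {x} → P x → Q x → ⊥) → HasCard (λ x → P x ⊎ Q x) (m ℕ.+ n)
card-⊎ {P = P} {Q = Q} (xs , u , l , h) (ys , v , k , g) d =
  xs ++ ys , Unique.++⁺ u v (λ (m , m′) → d (to (h _) m) (to (g _) m′)) , trans (length-++ xs) (cong₂ ℕ._+_ l k) ,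
  λ x → mk⇔ (λ m → split x (∈-++⁻ xs m)) λ { (inj₁ p) → ∈-++⁺ˡ (from (h x) p) ; (inj₂ q) → ∈-++⁺ʳ xs (from (g x) q) }
  where
  split : ∀ x → x ∈ xs ⊎ x ∈ ys → P x ⊎ Q x
  split x (inj₁ m) = inj₁ (to (h x) m)
  split x (inj₂ m) = inj₂ (to (g x) m)

-- A relation in place of a function, because the image of a walk will depend on parameters of its
-- state, which the walk determines only through its run.
card-image : (R : A → B → Set) → (∀ {x} → P x → ∃[ y ] R x y) →
             (∀ {x y y′} → P x → R x y → R x y′ → y ≡ y′) →
             (∀ {x x′ y} → P x → P x′ → R x y → R x′ y → x ≡ x′) →
             HasCard P n → HasCard (λ y → ∃[ x ] P x × R x y) n
card-image {A = A} {B = B} {P = P} R total functional injective (xs , u , refl , h) = conclude (go xs u (All.tabulate (to (h _))))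
  where
  Image : List A → List B → Set
  Image xs ys = Unique ys × length ys ≡ length xs × (∀ y → (y ∈ ys) ⇔ (∃[ x ] x ∈ xs × R x y))
  conclude : ∃[ ys ] Image xs ys → HasCard (λ y → ∃[ x ] P x × R x y) (length xs)
  conclude (ys , v , l , g) = ys , v , l , λ y → mk⇔
    (λ m → let x , m′ , r = to (g y) m in x , to (h x) m′ , r) (λ (x , p , r) → from (g y) (x , from (h x) p , r))
  go : ∀ xs → Unique xs → All P xs → ∃[ ys ] Image xs ys
  go [] _ _ = [] , [] , refl , λ y → mk⇔ (λ ()) (λ { (_ , () , _) })
  go (x ∷ xs) (x∉ ∷ u) (p ∷ ps) with go xs u ps | total p
  ... | ys , v , l , g | y , r = y ∷ ys ,
    All.tabulate (λ { m refl → let x′ , m′ , r′ = to (g y) m in All.lookup x∉ m′ (injective p (All.lookup ps m′) r r′) }) ∷ v ,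
    cong suc l , λ z → mk⇔
      (λ { (here refl) → x , here refl , r ; (there m) → let x′ , m′ , r′ = to (g z) m in x′ , there m′ , r′ })
      (λ { (_ , here refl , r′) → here (functional p r′ r) ; (x′ , there m′ , r′) → there (from (g z) (x′ , m′ , r′)) })

card-map : (f : A → B) (g : B → A) → (∀ x → g (f x) ≡ x) → HasCard P n → HasCard (λ y → ∃[ x ] P x × f x ≡ y) n
card-map f g inv = card-image (λ x y → f x ≡ y) (λ {x} _ → f x , refl) (λ { _ refl refl → refl })
  λ { {x} {x′} _ _ e e′ → trans (sym (inv x)) (trans (cong g (trans e (sym e′))) (inv x′)) }

length-⊆ : (xs ys : List A) → Unique xs → (∀ {x} → x ∈ xs → x ∈ ys) → length xs ℕ.≤ length ys
length-⊆ [] ys _ _ = z≤n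
length-⊆ (x ∷ xs) ys (x∉ ∷ u) sub with ∈-∃++ (sub (here refl))
... | as , bs , refl = ℕ.≤-trans (s≤s (length-⊆ xs (as ++ bs) u sub′)) (ℕ.≤-reflexive eq)
  where
  sub′ : ∀ {y} → y ∈ xs → y ∈ as ++ bs
  sub′ {y} m with ∈-++⁻ as (sub (there m))
  ... | inj₁ m′ = ∈-++⁺ˡ m′
  ... | inj₂ (here refl) = ⊥-elim (All.lookup x∉ m refl)
  ... | inj₂ (there m′) = ∈-++⁺ʳ as m′
  eq : suc (length (as ++ bs)) ≡ length (as ++ x ∷ bs)
  eq = trans (cong suc (length-++ as)) (trans (sym (ℕ.+-suc (length as) (length bs))) (sym (length-++ as)))

card-unique : {P : A → Set} → HasCard P m → HasCard P n → m ≡ n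
card-unique (xs , u , refl , h) (ys , v , refl , g) = ℕ.≤-antisym
  (length-⊆ xs ys u λ {x} m → from (g x) (to (h x) m)) (length-⊆ ys xs v λ {x} m → from (h x) (to (g x) m))

∑< : ℕ → (ℕ → ℕ) → ℕ
∑< zero    f = 0
∑< (suc k) f = ∑< k f ℕ.+ f k

card-∑ : ∀ k {f : ℕ → ℕ} {P : ℕ → A → Set} → (∀ j → j ℕ.< k → HasCard (P j) (f j)) →
         (∀ {i j x} → P i x → P j x → i ≡ j) → HasCard (λ x → ∃[ j ] j ℕ.< k × P j x) (∑< k f)
card-∑ zero    h d = card-∅ λ { (_ , () , _) }
card-∑ (suc k) {P = P} h d = card-resp (card-⊎ (card-∑ k (λ j l → h j (ℕ.m≤n⇒m≤1+n l)) d) (h k ℕ.≤-refl) λ { (j , l , p) q → ℕ.<-irrefl (d p q) l }) (λ { (inj₁ (j , l , p)) → j , ℕ.m≤n⇒m≤1+n l , p ; (inj₂ p) → k , ℕ.≤-refl , p }) (λ { (j , l , p) → last (ℕ.m≤n⇒m<n∨m≡n (ℕ.s≤s⁻¹ l)) p })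
  where
  last : ∀ {j x} → j ℕ.< k ⊎ j ≡ k → P j x → (∃[ j ] j ℕ.< k × P j x) ⊎ P k x
  last (inj₁ l)    p = inj₁ (_ , l , p)
  last (inj₂ refl) p = inj₂ p

-- The coefficients of q^k times the series of `f`, see `ser-lag`.
lag : ℕ → (ℕ → ℕ) → ℕ → ℕ
lag zero    f n       = f n
lag (suc k) f zero    = 0
lag (suc k) f (suc n) = lag k f n

card-lag : ∀ k n {f : ℕ → ℕ} {P : ℕ → A → Set} → (∀ m → m ℕ.+ k ≡ n → HasCard (P m) (f m)) →
           HasCard (λ x → ∃[ m ] m ℕ.+ k ≡ n × P m x) (lag k f n)
card-lag zero n {P = P} h = card-resp (h n (ℕ.+-identityʳ n)) (λ p → n , ℕ.+-identityʳ n , p) (λ { (m , e , p) → subst (λ m → P m _) (trans (sym (ℕ.+-identityʳ m)) e) p })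
card-lag (suc k) zero h = card-∅ λ { (m , e , _) → ⊥-elim (ℕ.1+n≢0 (trans (sym (ℕ.+-suc m k)) e)) }
card-lag (suc k) (suc n) h = card-resp (card-lag k n λ m e → h m (trans (ℕ.+-suc m k) (cong suc e))) (λ { (m , e , p) → m , trans (ℕ.+-suc m k) (cong suc e) , p }) (λ { (m , e , p) → m , ℕ.suc-injective (trans (sym (ℕ.+-suc m k)) e) , p })

-- Comparison with the definitions of Defs

end-pos : ∀ r → end (reverse r) ≡ pos r
end-pos []      = refl
end-pos (d ∷ r) = trans (cong end (unfold-reverse d r))
  (trans (foldl-∷ʳ step origin d (reverse r)) (cong (λ p → step p d) (end-pos r)))

verticesFrom-∷ʳ : ∀ p u d → verticesFrom p (u ∷ʳ d) ≡ verticesFrom p u ∷ʳ foldl step p (u ∷ʳ d)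
verticesFrom-∷ʳ p []      d = refl
verticesFrom-∷ʳ p (e ∷ u) d = cong (p ∷_) (verticesFrom-∷ʳ (step p e) u d)

vertices-∷ : ∀ d r → vertices (reverse (d ∷ r)) ≡ vertices (reverse r) ∷ʳ pos (d ∷ r)
vertices-∷ d r = trans (cong vertices (unfold-reverse d r)) (trans (verticesFrom-∷ʳ origin (reverse r) d)
  (cong (vertices (reverse r) ∷ʳ_) (trans (cong end (sym (unfold-reverse d r))) (end-pos (d ∷ r)))))

vertices-trail : ∀ r → vertices (reverse r) ≡ reverse (trail r)
vertices-trail []      = refl
vertices-trail (d ∷ r) = trans (vertices-∷ d r)
  (trans (cong (_∷ʳ pos (d ∷ r)) (vertices-trail r)) (sym (unfold-reverse (pos (d ∷ r)) (trail r))))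

point≡ : ∀ {p q : Point} → proj₁ p ≡ proj₁ q → proj₂ p ≡ proj₂ q → p ≡ q
point≡ = cong₂ _,_

unit-range : ∀ {a x} → a ≡ x ⊎ a ≡ x ℤ.+ 1ℤ → x ℤ.≤ a × a ℤ.≤ x ℤ.+ 1ℤ
unit-range (inj₁ e) = lin 2 0 (λ x y → y :≡ x ⇒ ⊢ x :≤ y) refl e , lin 2 0 (λ x y → x :≡ y ⇒ ⊢ x :≤ y ⊕ con 1ℤ) refl e
unit-range (inj₂ e) = lin 2 0 (λ x y → y :≡ x ⊕ con 1ℤ ⇒ ⊢ x :≤ y) refl e , ℤ.≤-reflexive e

unit-range′ : ∀ {a x} → a ≡ x ⊎ a ≡ x ℤ.- 1ℤ → x ℤ.- 1ℤ ℤ.≤ a × a ℤ.≤ x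
unit-range′ (inj₁ e) = lin 2 0 (λ x y → y :≡ x ⇒ ⊢ x ⊖ con 1ℤ :≤ y) refl e , lin 2 0 (λ x y → x :≡ y ⇒ ⊢ x :≤ y) refl e
unit-range′ (inj₂ e) = ℤ.≤-reflexive (sym e) , lin 2 0 (λ x y → x :≡ y ⊖ con 1ℤ ⇒ ⊢ x :≤ y) refl e

module _ (u : Walk) where
  private r = reverse u

  end≡ : end u ≡ pos r
  end≡ = trans (cong end (sym (reverse-involutive u))) (end-pos r)

  vertices≡ : vertices u ≡ reverse (trail r)
  vertices≡ = trans (cong vertices (sym (reverse-involutive u))) (vertices-trail r)

  to-trail : ∀ {p} → p ∈ vertices u → p ∈ trail r
  to-trail m = reverse⁻ (subst (_ ∈_) vertices≡ m)

  from-trail : ∀ {p} → p ∈ trail r → p ∈ vertices u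
  from-trail m = subst (_ ∈_) (sym vertices≡) (reverse⁺ m)

  x-end : proj₁ (end u) ≡ X r
  x-end = cong proj₁ end≡

  y-end : proj₂ (end u) ≡ Y r
  y-end = cong proj₂ end≡

  module Extreme (f : Point → ℤ) (f-origin : f origin ≡ 0ℤ) where
    values : List ℤ
    values = map f (vertices u)

    Attained : ℤ → Set
    Attained z = ∃[ p ] p ∈ trail r × f p ≡ z

    attained-origin : Attained 0ℤ
    attained-origin = origin , origin∈ r , f-origin

    attained-values : All Attained values
    attained-values = All.tabulate λ m → let p , m′ , e = ∈-map⁻ f m in p , to-trail m′ , sym e

    max-attained : Attained (Extrema.max 0ℤ values)
    max-attained = Extrema.argmax-all id attained-origin attained-values

    min-attained : Attained (Extrema.min 0ℤ values)
    min-attained = Extrema.argmin-all id attained-origin attained-values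

    ≤max : ∀ {p} → p ∈ trail r → f p ℤ.≤ Extrema.max 0ℤ values
    ≤max m = All.lookup (Extrema.xs≤max 0ℤ values) (∈-map⁺ f (from-trail m))

    min≤ : ∀ {p} → p ∈ trail r → Extrema.min 0ℤ values ℤ.≤ f p
    min≤ m = All.lookup (Extrema.min≤xs 0ℤ values) (∈-map⁺ f (from-trail m))

    max-unique : ∀ {z} → Attained z → (∀ {p} → p ∈ trail r → f p ℤ.≤ z) → Extrema.max 0ℤ values ≡ z
    max-unique (p , m , refl) h = let q , m′ , e = max-attained in
      ℤ.≤-antisym (ℤ.≤-trans (ℤ.≤-reflexive (sym e)) (h m′)) (≤max m)

    min-unique : ∀ {z} → Attained z → (∀ {p} → p ∈ trail r → z ℤ.≤ f p) → Extrema.min 0ℤ values ≡ z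
    min-unique (p , m , refl) h = let q , m′ , e = min-attained in
      ℤ.≤-antisym (min≤ m) (ℤ.≤-trans (h m′) (ℤ.≤-reflexive e))

  module EX = Extreme proj₁ refl
  module EY = Extreme proj₂ refl

  side-to : EndsOnNorth u ⊎ EndsOnEast u ⊎ EndsOnWest u → Side r
  side-to (inj₁ e)        = inj₁ λ m → lin 4 0 (λ x y z u → x :≤ z ⇒ u :≡ z ⇒ u :≡ y ⇒ ⊢ x :≤ y) refl (EY.≤max m) e y-end
  side-to (inj₂ (inj₁ e)) = inj₂ (inj₁ λ m → lin 4 0 (λ x y z u → x :≤ z ⇒ u :≡ z ⇒ u :≡ y ⇒ ⊢ x :≤ y) refl (EX.≤max m) e x-end)
  side-to (inj₂ (inj₂ e)) = inj₂ (inj₂ λ m → lin 4 0 (λ x y z u → z :≤ y ⇒ u :≡ z ⇒ u :≡ x ⇒ ⊢ x :≤ y) refl (EX.min≤ m) e x-end)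

  side-from : Side r → EndsOnNorth u ⊎ EndsOnEast u ⊎ EndsOnWest u
  side-from (inj₁ s)        = inj₁ (trans y-end (sym (EY.max-unique (_ , pos∈ r , refl) s)))
  side-from (inj₂ (inj₁ s)) = inj₂ (inj₁ (trans x-end (sym (EX.max-unique (_ , pos∈ r , refl) s))))
  side-from (inj₂ (inj₂ s)) = inj₂ (inj₂ (trans x-end (sym (EX.min-unique (_ , pos∈ r , refl) s))))

  step-end : ∀ d → step (end u) d ≡ pos (d ∷ r)
  step-end d = cong (λ p → step p d) end≡

  corner-to : ∀ d → width u ≡ 1ℤ → height u ≢ 0ℤ → SouthCornerStep u d → Corner r d
  corner-to d w≡ h≢ c = go c
    where
    taller : Y r ≡ bottom u → ∃[ p ] p ∈ trail r × Y r ℤ.< proj₂ p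
    taller e = let p , m , f = EY.max-attained in
      p , m , ℤ.≤∧≢⇒< (ℤ.≤-trans (ℤ.≤-reflexive e) (EY.min≤ m)) λ g → h≢ (lin 4 0 (λ x y z u → z :≡ y ⇒ u :≡ x ⇒ z :≡ u ⇒ ⊢ x ⊖ y :≡ con 0ℤ) refl e f g)
    narrow : ∀ {p} → p ∈ trail r → proj₁ p ≡ left u ⊎ proj₁ p ≡ right u
    narrow m with two-values (EX.min≤ m) (lin 3 0 (λ x y z → z ⊖ y :≡ con 1ℤ ⇒ x :≤ z ⇒ ⊢ x :≤ y ⊕ con 1ℤ) refl w≡ (EX.≤max m))
    ... | inj₁ e = inj₁ e
    ... | inj₂ e = inj₂ (lin 3 0 (λ x y z → x :≡ z ⊕ con 1ℤ ⇒ y ⊖ z :≡ con 1ℤ ⇒ ⊢ x :≡ y) refl e w≡)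
    module _ (y≡ : Y r ≡ bottom u) where
      lowest : ∀ {p} → p ∈ trail r → Y r ℤ.≤ proj₂ p
      lowest m = ℤ.≤-trans (ℤ.≤-reflexive y≡) (EY.min≤ m)
    go : SouthCornerStep u d → Corner r d
    go (inj₁ (e , f)) = record
      { level = lin 4 0 (λ x y z u → z :≡ u ⇒ z :≡ x ⇒ y :≡ u ⇒ ⊢ x :≡ y) refl (cong proj₂ f) (cong proj₂ (step-end d)) y≡
      ; lowest = lowest y≡ ; taller = taller y≡
      ; opposite = let p , m , g = EX.min-attained in p , m , trans g (sym x′)
      ; narrow = λ m → Sum.swap (Sum.map (λ g → trans g (sym x′)) (λ g → trans g (sym x≡)) (narrow m)) }
      where
      y≡ : Y r ≡ bottom u
      y≡ = trans (sym y-end) (cong proj₂ e)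
      x≡ : X r ≡ right u
      x≡ = trans (sym x-end) (cong proj₁ e)
      x′ : X (d ∷ r) ≡ left u
      x′ = trans (sym (cong proj₁ (step-end d))) (cong proj₁ f)
    go (inj₂ (e , f)) = record
      { level = lin 4 0 (λ x y z u → z :≡ u ⇒ z :≡ x ⇒ y :≡ u ⇒ ⊢ x :≡ y) refl (cong proj₂ f) (cong proj₂ (step-end d)) y≡
      ; lowest = lowest y≡ ; taller = taller y≡
      ; opposite = let p , m , g = EX.max-attained in p , m , trans g (sym x′)
      ; narrow = λ m → Sum.map (λ g → trans g (sym x≡)) (λ g → trans g (sym x′)) (narrow m) }
      where
      y≡ : Y r ≡ bottom u
      y≡ = trans (sym y-end) (cong proj₂ e)
      x≡ : X r ≡ left u
      x≡ = trans (sym x-end) (cong proj₁ e)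
      x′ : X (d ∷ r) ≡ right u
      x′ = trans (sym (cong proj₁ (step-end d))) (cong proj₁ f)

  corner-from : ∀ d → Corner r d → width u ≡ 1ℤ × height u ≢ 0ℤ × SouthCornerStep u d
  corner-from d c = go d level opposite narrow
    where
    open Corner c using (level; lowest; taller; opposite; narrow)
    bottom≡ : bottom u ≡ Y r
    bottom≡ = EY.min-unique (_ , pos∈ r , refl) lowest
    high : height u ≢ 0ℤ
    high h = let p , m , g = taller in lin 4 0 (λ x y z u → x ⊖ y :≡ con 0ℤ ⇒ z :≤ x ⇒ u :< z ⇒ y :≡ u ⇒ ⊢ absurd) refl h (EY.≤max m) g bottom≡
    go : ∀ d → Y (d ∷ r) ≡ Y r → (∃[ p ] p ∈ trail r × proj₁ p ≡ X (d ∷ r)) →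
         (∀ {p} → p ∈ trail r → proj₁ p ≡ X r ⊎ proj₁ p ≡ X (d ∷ r)) →
         width u ≡ 1ℤ × height u ≢ 0ℤ × SouthCornerStep u d
    go north l _ _ = ⊥-elim (lin 1 0 (λ x → x ⊕ con 1ℤ :≡ x ⇒ ⊢ absurd) refl l)
    go south l _ _ = ⊥-elim (lin 1 0 (λ x → x ⊖ con 1ℤ :≡ x ⇒ ⊢ absurd) refl l)
    go east _ o n = lin 3 0 (λ x y z → y :≡ z ⇒ x :≡ z ⊕ con 1ℤ ⇒ ⊢ x ⊖ y :≡ con 1ℤ) refl left≡ right≡ , high ,
      inj₂ (cong₂ _,_ (trans x-end (sym left≡)) (trans y-end (sym bottom≡)) ,
            cong₂ _,_ (lin 3 0 (λ x y z → x :≡ z ⇒ y :≡ z ⊕ con 1ℤ ⇒ ⊢ x ⊕ con 1ℤ :≡ y) refl x-end right≡) (trans y-end (sym bottom≡)))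
      where
      left≡ : left u ≡ X r
      left≡ = EX.min-unique (_ , pos∈ r , refl) λ m → proj₁ (unit-range (n m))
      right≡ : right u ≡ X (east ∷ r)
      right≡ = EX.max-unique o λ m → proj₂ (unit-range (n m))
    go west _ o n = lin 3 0 (λ x y z → y :≡ z ⊖ con 1ℤ ⇒ x :≡ z ⇒ ⊢ x ⊖ y :≡ con 1ℤ) refl left≡ right≡ , high ,
      inj₁ (cong₂ _,_ (trans x-end (sym right≡)) (trans y-end (sym bottom≡)) ,
            cong₂ _,_ (lin 3 0 (λ x y z → x :≡ z ⇒ y :≡ z ⊖ con 1ℤ ⇒ ⊢ x ⊖ con 1ℤ :≡ y) refl x-end left≡) (trans y-end (sym bottom≡)))
      where
      left≡ : left u ≡ X (west ∷ r)
      left≡ = EX.min-unique o λ m → proj₁ (unit-range′ (n m))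
      right≡ : right u ≡ X r
      right≡ = EX.max-unique (_ , pos∈ r , refl) λ m → proj₂ (unit-range′ (n m))

  clear-from : ∀ d → Clear r d → ∀ k → 1 ℕ.≤ k → advance (end u) k d ∉ vertices u
  clear-from north c k h m = lin 2 1 (λ x y m → x ⊕ nat m :≤ y ⇒ con 1 :≤ⁿ m ⇒ x :≡ y ⇒ ⊢ absurd) refl (c (to-trail m) x-end) h y-end
  clear-from south c k h m = lin 2 1 (λ x y m → x :≤ y ⊖ nat m ⇒ con 1 :≤ⁿ m ⇒ y :≡ x ⇒ ⊢ absurd) refl (c (to-trail m) x-end) h y-end
  clear-from east  c k h m = lin 2 1 (λ x y m → x ⊕ nat m :≤ y ⇒ con 1 :≤ⁿ m ⇒ x :≡ y ⇒ ⊢ absurd) refl (c (to-trail m) y-end) h x-end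
  clear-from west  c k h m = lin 2 1 (λ x y m → x :≤ y ⊖ nat m ⇒ con 1 :≤ⁿ m ⇒ y :≡ x ⇒ ⊢ absurd) refl (c (to-trail m) y-end) h x-end

  offset : ∀ {a b} → a ℤ.< b → ∃[ k ] 1 ℕ.≤ k × a ℤ.+ + k ≡ b
  offset {a} {b} h = let e = ℤ.0≤i⇒+∣i∣≡i (ℤ.<⇒≤ (positive h)) in
    ℤ.∣ b ℤ.- a ∣ , ℤ.drop‿+≤+ (lin 2 1 (λ x y m → con 0ℤ :< x ⊖ y ⇒ nat m :≡ x ⊖ y ⇒ ⊢ con 1ℤ :≤ nat m) refl {b} {a} (positive h) e) , lin 2 1 (λ x y m → nat m :≡ y ⊖ x ⇒ ⊢ x ⊕ nat m :≡ y) refl {a} {b} e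
    where
    positive : ∀ {a b} → a ℤ.< b → 0ℤ ℤ.< b ℤ.- a
    positive h = lin 2 0 (λ x y → y :< x ⇒ ⊢ con 0ℤ :< x ⊖ y) refl h

  clear-to : ∀ d → (∀ k → 1 ℕ.≤ k → advance (end u) k d ∉ vertices u) → Clear r d
  clear-to north c {p} m e = ℤ.≮⇒≥ λ h → let k , g , f = offset h in
    c k g (subst (_∈ vertices u) (point≡ {p} {advance (end u) k north} (trans e (sym x-end)) (lin 3 1 (λ x y z m → z ⊕ nat m :≡ x ⇒ y :≡ z ⇒ ⊢ x :≡ y ⊕ nat m) refl f y-end)) (from-trail m))
  clear-to south c {p} m e = ℤ.≮⇒≥ λ h → let k , g , f = offset h in
    c k g (subst (_∈ vertices u) (point≡ {p} {advance (end u) k south} (trans e (sym x-end)) (lin 3 1 (λ x y z m → x ⊕ nat m :≡ z ⇒ y :≡ z ⇒ ⊢ x :≡ y ⊖ nat m) refl f y-end)) (from-trail m))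
  clear-to east c {p} m e = ℤ.≮⇒≥ λ h → let k , g , f = offset h in
    c k g (subst (_∈ vertices u) (point≡ {p} {advance (end u) k east} (lin 3 1 (λ x y z m → z ⊕ nat m :≡ x ⇒ y :≡ z ⇒ ⊢ x :≡ y ⊕ nat m) refl f x-end) (trans e (sym y-end))) (from-trail m))
  clear-to west c {p} m e = ℤ.≮⇒≥ λ h → let k , g , f = offset h in
    c k g (subst (_∈ vertices u) (point≡ {p} {advance (end u) k west} (lin 3 1 (λ x y z m → x ⊕ nat m :≡ z ⇒ y :≡ z ⇒ ⊢ x :≡ y ⊖ nat m) refl f x-end) (trans e (sym y-end))) (from-trail m))

reverse-split : ∀ (u : List Dir) d v → reverse (u ++ d ∷ v) ≡ reverse v ++ d ∷ reverse u
reverse-split u d v = trans (reverse-++ u (d ∷ v))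
  (trans (cong (_++ reverse u) (unfold-reverse d v)) (++-assoc (reverse v) [ d ] (reverse u)))

legal-suffix : ∀ v {r} → Legal (v ++ r) → Legal r
legal-suffix []      lr       = lr
legal-suffix (_ ∷ v) (_ ∷ lr) = legal-suffix v lr

legal-allowed : ∀ w u d v → Legal (reverse w) → w ≡ u ++ d ∷ v → Allowed (reverse u) d
legal-allowed w u d v lr refl with legal-suffix (reverse v) (subst Legal (reverse-split u d v) lr)
... | a ∷ _ = a

legal-unique : ∀ {r} → Legal r → Unique (vertices (reverse r))
legal-unique [] = [] ∷ []
legal-unique {d ∷ r} (a ∷ lr) = subst Unique (sym (vertices-∷ d r)) (Unique.++⁺ (legal-unique lr) ([] ∷ [])
  λ { (m , here refl) → fresh d (Allowed.clear a) (reverse⁻ (subst (pos (d ∷ r) ∈_) (vertices-trail r) m)) })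

prudent-from : ∀ w → Legal (reverse w) → Prudent w
prudent-from w lr = subst SelfAvoiding (reverse-involutive w) (legal-unique lr) ,
  λ u d v e → clear-from u d (Allowed.clear (legal-allowed w u d v lr e))

three-sided-from : ∀ w → Legal (reverse w) → ThreeSided w
three-sided-from w lr =
  (λ i _ → side-from (take i w) (legal-side (legal-suffix (reverse (drop i w))
    (subst Legal (trans (cong reverse (sym (take++drop≡id i w))) (reverse-++ (take i w) (drop i w))) lr)))) ,
  λ u d v e w≡ h≢ c → Allowed.corner (legal-allowed w u d v lr e) (corner-to u d w≡ h≢ c)

take-prefix : ∀ (u : List Dir) d v → take (suc (length u)) (u ++ d ∷ v) ≡ u ∷ʳ d
take-prefix []      d v = refl
take-prefix (e ∷ u) d v = cong (e ∷_) (take-prefix u d v)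

prefix-length : ∀ (u : List Dir) d v → suc (length u) ℕ.≤ length (u ++ d ∷ v)
prefix-length []      d v = s≤s z≤n
prefix-length (_ ∷ u) d v = s≤s (prefix-length u d v)

allowed-to : ∀ w → Prudent w → ThreeSided w → ∀ u d v → w ≡ u ++ d ∷ v → Allowed (reverse u) d
allowed-to w (_ , clear) (side , corner) u d v refl = allowed
  (clear-to u d (clear u d v refl))
  -- The side condition for a step concerns the prefix that includes it, hence one more than the
  -- length of `u`.
  (subst Side (trans (cong reverse (take-prefix u d v)) (reverse-split u d []))
    (side-to (take (suc (length u)) w) (side (suc (length u)) (prefix-length u d v))))
  λ c → let w≡ , h≢ , s = corner-from u d c in corner u d v refl w≡ h≢ s

legal-to : ∀ w → Prudent w → ThreeSided w → Legal (reverse w)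
legal-to w p t = go (reverse w) λ v d r e →
  subst (λ u → Allowed u d) (reverse-involutive r)
    (allowed-to w p t (reverse r) d (reverse v)
      (trans (sym (reverse-involutive w)) (trans (cong reverse e) (reverse-split v d r))))
  where
  go : ∀ r → (∀ v d r′ → r ≡ v ++ d ∷ r′ → Allowed r′ d) → Legal r
  go []      h = []
  go (d ∷ r) h = h [] d r refl ∷ go r λ v d′ r′ e → h (d ∷ v) d′ r′ (cong (d ∷_) e)


-- Area

BoolFun : ℕ → Set
BoolFun zero    = Bool
BoolFun (suc n) = Bool → BoolFun n

Agree : ∀ n → BoolFun n → BoolFun n → Set
Agree zero    f g = f ≡ g
Agree (suc n) f g = ∀ b → Agree n (f b) (g b)

agree : ∀ n → BoolFun n → BoolFun n → Bool
agree zero    f g = not (f xor g)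
agree (suc n) f g = agree n (f false) (g false) ∧ agree n (f true) (g true)

-- For fixed comparisons of coordinates, the crossing identities below are Boolean identities in at
-- most six unknowns, so trying all values proves them.
truth-table : ∀ n (f g : BoolFun n) → agree n f g ≡ true → Agree n f g
truth-table zero    false false _ = refl
truth-table zero    true  true  _ = refl
truth-table (suc n) f g h b with agree n (f false) (g false) in e | agree n (f true) (g true) in e′
truth-table (suc n) f g h false | true | true = truth-table n (f false) (g false) e
truth-table (suc n) f g h true  | true | true = truth-table n (f true) (g true) e′

lt : ℤ → ℤ → Bool
lt z u = does (z ℤ.<? u)

lt-true : ∀ {z u} → z ℤ.< u → lt z u ≡ true
lt-true {z} {u} h with z ℤ.<? u
... | yes _ = refl
... | no ¬h = ⊥-elim (¬h h)

lt-false : ∀ {z u} → u ℤ.≤ z → lt z u ≡ false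
lt-false {z} {u} h with z ℤ.<? u
... | yes h′ = ⊥-elim (ℤ.<⇒≱ h′ h)
... | no  _  = refl

xor-range : ∀ {z u v} → u ℤ.≤ v → lt z u xor lt z v ≡ true → u ℤ.≤ z × z ℤ.< v
xor-range {z} {u} {v} h e with z ℤ.<? u | z ℤ.<? v
xor-range h () | yes p | yes q
xor-range h _  | yes p | no q = ⊥-elim (q (ℤ.<-≤-trans p h))
xor-range h _  | no p | yes q = ℤ.≮⇒≥ p , q
xor-range h () | no p | no q

range-xor : ∀ {z u v} → u ℤ.≤ z → z ℤ.< v → lt z u xor lt z v ≡ true
range-xor p q rewrite lt-false p | lt-true q = refl

∧-true : ∀ {a b} → a ∧ b ≡ true → a ≡ true × b ≡ true
∧-true {true} {true} _ = refl , refl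

-- The edge pq is crossed by the ray going east from the centre of the cell
-- (a , b) iff it lies east of it and its ends are on different sides of that ray.
bit : Cell → Point → Point → Bool
bit (a , b) (x , y) (_ , y′) = lt a x ∧ (lt b y xor lt b y′)

crossing : List Dir → Cell → Bool
crossing []      c = false
crossing (d ∷ r) c = crossing r c xor bit c (pos r) (pos (d ∷ r))

-- Crossings after closing up along y := t and x := 0 (without the horizontal edges).
closed : ℤ → List Dir → Cell → Bool
closed t r (a , b) = crossing r (a , b) xor
  ((lt a (X r) ∧ (lt b (Y r) xor lt b t)) xor (lt a 0ℤ ∧ (lt b 0ℤ xor lt b t)))

-- The counterpart of `closed` in the state `fin`: closing up along x = 1 to the row of the origin.
closed-east : List Dir → Cell → Bool
closed-east r (a , b) = crossing r (a , b) xor (lt a 1ℤ ∧ (lt b (Y r) xor lt b 0ℤ))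

True : (Cell → Bool) → Cell → Set
True f c = f c ≡ true

card-xor : ∀ {f g h : Cell → Bool} {m k} → HasCard (True f) m → HasCard (True g) k →
           (∀ c → True f c → True g c → ⊥) → (∀ c → h c ≡ f c xor g c) → HasCard (True h) (m ℕ.+ k)
card-xor {f} {g} {h} p q d e = card-resp (card-⊎ p q (d _)) (λ {c} → forth′ c) (λ {c} → back′ c)
  where
  forth′ : ∀ c → True f c ⊎ True g c → True h c
  forth′ c u with f c in ef | g c in eg | h c | e c
  forth′ c u | true | true | _ | _ = ⊥-elim (d c ef eg)
  forth′ c u | true | false | _ | refl = refl
  forth′ c u | false | true | _ | refl = refl
  forth′ c (inj₁ ()) | false | false | _ | refl
  forth′ c (inj₂ ()) | false | false | _ | refl
  back′ : ∀ c → True h c → True f c ⊎ True g c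
  back′ c u with f c | g c | h c | e c
  back′ c u | true | _ | _ | _ = inj₁ refl
  back′ c u | false | true | _ | _ = inj₂ refl
  back′ c () | false | false | _ | refl

card-row : ∀ x b k → HasCard {Cell} (λ c → x ℤ.≤ proj₁ c × proj₁ c ℤ.< x ℤ.+ + k × proj₂ c ≡ b) k
card-row x b zero = card-∅ λ { (p , q , _) → lin 2 0 (λ x y → x :≤ y ⇒ y :< x ⊕ con 0ℤ ⇒ ⊢ absurd) refl p q }
card-row x b (suc k) = subst (HasCard _) (ℕ.+-comm k 1) (card-resp (card-⊎ (card-row x b k) (card-singleton (x ℤ.+ + k , b)) λ { (p , q , _) refl → lin 1 1 (λ x m → x ⊕ nat m :< x ⊕ nat m ⇒ ⊢ absurd) refl {x} {k} q }) (λ { {c} (inj₁ (p , q , e)) → p , lin 2 1 (λ x y m → x :< y ⊕ nat m ⇒ ⊢ x :< y ⊕ nat (suc m)) refl {proj₁ c} {x} {k} q , e ; (inj₂ refl) → lin 1 1 (λ x m → ⊢ x :≤ x ⊕ nat m) refl {x} {k} , lin 1 1 (λ x m → ⊢ x ⊕ nat m :< x ⊕ nat (suc m)) refl {x} {k} , refl }) (λ { (p , q , e) → split p q e }))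
  where
  split : ∀ {c : Cell} → x ℤ.≤ proj₁ c → proj₁ c ℤ.< x ℤ.+ + suc k → proj₂ c ≡ b →
          (x ℤ.≤ proj₁ c × proj₁ c ℤ.< x ℤ.+ + k × proj₂ c ≡ b) ⊎ c ≡ (x ℤ.+ + k , b)
  split {c} p q e with ≤⊎> (x ℤ.+ + k) (proj₁ c)
  ... | inj₂ u = inj₁ (p , u , e)
  ... | inj₁ u = inj₂ (cong₂ _,_ (lin 2 1 (λ x y m → y ⊕ nat m :≤ x ⇒ x :< y ⊕ nat (suc m) ⇒ ⊢ x :≡ y ⊕ nat m) refl {proj₁ c} {x} {k} u q) e)

swap-cell : Cell → Cell
swap-cell (a , b) = b , a

card-column : ∀ a y k → HasCard {Cell} (λ c → proj₁ c ≡ a × y ℤ.≤ proj₂ c × proj₂ c ℤ.< y ℤ.+ + k) k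
card-column a y k = card-resp (card-map swap-cell swap-cell (λ _ → refl) (card-row y a k)) (λ { (_ , (p , q , e) , refl) → e , p , q }) (λ { {c} (e , p , q) → swap-cell c , (p , q , e) , refl })

-- The limits to the west, east and north separate the old cells from those of a new strip. There is
-- none to the south, where columns may reach any depth.
record Enclosed (f : Cell → Bool) (w m : ℕ) (t : ℤ) : Set where
  field
    cells  : HasCard (True f) m
    bounds : ∀ {c} → True f c → ℤ.- + w ℤ.≤ proj₁ c × proj₁ c ℤ.< 0ℤ × proj₂ c ℤ.< t

-- The closure in `closed` runs along x = 0, so it omits the `t` cells between x = 0 and x = 1 that
-- the state already counts in `n`.
AreaInv : State → List Dir → Set
AreaInv (exc w t e n d) r   = ∃[ m ] m ℕ.+ t ≡ n × Enclosed (closed (+ t) r) w m (+ t)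
AreaInv (crest i k t n d) r = ∃[ m ] m ℕ.+ t ≡ n × Enclosed (closed (+ t) r) (i ℕ.+ k) m (+ t)
AreaInv (fin y n) r         = HasCard (True (closed-east r)) n

enclosed-cong : ∀ {f g w w′ m t} → w ℕ.≤ w′ → (∀ c → g c ≡ f c) → Enclosed f w m t → Enclosed g w′ m t
enclosed-cong h e v = record
  { cells = card-resp cells (λ {c} p → trans (e c) p) (λ {c} p → trans (sym (e c)) p)
  ; bounds = λ {c} p → let x , y , z = bounds (trans (sym (e c)) p) in lin 1 2 (λ x m n → ⊝ nat n :≤ x ⇒ n :≤ⁿ m ⇒ ⊢ ⊝ nat m :≤ x) refl x h , y , z }
  where open Enclosed v

-- The end moves along the vertical segment that closes the walk, so the two changes cancel. In
-- `closed-level` that segment is empty, the walk being in the row to which it is closed up.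
closed-vertical : ∀ t d r → X (d ∷ r) ≡ X r → ∀ c → closed t (d ∷ r) c ≡ closed t r c
closed-vertical t d r e (a , b) rewrite e =
  truth-table 6 (λ cr lx hy hy′ ht k → (cr xor (lx ∧ (hy xor hy′))) xor ((lx ∧ (hy′ xor ht)) xor k))
                (λ cr lx hy hy′ ht k → cr xor ((lx ∧ (hy xor ht)) xor k)) refl
    (crossing r (a , b)) (lt a (X r)) (lt b (Y r)) (lt b (Y (d ∷ r))) (lt b t) _

closed-level : ∀ t d r → Y r ≡ t → Y (d ∷ r) ≡ Y r → ∀ c → closed t (d ∷ r) c ≡ closed t r c
closed-level t d r refl e (a , b) rewrite e =
  truth-table 5 (λ cr lx lx′ hy k → (cr xor (lx ∧ (hy xor hy))) xor ((lx′ ∧ (hy xor hy)) xor k))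
                (λ cr lx lx′ hy k → cr xor ((lx ∧ (hy xor hy)) xor k)) refl
    (crossing r (a , b)) (lt a (X r)) (lt a (X (d ∷ r))) (lt b (Y r)) _

strip : ℤ → ℤ → ℤ → ℤ → Cell → Bool
strip x x′ y y′ (a , b) = (lt a x xor lt a x′) ∧ (lt b y xor lt b y′)

strip-true : ∀ {x x′ y y′ c} → x ℤ.≤ x′ → y ℤ.≤ y′ → True (strip x x′ y y′) c →
             (x ℤ.≤ proj₁ c × proj₁ c ℤ.< x′) × (y ℤ.≤ proj₂ c × proj₂ c ℤ.< y′)
strip-true p q e = let u , v = ∧-true e in xor-range p u , xor-range q v

true-strip : ∀ {x x′ y y′ c} → x ℤ.≤ proj₁ c → proj₁ c ℤ.< x′ → y ℤ.≤ proj₂ c → proj₂ c ℤ.< y′ → True (strip x x′ y y′) c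
true-strip {c = a , b} p p′ q q′ rewrite range-xor p p′ | range-xor q q′ = refl

card-strip-row : ∀ x k y → HasCard (True (strip x (x ℤ.+ + k) y (y ℤ.+ 1ℤ))) k
card-strip-row x k y = card-resp (card-row x y k)
  (λ { (p , q , refl) → true-strip {x} {x ℤ.+ + k} {y} {y ℤ.+ 1ℤ} p q ℤ.≤-refl (lin 1 0 (λ x → ⊢ x :< x ⊕ con 1ℤ) refl) })
  (λ {c} e → let (p , q) , (u , v) = strip-true {x} {x ℤ.+ + k} {y} {y ℤ.+ 1ℤ} {c} (lin 1 1 (λ x m → ⊢ x :≤ x ⊕ nat m) refl) (lin 1 0 (λ x → ⊢ x :≤ x ⊕ con 1ℤ) refl) e in p , q , lin 2 0 (λ x y → y :≤ x ⇒ x :< y ⊕ con 1ℤ ⇒ ⊢ x :≡ y) refl u v)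

card-strip-column : ∀ x y k → HasCard (True (strip x (x ℤ.+ 1ℤ) y (y ℤ.+ + k))) k
card-strip-column x y k = card-resp (card-column x y k)
  (λ { (refl , p , q) → true-strip {x} {x ℤ.+ 1ℤ} {y} {y ℤ.+ + k} ℤ.≤-refl (lin 1 0 (λ x → ⊢ x :< x ⊕ con 1ℤ) refl) p q })
  (λ {c} e → let (p , q) , (u , v) = strip-true {x} {x ℤ.+ 1ℤ} {y} {y ℤ.+ + k} {c} (lin 1 0 (λ x → ⊢ x :≤ x ⊕ con 1ℤ) refl) (lin 1 1 (λ x m → ⊢ x :≤ x ⊕ nat m) refl) e in lin 2 0 (λ x y → y :≤ x ⇒ x :< y ⊕ con 1ℤ ⇒ ⊢ x :≡ y) refl p q , u , v)

card-strip-row′ : ∀ {x x′ y y′} k → x′ ≡ x ℤ.+ + k → y′ ≡ y ℤ.+ 1ℤ → HasCard (True (strip x x′ y y′)) k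
card-strip-row′ k refl refl = card-strip-row _ k _

card-strip-column′ : ∀ {x x′ y y′} k → x′ ≡ x ℤ.+ 1ℤ → y′ ≡ y ℤ.+ + k → HasCard (True (strip x x′ y y′)) k
card-strip-column′ k refl refl = card-strip-column _ _ k

enclosed-add : ∀ {f g h w w′ m k t t′} → Enclosed f w m t → w ℕ.≤ w′ → t ℤ.≤ t′ → HasCard (True g) k →
  (∀ {c} → True g c → ¬ (ℤ.- + w ℤ.≤ proj₁ c × proj₁ c ℤ.< 0ℤ × proj₂ c ℤ.< t)) →
  (∀ {c} → True g c → ℤ.- + w′ ℤ.≤ proj₁ c × proj₁ c ℤ.< 0ℤ × proj₂ c ℤ.< t′) →
  (∀ c → h c ≡ f c xor g c) → Enclosed h w′ (m ℕ.+ k) t′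
enclosed-add {f} {g} {h} {w} {w′} {m} {k} {t} {t′} v p q card disjoint inside e = record
  { cells = card-xor cells card (λ c u u′ → disjoint u′ (bounds u)) e
  ; bounds = λ {c} → new c }
  where
  open Enclosed v
  new : ∀ c → True h c → ℤ.- + w′ ℤ.≤ proj₁ c × proj₁ c ℤ.< 0ℤ × proj₂ c ℤ.< t′
  new c u with f c in ef | g c in eg | h c | e c
  ... | true | _ | _ | _ = let x , y , z = bounds ef in lin 1 2 (λ x m n → ⊝ nat n :≤ x ⇒ n :≤ⁿ m ⇒ ⊢ ⊝ nat m :≤ x) refl x p , y , ℤ.<-≤-trans z q
  ... | false | true | _ | _ = inside eg
  new c () | false | false | _ | refl

closed-col : ∀ t r c → closed t (west ∷ r) c ≡ closed t r c xor strip (X (west ∷ r)) (X r) (Y r) t c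
closed-col t r (a , b) =
  truth-table 6 (λ cr lx lx′ hy ht k → (cr xor (lx ∧ (hy xor hy))) xor ((lx′ ∧ (hy xor ht)) xor k))
                (λ cr lx lx′ hy ht k → (cr xor ((lx ∧ (hy xor ht)) xor k)) xor ((lx′ xor lx) ∧ (hy xor ht))) refl
    (crossing r (a , b)) (lt a (X r)) (lt a (X (west ∷ r))) (lt b (Y r)) (lt b t) _

closed-up : ∀ t r → Y r ≡ t → ∀ c →
            closed (t ℤ.+ 1ℤ) (north ∷ r) c ≡ closed t r c xor strip (X r) 0ℤ t (t ℤ.+ 1ℤ) c
closed-up t r refl (a , b) =
  truth-table 6 (λ cr lx l0 ht ht′ h0 → (cr xor (lx ∧ (ht xor ht′))) xor ((lx ∧ (ht′ xor ht′)) xor (l0 ∧ (h0 xor ht′))))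
                (λ cr lx l0 ht ht′ h0 → (cr xor ((lx ∧ (ht xor ht)) xor (l0 ∧ (h0 xor ht)))) xor ((lx xor l0) ∧ (ht xor ht′))) refl
    (crossing r (a , b)) (lt a (X r)) (lt a 0ℤ) (lt b (Y r)) (lt b (Y r ℤ.+ 1ℤ)) (lt b 0ℤ)

closed-exit : ∀ t r → X r ≡ 0ℤ → Y r ≡ t → ∀ c →
              closed-east (east ∷ r) c ≡ closed t r c xor strip 0ℤ 1ℤ 0ℤ t c
closed-exit t r e refl (a , b) rewrite e =
  truth-table 5 (λ cr l0 l1 ht h0 → (cr xor (l0 ∧ (ht xor ht))) xor (l1 ∧ (ht xor h0)))
                (λ cr l0 l1 ht h0 → (cr xor ((l0 ∧ (ht xor ht)) xor (l0 ∧ (h0 xor ht)))) xor ((l0 xor l1) ∧ (h0 xor ht))) refl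
    (crossing r (a , b)) (lt a 0ℤ) (lt a 1ℤ) (lt b (Y r)) (lt b 0ℤ)

closed-drop : ∀ r → X r ≡ 1ℤ → ∀ c → closed-east (south ∷ r) c ≡ closed-east r c
closed-drop r e (a , b) rewrite e =
  truth-table 5 (λ cr l1 hy hy′ h0 → (cr xor (l1 ∧ (hy xor hy′))) xor (l1 ∧ (hy′ xor h0)))
                (λ cr l1 hy hy′ h0 → cr xor (l1 ∧ (hy xor h0))) refl
    (crossing r (a , b)) (lt a 1ℤ) (lt b (Y r)) (lt b (Y (south ∷ r))) (lt b 0ℤ)

up-area : ∀ {i w t m r} → X r ≡ ℤ.- + i → Y r ≡ + t → i ℕ.≤ w →
          Enclosed (closed (+ t) r) w m (+ t) → Enclosed (closed (+ suc t) (north ∷ r)) w (m ℕ.+ i) (+ suc t)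
up-area {i} {w} {t} {m} {r} x≡ y≡ i≤w v =
  subst (λ z → Enclosed (closed z (north ∷ r)) w (m ℕ.+ i) z) (cong +_ (ℕ.+-comm t 1))
    (enclosed-add v ℕ.≤-refl (lin 0 1 (λ m → ⊢ nat m :≤ nat (m ⊕ con 1)) refl) (card-strip-row′ {X r} {0ℤ} {+ t} {+ t ℤ.+ 1ℤ} i (lin 1 1 (λ x m → x :≡ ⊝ nat m ⇒ ⊢ con 0ℤ :≡ x ⊕ nat m) refl x≡) refl)
      (λ {c} u (_ , _ , z) → let _ , (p , _) = area {c} u in lin 1 1 (λ x m → nat m :≤ x ⇒ x :< nat m ⇒ ⊢ absurd) refl p z)
      (λ {c} u → let (p , q) , (_ , q′) = area {c} u in lin 2 2 (λ x y m n → y :≤ x ⇒ y :≡ ⊝ nat n ⇒ n :≤ⁿ m ⇒ ⊢ ⊝ nat m :≤ x) refl p x≡ i≤w , q , q′)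
      (closed-up (+ t) r y≡))
  where
  area : ∀ {c} → True (strip (X r) 0ℤ (+ t) (+ t ℤ.+ 1ℤ)) c → _
  area {c} = strip-true {X r} {0ℤ} {+ t} {+ t ℤ.+ 1ℤ} {c} (lin 1 1 (λ x m → x :≡ ⊝ nat m ⇒ ⊢ x :≤ con 0ℤ) refl x≡) (lin 0 1 (λ m → ⊢ nat m :≤ nat m ⊕ con 1ℤ) refl)

step-area : ∀ {s d s′ r} → Step s d s′ → Inv s r → AreaInv s r → AreaInv s′ (d ∷ r)
step-area {s′ = exc _ t e _ _} {r = r} (col {w}) v (m , refl , a) = m ℕ.+ e , lin 0 3 (λ m n k → ⊢ m ⊕ n ⊕ k :≡ⁿ n ⊕ (m ⊕ k)) refl {m} {e} {t} ,
  enclosed-add a (ℕ.n≤1+n w) ℤ.≤-refl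
    (card-strip-column′ {X (west ∷ r)} {X r} {Y r} {+ t} e (lin 1 0 (λ x → ⊢ x :≡ x ⊖ con 1ℤ ⊕ con 1ℤ) refl) (lin 1 2 (λ x m n → x :≡ nat m ⊖ nat n ⇒ ⊢ nat m :≡ x ⊕ nat n) refl y≡))
    (λ {c} u (p , _ , _) → let (_ , q) , _ = new {c} u in lin 2 1 (λ x y m → ⊝ nat m :≤ x ⇒ x :< y ⇒ y :≡ ⊝ nat m ⇒ ⊢ absurd) refl p q x≡)
    (λ {c} u → let (p , q) , (_ , q′) = new {c} u in lin 2 1 (λ x y m → y ⊖ con 1ℤ :≤ x ⇒ y :≡ ⊝ nat m ⇒ ⊢ ⊝ nat (suc m) :≤ x) refl p x≡ , lin 2 1 (λ x y m → x :< y ⇒ y :≡ ⊝ nat m ⇒ ⊢ x :< con 0ℤ) refl q x≡ , q′)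
    (closed-col (+ t) r)
  where
  open Exc v
  new : ∀ {c} → True (strip (X (west ∷ r)) (X r) (Y r) (+ t)) c → _
  new {c} = strip-true {X (west ∷ r)} {X r} {Y r} {+ t} {c} (lin 1 0 (λ x → ⊢ x ⊖ con 1ℤ :≤ x) refl) (lin 1 2 (λ x m n → x :≡ nat m ⊖ nat n ⇒ ⊢ x :≤ nat m) refl {Y r} {t} {e} y≡)
step-area {r = r} (dig h) v (m , e , a) = m , e , enclosed-cong ℕ.≤-refl (closed-vertical _ south r refl) a
step-area {r = r} (climb h) v (m , e , a) = m , e , enclosed-cong ℕ.≤-refl (closed-vertical _ north r refl) a
step-area {r = r} (rise {w} {t} h) v (m , refl , a) = m ℕ.+ w , lin 0 3 (λ m n k → ⊢ m ⊕ n ⊕ suc k :≡ⁿ suc (n ⊕ (m ⊕ k))) refl {m} {w} {t} ,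
  subst (λ w′ → Enclosed _ w′ (m ℕ.+ w) _) (sym (ℕ.+-identityʳ w))
    (up-area {w} {w} {t} {m} {r} x≡ (lin 1 1 (λ x m → x :≡ nat m ⊖ con 0ℤ ⇒ ⊢ x :≡ nat m) refl y≡) ℕ.≤-refl a)
  where open Exc v
step-area {r = r} (lift {i} {k} {t}) v (m , refl , a) = m ℕ.+ i , lin 0 3 (λ m n k → ⊢ m ⊕ n ⊕ suc k :≡ⁿ suc (n ⊕ (m ⊕ k))) refl {m} {i} {t} ,
  up-area {i} {i ℕ.+ k} {t} {m} {r} x≡ y≡ (ℕ.m≤m+n i k) a
  where open Top v
step-area {r = r} (back {i} {k} h) v (m , e , a) = m , e ,
  enclosed-cong (ℕ.≤-reflexive (sym (ℕ.+-suc i k))) (closed-level _ east r (Top.y≡ v) refl) a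
step-area {r = r} (forth {i} {k} h) v (m , e , a) = m , e ,
  enclosed-cong (ℕ.≤-reflexive (ℕ.+-suc i k)) (closed-level _ west r (Top.y≡ v) refl) a
step-area {r = r} (over {i} h) v (m , e , a) = m , e ,
  enclosed-cong (ℕ.m≤n⇒m≤1+n (ℕ.≤-reflexive (ℕ.+-identityʳ i))) (closed-level _ west r (Top.y≡ v) refl) a
step-area {r = r} (exit {k} {t} h) v (m , refl , a) =
  card-xor cells (card-strip-column′ {0ℤ} {1ℤ} {0ℤ} {+ t} t refl refl)
    (λ c u u′ → let _ , p , _ = bounds u ; (q , _) , _ = strip-true {0ℤ} {1ℤ} {0ℤ} {+ t} {c} (lin 0 0 (⊢ con 0ℤ :≤ con 1ℤ) refl) (lin 0 1 (λ m → ⊢ con 0ℤ :≤ nat m) refl) u′ in lin 1 0 (λ x → x :< con 0ℤ ⇒ con 0ℤ :≤ x ⇒ ⊢ absurd) refl p q)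
    (closed-exit (+ t) r x≡ y≡)
  where
  open Top v
  open Enclosed a
step-area {r = r} fall v a = card-resp a (λ {c} p → trans (closed-drop r (Fin.x≡ v) c) p) (λ {c} p → trans (sym (closed-drop r (Fin.x≡ v) c)) p)

initial-area : AreaInv initial []
initial-area = 0 , refl , record
  { cells = card-∅ λ {c} u → never c u
  ; bounds = λ {c} u → ⊥-elim (never c u) }
  where
  never : ∀ c → ¬ True (closed 0ℤ []) c
  never (a , b) u = subst (_≢ true) (sym (truth-table 2 (λ l h → false xor ((l ∧ (h xor h)) xor (l ∧ (h xor h)))) (λ _ _ → false) refl
    (lt a 0ℤ) (lt b 0ℤ))) (λ ()) u

run-area : ∀ {r s} → Run r s → AreaInv s r
run-area []        = initial-area
run-area (st ∷ rn) = step-area st (proj₂ (run-sound rn)) (run-area rn)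

inside : List Dir → Cell → Bool
inside r c = crossing r c xor bit c (pos r) origin

accepted-area : ∀ {n r} → Accepted n r → HasCard (True (inside r)) n
accepted-area {n} {r} (_ , rn , around) = card-resp (run-area rn) (λ {c} → trans (eq c)) (λ {c} → trans (sym (eq c)))
  where
  open Fin (proj₂ (run-sound rn))
  eq : ∀ c → inside r c ≡ closed-east r c
  eq (a , b) rewrite x≡ = refl
accepted-area {n} {r} (_ , rn , hanging) with run-area rn
... | m , e , v = subst (HasCard _) (n≡ e) (card-resp (Enclosed.cells v) (λ {c} → trans (eq c)) (λ {c} → trans (sym (eq c))))
  where
  open Top (proj₂ (run-sound rn))
  n≡ : ∀ {m} → m ℕ.+ 1 ≡ suc n → m ≡ n
  n≡ e = lin 0 2 (λ m n → m ⊕ con 1 :≡ⁿ suc n ⇒ ⊢ m :≡ⁿ n) refl e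
  eq : ∀ c → inside r c ≡ closed 1ℤ r c
  eq (a , b) rewrite x≡ | y≡ =
    truth-table 4 (λ cr l0 h1 h0 → cr xor (l0 ∧ (h1 xor h0))) (λ cr l0 h1 h0 → cr xor ((l0 ∧ (h1 xor h1)) xor (l0 ∧ (h0 xor h1)))) refl
      (crossing r (a , b)) (lt a 0ℤ) (lt b 1ℤ) (lt b 0ℤ)
accepted-area {n} {r} (_ , rn , column) with run-area rn
... | m , e , v = subst (HasCard _) (n≡ e) (card-resp (Enclosed.cells v) (λ {c} → trans (eq c)) (λ {c} → trans (sym (eq c))))
  where
  open Exc (proj₂ (run-sound rn))
  n≡ : ∀ {m} → m ℕ.+ 0 ≡ n → m ≡ n
  n≡ e = lin 0 2 (λ m n → m ⊕ con 0 :≡ⁿ n ⇒ ⊢ m :≡ⁿ n) refl e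
  eq : ∀ c → inside r c ≡ closed 0ℤ r c
  eq (a , b) rewrite y≡ =
    truth-table 4 (λ cr l l0 h0 → cr xor (l ∧ (h0 xor h0))) (λ cr l l0 h0 → cr xor ((l ∧ (h0 xor h0)) xor (l0 ∧ (h0 xor h0)))) refl
      (crossing r (a , b)) (lt a (X r)) (lt a 0ℤ) (lt b 0ℤ)

-- Reflection takes the cell column `a` to -1 - a, so a vertical edge to the east of one is
-- reflected to the west of the other.
lt-mirror : ∀ a x → lt a (ℤ.- x) ≡ not (lt (-1ℤ ℤ.- a) x)
lt-mirror a x with ≤⊎> (ℤ.- x) a
... | inj₁ p = trans (lt-false p) (sym (cong not (lt-true (bound p))))
  where
  bound : ℤ.- x ℤ.≤ a → -1ℤ ℤ.- a ℤ.< x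
  bound p = lin 2 0 (λ x y → ⊝ y :≤ x ⇒ ⊢ con -1ℤ ⊖ x :< y) refl p
... | inj₂ p = trans (lt-true p) (sym (cong not (lt-false (bound p))))
  where
  bound : a ℤ.< ℤ.- x → x ℤ.≤ -1ℤ ℤ.- a
  bound p = lin 2 0 (λ x y → y :< ⊝ x ⇒ ⊢ x :≤ con -1ℤ ⊖ y) refl p

mirror-cell : Cell → Cell
mirror-cell (a , b) = -1ℤ ℤ.- a , b

-- Reflection turns the ray to the east into one to the west. Both rays together form a horizontal
-- line, which the open walk crosses an odd number of times exactly when its ends lie on different
-- sides. For the closed curve this correction disappears, as `inside-mirror` shows.
crossing-mirror : ∀ r a b → crossing (mirror r) (a , b) ≡ crossing r (-1ℤ ℤ.- a , b) xor (lt b 0ℤ xor lt b (Y r))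
crossing-mirror [] a b = sym (xor-same (lt b 0ℤ))
crossing-mirror (d ∷ r) a b rewrite crossing-mirror r a b | pos-mirror r | step-reflect (pos r) d | lt-mirror a (X r) =
  truth-table 5 (λ cr l h0 h h′ → (cr xor (h0 xor h)) xor (not l ∧ (h xor h′)))
                (λ cr l h0 h h′ → (cr xor (l ∧ (h xor h′))) xor (h0 xor h′)) refl
    (crossing r (-1ℤ ℤ.- a , b)) (lt (-1ℤ ℤ.- a) (X r)) (lt b 0ℤ) (lt b (Y r)) (lt b (Y (d ∷ r)))

inside-mirror : ∀ r c → inside (mirror r) c ≡ inside r (mirror-cell c)
inside-mirror r (a , b) rewrite crossing-mirror r a b | pos-mirror r | lt-mirror a (X r) =
  truth-table 4 (λ cr l h0 h → (cr xor (h0 xor h)) xor (not l ∧ (h xor h0)))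
                (λ cr l h0 h → cr xor (l ∧ (h xor h0))) refl
    (crossing r (-1ℤ ℤ.- a , b)) (lt (-1ℤ ℤ.- a) (X r)) (lt b 0ℤ) (lt b (Y r))

mirror-cell-involutive : ∀ c → mirror-cell (mirror-cell c) ≡ c
mirror-cell-involutive (a , b) = cong (_, b) (lin 1 0 (λ x → ⊢ con -1ℤ ⊖ (con -1ℤ ⊖ x) :≡ x) refl)

inside-card-mirror : ∀ {n} r → HasCard (True (inside r)) n → HasCard (True (inside (mirror r))) n
inside-card-mirror r h = card-resp (card-map mirror-cell mirror-cell mirror-cell-involutive h)
  (λ { (c , p , refl) → trans (inside-mirror r (mirror-cell c)) (trans (cong (inside r) (mirror-cell-involutive c)) p) })
  (λ {c} p → mirror-cell c , trans (sym (inside-mirror r c)) p , mirror-cell-involutive c)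

-- Agreement with the even-odd rule

odd : ℕ → Bool
odd zero    = false
odd (suc n) = not (odd n)

not-true : ∀ {b} → not b ≡ true → b ≢ true
not-true {false} _ ()

≢true : ∀ {b} → b ≢ true → not b ≡ true
≢true {false} _ = refl
≢true {true}  h = ⊥-elim (h refl)

odd-suc : ∀ n → (2 ∤ n) ⇔ odd n ≡ true → (2 ∤ suc n) ⇔ odd (suc n) ≡ true
odd-suc n h = mk⇔ (λ p → ≢true λ q → p (even n q)) λ p q → not-true {odd n} p (to h (consecutive q))
  where
  consecutive : 2 ∣ suc n → 2 ∤ n
  consecutive p q with ∣1⇒≡1 (∣m+n∣m⇒∣n (subst (2 ∣_) (ℕ.+-comm 1 n) p) q)
  ... | ()
  even : ∀ n → odd n ≡ true → 2 ∣ suc n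
  even (suc zero) _ = ∣-refl
  even (suc (suc n)) e = ∣m∣n⇒∣m+n (∣-refl {2}) (even n (trans (sym (not-not (odd n))) e))
    where
    not-not : ∀ b → not (not b) ≡ b
    not-not true  = refl
    not-not false = refl

odd-correct : ∀ n → (2 ∤ n) ⇔ odd n ≡ true
odd-correct zero    = mk⇔ (λ p → ⊥-elim (p (2 ∣0))) λ ()
odd-correct (suc n) = odd-suc n (odd-correct n)

parity : Cell → List Edge → Bool
parity c []       = false
parity c (e ∷ es) = does (crosses? c e) xor parity c es

parity-correct : ∀ c es → odd (length (filter (crosses? c) es)) ≡ parity c es
parity-correct c [] = refl
parity-correct c (e ∷ es) with does (crosses? c e)
... | true  = cong not (parity-correct c es)
... | false = parity-correct c es

xor-unit : ∀ z y → lt z y xor lt z (y ℤ.+ 1ℤ) ≡ does (y ℤ.≟ z)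
xor-unit z y with y ℤ.≟ z
... | yes refl = range-xor {y} {y} {y ℤ.+ 1ℤ} ℤ.≤-refl (lin 1 0 (λ x → ⊢ x :< x ⊕ con 1ℤ) refl)
... | no  p    = not-range λ e → let u , v = xor-range {z} {y} {y ℤ.+ 1ℤ} (lin 1 0 (λ x → ⊢ x :≤ x ⊕ con 1ℤ) refl) e in p (lin 2 0 (λ x y → x :≤ y ⇒ y :< x ⊕ con 1ℤ ⇒ ⊢ x :≡ y) refl u v)
  where
  not-range : ∀ {b} → b ≢ true → b ≡ false
  not-range {false} _ = refl
  not-range {true}  h = ⊥-elim (h refl)

does-refl : ∀ (x : ℤ) → does (x ℤ.≟ x) ≡ true
does-refl x with x ℤ.≟ x
... | yes _ = refl
... | no  p = ⊥-elim (p refl)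

does-≢ : ∀ {x y : ℤ} → x ≢ y → does (x ℤ.≟ y) ≡ false
does-≢ {x} {y} h with x ℤ.≟ y
... | yes p = ⊥-elim (h p)
... | no  _ = refl

east-moves : ∀ x → x ≢ x ℤ.+ 1ℤ
east-moves x e = lin 1 0 (λ x → x :≡ x ⊕ con 1ℤ ⇒ ⊢ absurd) refl e

west-moves : ∀ x → x ≢ x ℤ.- 1ℤ
west-moves x e = lin 1 0 (λ x → x :≡ x ⊖ con 1ℤ ⇒ ⊢ absurd) refl e

level-bit : ∀ l h → l ∧ (h xor h) ≡ false
level-bit = truth-table 2 (λ l h → l ∧ (h xor h)) (λ _ _ → false) refl

crosses-bit : ∀ c p d → does (crosses? c (p , step p d)) ≡ bit c p (step p d)
crosses-bit (a , b) (x , y) north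
  rewrite does-refl x | ℤ.i≤j⇒i⊓j≡i {y} {y ℤ.+ 1ℤ} (lin 1 0 (λ x → ⊢ x :≤ x ⊕ con 1ℤ) refl) = cong (lt a x ∧_) (sym (xor-unit b y))
crosses-bit (a , b) (x , y) south
  rewrite does-refl x | ℤ.i≥j⇒i⊓j≡j {y} {y ℤ.- 1ℤ} (lin 1 0 (λ x → ⊢ x ⊖ con 1ℤ :≤ x) refl) =
  cong (lt a x ∧_) (sym (trans (xor-comm (lt b y) _)
    (trans (cong (λ z → lt b (y ℤ.- 1ℤ) xor lt b z) (above y)) (xor-unit b (y ℤ.- 1ℤ)))))
  where
  above : ∀ y → y ≡ (y ℤ.- 1ℤ) ℤ.+ 1ℤ
  above y = lin 1 0 (λ x → ⊢ x :≡ x ⊖ con 1ℤ ⊕ con 1ℤ) refl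
crosses-bit (a , b) (x , y) east rewrite does-≢ (east-moves x) = sym (level-bit (lt a x) (lt b y))
crosses-bit (a , b) (x , y) west rewrite does-≢ (west-moves x) = sym (level-bit (lt a x) (lt b y))

edgesFrom : Point → Walk → List Edge
edgesFrom p w = zip (verticesFrom p w) (drop 1 (verticesFrom p w) ++ [ origin ])

edgesFrom-∷ : ∀ p d w → edgesFrom p (d ∷ w) ≡ (p , step p d) ∷ edgesFrom (step p d) w
edgesFrom-∷ p d []      = refl
edgesFrom-∷ p d (_ ∷ w) = refl

parityFrom : Cell → Point → Walk → Bool
parityFrom c p []      = false
parityFrom c p (d ∷ w) = bit c p (step p d) xor parityFrom c (step p d) w

-- Adjacency makes the closing edge a unit step, so `crosses-bit` covers it like the others.
parity-edges : ∀ c p w d → step (foldl step p w) d ≡ origin →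
               parity c (edgesFrom p w) ≡ parityFrom c p w xor bit c (foldl step p w) origin
parity-edges c p [] d e = trans (xor-identityʳ _)
  (subst (λ q → does (crosses? c (p , q)) ≡ bit c p q) e (crosses-bit c p d))
parity-edges c p (d′ ∷ w) d e = trans (cong (parity c) (edgesFrom-∷ p d′ w))
  (trans (cong₂ _xor_ (crosses-bit c p d′) (parity-edges c (step p d′) w d e))
         (sym (xor-assoc (bit c p (step p d′)) _ _)))

parityFrom-∷ʳ : ∀ c p w d → parityFrom c p (w ∷ʳ d) ≡ parityFrom c p w xor bit c (foldl step p w) (step (foldl step p w) d)
parityFrom-∷ʳ c p []       d = xor-identityʳ _
parityFrom-∷ʳ c p (d′ ∷ w) d = trans (cong (bit c p (step p d′) xor_) (parityFrom-∷ʳ c (step p d′) w d))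
  (sym (xor-assoc (bit c p (step p d′)) _ _))

parity-crossing : ∀ c r → parityFrom c origin (reverse r) ≡ crossing r c
parity-crossing c []      = refl
parity-crossing c (d ∷ r) = trans (cong (parityFrom c origin) (unfold-reverse d r))
  (trans (parityFrom-∷ʳ c origin (reverse r) d)
  (cong₂ _xor_ (parity-crossing c r) (cong (λ p → bit c p (step p d)) (end-pos r))))

encloses-inside : ∀ {r} → Adjacent (pos r) origin → ∀ c → Encloses (reverse r) c ⇔ inside r c ≡ true
encloses-inside {r} (d , e) c = mk⇔ (λ p → trans (sym eq) (to (odd-correct _) p)) (λ p → from (odd-correct _) (trans eq p))
  where
  eq : odd (length (filter (crosses? c) (edges (reverse r)))) ≡ inside r c
  eq = trans (parity-correct c (edges (reverse r)))
    (trans (parity-edges c origin (reverse r) d (trans (cong (λ p → step p d) (end-pos r)) e))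
      (cong₂ _xor_ (parity-crossing c r) (cong (λ p → bit c p origin) (end-pos r))))

has-area : ∀ {r n} → Adjacent (pos r) origin → HasCard (True (inside r)) n → HasArea (reverse r) n
has-area {r} adj h = card-resp h (λ {c} → from (encloses-inside {r} adj c)) (λ {c} → to (encloses-inside {r} adj c))

-- Enumeration

-- The number of walks of area n in a box of width w that have just extended it to the
-- west (X₁, or X₀ for those still under the row of the origin), respectively opened a new
-- top row (F).  The history lists F w (n − 1), …, F w 0.
module _ (x : ℕ → ℕ) (w : ℕ) where
  history : ℕ → List ℕ
  fill    : ℕ → ℕ
  history zero    = []
  history (suc n) = sum (take (suc w) (history n)) ℕ.+ lag (suc w) x n ∷ history n
  fill n = sum (take (suc w) (history n)) ℕ.+ lag (suc w) x n

X₀ X₁ F : ℕ → ℕ → ℕ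
X₀ zero    zero    = 1
X₀ zero    (suc _) = 0
X₀ (suc w) n       = ∑< (suc n) (X₀ w)
X₁ zero    n       = X₀ zero n
X₁ (suc w) n       = ∑< (suc n) (X₁ w) ℕ.+ fill (X₁ w) w n
F w = fill (X₁ w) w

-- The cutoff at w ≤ n loses nothing, since opening a row in a box of width w costs more than w
-- cells. The shift by `suc w` in `hangings` is the row of cells between y = 0 and y = 1.
arounds hangings columns polygons : ℕ → ℕ
arounds n  = ∑< (suc n) (λ w → F w n)
hangings n = ∑< n (λ w → lag (suc w) (X₀ (suc w)) n)
columns zero    = 0
columns (suc _) = 1
polygons n = arounds n ℕ.+ (hangings n ℕ.+ columns n)

∑<-shift : ∀ k f → ∑< (suc k) f ≡ f 0 ℕ.+ ∑< k (λ j → f (suc j))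
∑<-shift zero    f = ℕ.+-comm 0 (f 0)
∑<-shift (suc k) f = trans (cong (ℕ._+ f (suc k)) (∑<-shift k f)) (ℕ.+-assoc (f 0) _ _)

∑<-zero : ∀ k {f} → (∀ j → f j ≡ 0) → ∑< k f ≡ 0
∑<-zero zero    h = refl
∑<-zero (suc k) h = cong₂ ℕ._+_ (∑<-zero k h) (h k)

history-sum : ∀ x w k n → sum (take k (history x w n)) ≡ ∑< k (λ j → lag (suc j) (fill x w) n)
history-sum x w zero    n       = refl
history-sum x w (suc k) zero    = sym (∑<-zero (suc k) λ _ → refl)
history-sum x w (suc k) (suc n) = trans (cong (λ z → fill x w n ℕ.+ z) (history-sum x w k n))
  (sym (∑<-shift k (λ j → lag (suc j) (fill x w) (suc n))))

F-recurrence : ∀ w n → F w n ≡ ∑< (suc w) (λ j → lag (suc j) (F w) n) ℕ.+ lag (suc w) (X₁ w) n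
F-recurrence w n = cong (ℕ._+ lag (suc w) (X₁ w) n) (history-sum (X₁ w) w (suc w) n)

-- Between two marked steps the walk is monotone, because it cannot reverse, and so the piece is
-- determined by its two ends. At most one of the truncated differences is non-zero.
vertical horizontal : ℕ → ℕ → List Dir → List Dir
vertical d e r   = replicate (e ∸ d) south ++ replicate (d ∸ e) north ++ r
horizontal i j r = replicate (i ∸ j) east ++ replicate (j ∸ i) west ++ r

vertical-south : ∀ c d r → vertical d (c ℕ.+ d) r ≡ replicate c south ++ r
vertical-south c d r rewrite ℕ.m+n∸n≡m c d | ℕ.m≤n⇒m∸n≡0 (ℕ.m≤n+m d c) = refl

vertical-north : ∀ c e r → vertical (c ℕ.+ e) e r ≡ replicate c north ++ r
vertical-north c e r rewrite ℕ.m+n∸n≡m c e | ℕ.m≤n⇒m∸n≡0 (ℕ.m≤n+m e c) = refl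

horizontal-east : ∀ c j r → horizontal (c ℕ.+ j) j r ≡ replicate c east ++ r
horizontal-east c j r rewrite ℕ.m+n∸n≡m c j | ℕ.m≤n⇒m∸n≡0 (ℕ.m≤n+m j c) = refl

horizontal-west : ∀ c i r → horizontal i (c ℕ.+ i) r ≡ replicate c west ++ r
horizontal-west c i r rewrite ℕ.m+n∸n≡m c i | ℕ.m≤n⇒m∸n≡0 (ℕ.m≤n+m i c) = refl

strip-vertical strip-horizontal strip-east strip-south rest : List Dir → List Dir
strip-vertical (north ∷ r) = strip-vertical r
strip-vertical (south ∷ r) = strip-vertical r
strip-vertical r           = r
strip-horizontal (east ∷ r) = strip-horizontal r
strip-horizontal (west ∷ r) = strip-horizontal r
strip-horizontal r          = r
strip-east (east ∷ r) = strip-east r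
strip-east r          = r
strip-south (south ∷ r) = strip-south r
strip-south r           = r
rest []      = []
rest (_ ∷ r) = r

strip-vertical-vertical : ∀ d e {r} → heading r ≡ west → strip-vertical (vertical d e r) ≡ r
strip-vertical-vertical d e {r} h = go (e ∸ d) (d ∸ e) r h
  where
  go : ∀ a b r → heading r ≡ west → strip-vertical (replicate a south ++ replicate b north ++ r) ≡ r
  go (suc a) b       r          h = go a b r h
  go zero    (suc b) r          h = go zero b r h
  go zero    zero    []         h = refl
  go zero    zero    (west ∷ r) h = refl

strip-horizontal-horizontal : ∀ i j {r} → heading r ≡ north → strip-horizontal (horizontal i j r) ≡ r
strip-horizontal-horizontal i j {r} h = go (i ∸ j) (j ∸ i) r h
  where
  go : ∀ a b r → heading r ≡ north → strip-horizontal (replicate a east ++ replicate b west ++ r) ≡ r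
  go (suc a) b       r           h = go a b r h
  go zero    (suc b) r           h = go zero b r h
  go zero    zero    (north ∷ r) h = refl

strip-east-north : ∀ k r → strip-east (replicate k east ++ north ∷ r) ≡ north ∷ r
strip-east-north zero    r = refl
strip-east-north (suc k) r = strip-east-north k r

strip-south-east : ∀ k r → strip-south (replicate k south ++ east ∷ r) ≡ east ∷ r
strip-south-east zero    r = refl
strip-south-east (suc k) r = strip-south-east k r

gap : ∀ {m n} → m ≤ n → ∃[ c ] c ℕ.+ m ≡ n
gap h = _ , ℕ.m∸n+n≡m h

run-south : ∀ {r w t d n} c → Run r (exc w t d n west) → ∃[ l ] Run (replicate c south ++ r) (exc w t (c ℕ.+ d) n l) × l ≢ north
run-south zero    rn = west , rn , λ ()
run-south (suc c) rn = let l , rn′ , h = run-south c rn in south , dig h ∷ rn′ , λ ()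

run-north : ∀ {r w t n} c e → Run r (exc w t (c ℕ.+ e) n west) → ∃[ l ] Run (replicate c north ++ r) (exc w t e n l) × l ≢ south
run-north zero    e rn = west , rn , λ ()
run-north {r} {w} {t} {n} (suc c) e rn =
  let l , rn′ , h = run-north c (suc e) (subst (λ z → Run r (exc w t z n west)) (sym (ℕ.+-suc c e)) rn) in
  north , climb h ∷ rn′ , λ ()

run-vertical : ∀ {r w t d n} e → Run r (exc w t d n west) → ∃[ l ] Run (vertical d e r) (exc w t e n l) × (e ≡ 0 → l ≢ south)
run-vertical {r} {w} {t} {d} {n} e rn with ℕ.≤-total d e
... | inj₁ d≤e with gap d≤e
...   | c , refl rewrite vertical-south c d r = conclude c (run-south c rn)
  where
  conclude : ∀ c → ∃[ l ] Run (replicate c south ++ r) (exc w t (c ℕ.+ d) n l) × l ≢ north →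
             ∃[ l ] Run (replicate c south ++ r) (exc w t (c ℕ.+ d) n l) × (c ℕ.+ d ≡ 0 → l ≢ south)
  conclude zero    _ = west , rn , λ _ ()
  conclude (suc c) (l , rn′ , h) = l , rn′ , λ ()
run-vertical {r} {w} {t} {d} {n} e rn | inj₂ e≤d with gap e≤d
...   | c , refl rewrite vertical-north c e r = let l , rn′ , h = run-north c e rn in l , rn′ , λ _ → h

run-east : ∀ {r k t n} c j → Run r (crest (c ℕ.+ j) k t n north) →
           ∃[ l ] Run (replicate c east ++ r) (crest j (c ℕ.+ k) t n l) × l ≢ west × (c ≡ 0 → l ≡ north)
run-east zero    j rn = north , rn , (λ ()) , λ _ → refl
run-east {r} {k} {t} {n} (suc c) j rn =
  let l , rn′ , h , _ = run-east c (suc j) (subst (λ z → Run r (crest z k t n north)) (sym (ℕ.+-suc c j)) rn) in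
  east , back h ∷ rn′ , (λ ()) , λ ()

run-west : ∀ {r i t n} c k → Run r (crest i (c ℕ.+ k) t n north) →
           ∃[ l ] Run (replicate c west ++ r) (crest (c ℕ.+ i) k t n l) × l ≢ east × (c ≡ 0 → l ≡ north)
run-west zero    k rn = north , rn , (λ ()) , λ _ → refl
run-west {r} {i} {t} {n} (suc c) k rn =
  let l , rn′ , h , _ = run-west c (suc k) (subst (λ z → Run r (crest i z t n north)) (sym (ℕ.+-suc c k)) rn) in
  west , forth h ∷ rn′ , (λ ()) , λ ()

run-horizontal : ∀ {r i k t n} j k′ → i ℕ.+ k ≡ j ℕ.+ k′ → Run r (crest i k t n north) →
                 ∃[ l ] Run (horizontal i j r) (crest j k′ t n l) × (j ≡ 0 → l ≢ west) × (k′ ≡ 0 → l ≢ east)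
run-horizontal {r} {i} {k} {t} {n} j k′ e rn with ℕ.≤-total i j
... | inj₁ i≤j with gap i≤j
...   | c , refl rewrite horizontal-west c i r =
  let l , rn′ , h , g = run-west c k′ (subst (λ z → Run r (crest i z t n north)) k≡ rn) in
  l , rn′ , (λ z q → north≢west (trans (sym (g (ℕ.m+n≡0⇒m≡0 c z))) q)) , λ _ → h
  where
  k≡ : k ≡ c ℕ.+ k′
  k≡ = lin 0 4 (λ m n k l → l ⊕ m :≡ⁿ n ⊕ l ⊕ k ⇒ ⊢ m :≡ⁿ n ⊕ k) refl {k} {c} {k′} {i} e
  north≢west : north ≢ west
  north≢west ()
run-horizontal {r} {i} {k} {t} {n} j k′ e rn | inj₂ j≤i with gap j≤i
...   | c , refl rewrite horizontal-east c j r =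
  let l , rn′ , h , g = run-east c j rn in
  l , subst (λ z → Run (replicate c east ++ r) (crest j z t n l)) (sym k′≡) rn′ , (λ _ → h) ,
  λ z q → north≢east (trans (sym (g (ℕ.m+n≡0⇒m≡0 c (trans (sym k′≡) z)))) q)
  where
  k′≡ : k′ ≡ c ℕ.+ k
  k′≡ = lin 0 4 (λ m n k l → n ⊕ l ⊕ k :≡ⁿ l ⊕ m ⇒ ⊢ m :≡ⁿ n ⊕ k) refl {k′} {c} {k} {j} e
  north≢east : north ≢ east
  north≢east ()

-- The last index is the current direction: it excludes a reversal when the piece grows, so that
-- only these three shapes arise.
data VerticalRun (r : List Dir) (d : ℕ) : List Dir → ℕ → Dir → Set where
  none   : VerticalRun r d r d west
  souths : ∀ c → VerticalRun r d (replicate (suc c) south ++ r) (suc c ℕ.+ d) south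
  norths : ∀ c {e} → d ≡ suc c ℕ.+ e → VerticalRun r d (replicate (suc c) north ++ r) e north

vertical-run : ∀ {s w t e n l} → Run s (exc w t e n l) → ∃[ r ] ∃[ d ] Run r (exc w t d n west) × VerticalRun r d s e l
vertical-run []         = _ , _ , [] , none
vertical-run (col ∷ rn) = _ , _ , col ∷ rn , none
vertical-run (over h ∷ rn) = _ , _ , over h ∷ rn , none
vertical-run (dig h ∷ rn) with vertical-run rn
... | r , d , rn′ , none       = r , d , rn′ , souths 0
... | r , d , rn′ , souths c   = r , d , rn′ , souths (suc c)
... | r , d , rn′ , norths c _ = ⊥-elim (h refl)
vertical-run (climb h ∷ rn) with vertical-run rn
... | r , d , rn′ , none       = r , d , rn′ , norths 0 refl
... | r , d , rn′ , souths c   = ⊥-elim (h refl)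
... | r , d , rn′ , norths c e = r , d , rn′ , norths (suc c) (lin 0 3 (λ m n k → m :≡ⁿ suc (n ⊕ suc k) ⇒ ⊢ m :≡ⁿ suc (suc (n ⊕ k))) refl e)

vertical≡ : ∀ {r d s e l} → VerticalRun r d s e l → s ≡ vertical d e r
vertical≡ {r} {d} none            = sym (vertical-south 0 d r)
vertical≡ {r} {d} (souths c)      = sym (vertical-south (suc c) d r)
vertical≡ {r} {d} (norths c {e} refl) = sym (vertical-north (suc c) e r)

data HorizontalRun (r : List Dir) (i : ℕ) : List Dir → ℕ → Dir → Set where
  none  : HorizontalRun r i r i north
  easts : ∀ c {j} → i ≡ suc c ℕ.+ j → HorizontalRun r i (replicate (suc c) east ++ r) j east
  wests : ∀ c → HorizontalRun r i (replicate (suc c) west ++ r) (suc c ℕ.+ i) west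

horizontal-run : ∀ {s j k t n l} → Run s (crest j k t n l) →
                 ∃[ r ] ∃[ i ] ∃[ k′ ] i ℕ.+ k′ ≡ j ℕ.+ k × Run r (crest i k′ t n north) × HorizontalRun r i s j l
horizontal-run (rise h ∷ rn) = _ , _ , _ , refl , rise h ∷ rn , none
horizontal-run (lift ∷ rn)   = _ , _ , _ , refl , lift ∷ rn , none
horizontal-run (back h ∷ rn) with horizontal-run rn
... | r , i , k′ , e , rn′ , none      = r , i , k′ , trans e (sym (ℕ.+-suc _ _)) , rn′ , easts 0 refl
... | r , i , k′ , e , rn′ , easts c f = r , i , k′ , trans e (sym (ℕ.+-suc _ _)) , rn′ , easts (suc c) (trans f (cong suc (ℕ.+-suc c _)))
... | r , i , k′ , e , rn′ , wests c   = ⊥-elim (h refl)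
horizontal-run (forth h ∷ rn) with horizontal-run rn
... | r , i , k′ , e , rn′ , none      = r , i , k′ , lin 0 3 (λ m n k → m ⊕ n :≡ⁿ m ⊕ suc k ⇒ ⊢ m ⊕ n :≡ⁿ suc (m ⊕ k)) refl e , rn′ , wests 0
... | r , i , k′ , e , rn′ , easts c f = ⊥-elim (h refl)
... | r , i , k′ , e , rn′ , wests c   = r , i , k′ , trans e (cong suc (ℕ.+-suc (c ℕ.+ i) _)) , rn′ , wests (suc c)

horizontal≡ : ∀ {r i s j l} → HorizontalRun r i s j l → s ≡ horizontal i j r
horizontal≡ {r} {i} none                = sym (horizontal-west 0 i r)
horizontal≡ {r} {i} (wests c)           = sym (horizontal-west (suc c) i r)
horizontal≡ {r} {i} (easts c {j} refl)  = sym (horizontal-east (suc c) j r)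

-- The headings mark the moments at which the past ceases to matter. `T` restricts the height of the
-- box: `Zero` selects the walks still under the row of the origin.
AfterWest : (ℕ → Set) → ℕ → ℕ → List Dir → Set
AfterWest T w n r = ∃[ t ] ∃[ d ] T t × Run r (exc w t d n west)

AfterRise : (ℕ → Set) → ℕ → ℕ → List Dir → Set
AfterRise T w n r = ∃[ i ] ∃[ k ] ∃[ t ] i ℕ.+ k ≡ w × T t × Run r (crest i k t n north)

module _ {T : ℕ → Set} {w n : ℕ} (f : ℕ → ℕ → List Dir → List Dir) (g : List Dir → List Dir)
         (inverse : ∀ t d {r} → heading r ≡ west → g (f t d r) ≡ r) where

  WestImage : List Dir → Set
  WestImage s = ∃[ t ] ∃[ d ] ∃[ r ] T t × Run r (exc w t d n west) × s ≡ f t d r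

  -- The height and depth passed to `f` are functions of the walk by `run-deterministic`, and `g`
  -- recovers the walk; this makes the image relation functional and injective.
  card-west-image : ∀ {c} → HasCard (AfterWest T w n) c → HasCard WestImage c
  card-west-image h = card-resp
    (card-image (λ r s → ∃[ t ] ∃[ d ] T t × Run r (exc w t d n west) × s ≡ f t d r)
      (λ (t , d , p , rn) → _ , t , d , p , rn , refl)
      (λ { _ (_ , _ , _ , rn , e) (_ , _ , _ , rn′ , e′) → functional rn rn′ e e′ })
      (λ { _ _ (t , d , _ , rn , e) (t′ , d′ , _ , rn′ , e′) →
        trans (sym (recover t d rn e)) (recover t′ d′ rn′ e′) }) h)
    (λ { (r , _ , t , d , p , rn , e) → t , d , r , p , rn , e })
    (λ { (t , d , r , p , rn , e) → r , (t , d , p , rn) , t , d , p , rn , e })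
    where
    recover : ∀ {r s} t d → Run r (exc w t d n west) → s ≡ f t d r → g s ≡ r
    recover t d rn refl = inverse t d (Exc.heading≡ (proj₂ (run-sound rn)))
    functional : ∀ {r t d t′ d′ s s′} → Run r (exc w t d n west) → Run r (exc w t′ d′ n west) →
                 s ≡ f t d r → s′ ≡ f t′ d′ r → s ≡ s′
    functional rn rn′ refl refl with run-deterministic rn rn′
    ... | refl = refl

module _ {T : ℕ → Set} {w n : ℕ} (f : ℕ → ℕ → ℕ → List Dir → List Dir) (g : List Dir → List Dir)
         (inverse : ∀ i k t {r} → heading r ≡ north → g (f i k t r) ≡ r) where

  RiseImage : List Dir → Set
  RiseImage s = ∃[ i ] ∃[ k ] ∃[ t ] ∃[ r ] i ℕ.+ k ≡ w × T t × Run r (crest i k t n north) × s ≡ f i k t r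

  card-rise-image : ∀ {c} → HasCard (AfterRise T w n) c → HasCard RiseImage c
  card-rise-image h = card-resp
    (card-image (λ r s → ∃[ i ] ∃[ k ] ∃[ t ] Run r (crest i k t n north) × s ≡ f i k t r)
      (λ (i , k , t , q , p , rn) → _ , i , k , t , rn , refl)
      (λ { _ (_ , _ , _ , rn , e) (_ , _ , _ , rn′ , e′) → functional rn rn′ e e′ })
      (λ { _ _ (i , k , t , rn , e) (i′ , k′ , t′ , rn′ , e′) →
        trans (sym (recover i k t rn e)) (recover i′ k′ t′ rn′ e′) }) h)
    (λ { (r , (i , k , t , q , p , rn) , _ , _ , _ , rn′ , e) → i , k , t , r , q , p , rn , functional rn′ rn e refl })
    (λ { (i , k , t , r , q , p , rn , e) → r , (i , k , t , q , p , rn) , i , k , t , rn , e })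
    where
    recover : ∀ {r s} i k t → Run r (crest i k t n north) → s ≡ f i k t r → g s ≡ r
    recover i k t rn refl = inverse i k t (Top.heading≡ (proj₂ (run-sound rn)))
    functional : ∀ {r i k t i′ k′ t′ s s′} → Run r (crest i k t n north) → Run r (crest i′ k′ t′ n north) →
                 s ≡ f i k t r → s′ ≡ f i′ k′ t′ r → s ≡ s′
    functional rn rn′ refl refl with run-deterministic rn rn′
    ... | refl = refl

Any Zero : ℕ → Set
Any _  = ⊤
Zero t = t ≡ 0

exc-injective : ∀ {w t e n d w′ t′ e′ n′ d′} → exc w t e n d ≡ exc w′ t′ e′ n′ d′ → w ≡ w′ × e ≡ e′ × n ≡ n′
exc-injective refl = refl , refl , refl

crest-injective : ∀ {i k t n d i′ k′ t′ n′ d′} → crest i k t n d ≡ crest i′ k′ t′ n′ d′ → i ≡ i′ × k ≡ k′ × n ≡ n′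
crest-injective refl = refl , refl , refl

module _ (T : ℕ → Set) (w n : ℕ) where

  -- The new column is given the depth `n ∸ m`, the area that it adds.
  columnWalk : ℕ → ℕ → ℕ → List Dir → List Dir
  columnWalk m t d r = west ∷ vertical d (n ∸ m) r

  overWalk : ℕ → ℕ → ℕ → List Dir → List Dir
  overWalk i k t r = west ∷ horizontal i (i ℕ.+ k) r

  inverse-column : ∀ m t d {r} → heading r ≡ west → strip-vertical (rest (columnWalk m t d r)) ≡ r
  inverse-column m t d = strip-vertical-vertical d (n ∸ m)

  inverse-over : ∀ i k t {r} → heading r ≡ north → strip-horizontal (rest (overWalk i k t r)) ≡ r
  inverse-over i k t = strip-horizontal-horizontal i (i ℕ.+ k)

  Column : ℕ → List Dir → Set
  Column m = WestImage {T} {w} {m} (columnWalk m) (λ s → strip-vertical (rest s)) (inverse-column m)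

  Over : List Dir → Set
  Over = RiseImage {T} {w} {n} overWalk (λ s → strip-horizontal (rest s)) inverse-over

  column-run : ∀ {m s} → Column m s → ∃[ t ] ∃[ l ] T t × (∃[ s′ ] s ≡ west ∷ s′ × Run s′ (exc w t (n ∸ m) m l))
  column-run {m} (t , d , r , p , rn , refl) = let l , rn′ , _ = run-vertical (n ∸ m) rn in t , l , p , _ , refl , rn′

  over-run : ∀ {s} → Over s → ∃[ t ] ∃[ l ] T t × l ≢ east × (∃[ s′ ] s ≡ west ∷ s′ × Run s′ (crest w 0 t n l))
  over-run (i , k , t , r , refl , p , rn , refl) =
    let l , rn′ , _ , h = run-horizontal (i ℕ.+ k) 0 (sym (ℕ.+-identityʳ (i ℕ.+ k))) rn in t , l , p , h refl , _ , refl , rn′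

  to-west : ∀ {s} → (∃[ m ] m < suc n × Column m s) ⊎ Over s → AfterWest T (suc w) n s
  to-west (inj₁ (m , s≤s m≤n , c)) with column-run c
  ... | t , l , p , _ , refl , rn = t , n ∸ m , p , subst (λ z → Run _ (exc (suc w) t (n ∸ m) z west)) (ℕ.m∸n+n≡m m≤n) (col ∷ rn)
  to-west (inj₂ o) with over-run o
  ... | t , l , p , h , _ , refl , rn = t , 0 , p , over h ∷ rn

  from-west : ∀ {s} → AfterWest T (suc w) n s → (∃[ m ] m < suc n × Column m s) ⊎ Over s
  from-west (t , d , p , col {n = m} ∷ rn) with vertical-run rn
  ... | r , d₀ , rn′ , v = inj₁ (m , s≤s (ℕ.m≤n+m m d) , t , d₀ , r , p , rn′ ,
    cong (west ∷_) (trans (vertical≡ v) (cong (λ e → vertical d₀ e r) (sym (ℕ.m+n∸n≡m d m)))))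
  from-west (t , d , p , over h ∷ rn) with horizontal-run rn
  ... | r , i , k , e , rn′ , v = inj₂ (i , k , t , r , trans e (ℕ.+-identityʳ w) , p , rn′ ,
    cong (west ∷_) (trans (horizontal≡ v) (cong (λ j → horizontal i j r) (sym (trans e (ℕ.+-identityʳ w))))))

  column-unique : ∀ {m m′ s} → Column m s → Column m′ s → m ≡ m′
  column-unique {m} {m′} c c′ with column-run {m} c | column-run {m′} c′
  ... | _ , _ , _ , _ , refl , rn | _ , _ , _ , _ , refl , rn′ = proj₂ (proj₂ (exc-injective (run-deterministic rn rn′)))

  column-not-over : ∀ {s} → (∃[ m ] m < suc n × Column m s) → Over s → ⊥
  column-not-over (m , _ , c) o with column-run {m} c | over-run o
  ... | _ , _ , _ , _ , refl , rn | _ , _ , _ , _ , _ , refl , rn′ with run-deterministic rn rn′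
  ... | ()

  card-columns : ∀ {x : ℕ → ℕ} → (∀ m → HasCard (AfterWest T w m) (x m)) →
                 HasCard (λ s → ∃[ m ] m < suc n × Column m s) (∑< (suc n) x)
  card-columns h = card-∑ (suc n)
    (λ m _ → card-west-image (columnWalk m) (λ s → strip-vertical (rest s)) (inverse-column m) (h m))
    (λ {m} {m′} → column-unique {m} {m′})

initial-only : ∀ {r t e n} → Run r (exc 0 t e n west) → r ≡ [] × e ≡ 0 × n ≡ 0
initial-only []       = refl , refl , refl
initial-only (() ∷ _)

card-initial : ∀ {T} → T 0 → ∀ n → HasCard (AfterWest T 0 n) (X₀ 0 n)
card-initial p zero    = card-resp (card-singleton []) (λ { refl → 0 , 0 , p , [] }) (λ { (_ , _ , _ , rn) → proj₁ (initial-only rn) })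
card-initial p (suc n) = card-∅ λ { (_ , _ , _ , rn) → ℕ.1+n≢0 (proj₂ (proj₂ (initial-only rn))) }

card-X₀ : ∀ w n → HasCard (AfterWest Zero w n) (X₀ w n)
card-X₀ zero    n = card-initial refl n
card-X₀ (suc w) n = card-resp (card-columns Zero w n (card-X₀ w)) (λ c → to-west Zero w n (inj₁ c))
  λ p → only-columns (from-west Zero w n p)
  where
  only-columns : ∀ {s} → (∃[ m ] m < suc n × Column Zero w n m s) ⊎ Over Zero w n s → ∃[ m ] m < suc n × Column Zero w n m s
  only-columns (inj₁ c) = c
  only-columns (inj₂ o) with over-run Zero w n o
  -- A crest has positive height, so no walk of height zero leaves one.
  ... | _ , _ , refl , _ , _ , _ , rn = ⊥-elim (ℕ.1+n≰n (Top.positive (proj₂ (run-sound rn))))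

module _ (w : ℕ) where

  rowWalk : ℕ → ℕ → ℕ → ℕ → List Dir → List Dir
  rowWalk j i k t r = north ∷ horizontal i j r

  riseWalk : ℕ → ℕ → List Dir → List Dir
  riseWalk t d r = north ∷ vertical d 0 r

  Row : ℕ → ℕ → List Dir → Set
  Row j m = RiseImage {Any} {w} {m} (rowWalk j) (λ s → strip-horizontal (rest s)) (λ i k t → strip-horizontal-horizontal i j)

  Rise : ℕ → List Dir → Set
  Rise m = WestImage {Any} {w} {m} riseWalk (λ s → strip-vertical (rest s)) (λ t d → strip-vertical-vertical d 0)

  row-run : ∀ {j m s} → j < suc w → Row j m s → ∃[ t ] ∃[ l ] ∃[ s′ ] s ≡ north ∷ s′ × Run s′ (crest j (w ∸ j) t m l)
  row-run {j} (s≤s j≤w) (i , k , t , r , e , _ , rn , refl) =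
    let l , rn′ , _ = run-horizontal j (w ∸ j) (trans e (sym (ℕ.m+[n∸m]≡n j≤w))) rn in t , l , _ , refl , rn′

  rise-run : ∀ {m s} → Rise m s → ∃[ t ] ∃[ l ] l ≢ south × (∃[ s′ ] s ≡ north ∷ s′ × Run s′ (exc w t 0 m l))
  rise-run (t , d , r , _ , rn , refl) = let l , rn′ , h = run-vertical 0 rn in t , l , h refl , _ , refl , rn′

  -- The bound on `j` is repeated inside the summand because the disjointness required by `card-∑`
  -- sees only the summands.
  Rows Rises : ℕ → List Dir → Set
  Rows n s  = ∃[ j ] j < suc w × (j < suc w × (∃[ m ] m ℕ.+ suc j ≡ n × Row j m s))
  Rises n s = ∃[ m ] m ℕ.+ suc w ≡ n × Rise m s

  to-rise : ∀ {n s} → Rows n s ⊎ Rises n s → AfterRise Any w n s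
  to-rise (inj₁ (j , l , _ , m , refl , p)) with row-run l p
  ... | t , _ , s′ , refl , rn = j , w ∸ j , suc t , ℕ.m+[n∸m]≡n (ℕ.s≤s⁻¹ l) , tt ,
    subst (λ z → Run (north ∷ s′) (crest j (w ∸ j) (suc t) z north)) (ℕ.+-comm (suc j) m) (lift ∷ rn)
  to-rise (inj₂ (m , refl , p)) with rise-run p
  ... | t , _ , h , s′ , refl , rn = w , 0 , suc t , ℕ.+-identityʳ w , tt ,
    subst (λ z → Run (north ∷ s′) (crest w 0 (suc t) z north)) (ℕ.+-comm (suc w) m) (rise h ∷ rn)

  from-rise : ∀ {n s} → AfterRise Any w n s → Rows n s ⊎ Rises n s
  from-rise (j , k′ , _ , refl , _ , lift {n = m} ∷ rn) with horizontal-run rn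
  ... | r , i , k , e , rn′ , v = inj₁ (j , s≤s (ℕ.m≤m+n j k′) , s≤s (ℕ.m≤m+n j k′) , m , ℕ.+-comm m (suc j) ,
    i , k , _ , r , e , tt , rn′ , cong (north ∷_) (horizontal≡ v))
  from-rise (_ , _ , _ , e , _ , rise {w = w′} {n = m} h ∷ rn) with trans (sym (ℕ.+-identityʳ w′)) e | vertical-run rn
  ... | refl | r , d , rn′ , v = inj₂ (m , ℕ.+-comm m (suc w) , _ , d , r , tt , rn′ , cong (north ∷_) (vertical≡ v))

  row-not-rise : ∀ {n s} → Rows n s → Rises n s → ⊥
  row-not-rise (j , l , _ , m , _ , p) (m′ , _ , p′) with row-run l p | rise-run p′
  ... | _ , _ , _ , refl , rn | _ , _ , _ , _ , refl , rn′ with run-deterministic rn rn′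
  ... | ()

  -- By strong induction on the area: a new row adds at least one cell, so the walk before it has
  -- smaller area.
  card-F : (∀ n → HasCard (AfterWest Any w n) (X₁ w n)) → ∀ n → HasCard (AfterRise Any w n) (F w n)
  card-F h = <-rec (λ n → HasCard (AfterRise Any w n) (F w n)) λ n ih →
    subst (HasCard _) (sym (F-recurrence w n)) (card-resp
      (card-⊎
        (card-∑ (suc w)
          (λ j l → card-resp
            (card-lag (suc j) n λ { m refl → card-rise-image (rowWalk j) (λ s → strip-horizontal (rest s))
              (λ i k t → strip-horizontal-horizontal i j) (ih (ℕ.m<m+n m (s≤s z≤n))) })
            (λ q → l , q) proj₂)
          (λ { (l , m , _ , p) (l′ , m′ , _ , p′) → row-unique l l′ p p′ }))
        (card-lag (suc w) n λ m _ → card-west-image riseWalk (λ s → strip-vertical (rest s)) (λ t d → strip-vertical-vertical d 0) (h m))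
        row-not-rise)
      to-rise from-rise)
    where
    row-unique : ∀ {j j′ m m′ s} → j < suc w → j′ < suc w → Row j m s → Row j′ m′ s → j ≡ j′
    row-unique l l′ p p′ with row-run l p | row-run l′ p′
    ... | _ , _ , _ , refl , rn | _ , _ , _ , refl , rn′ = proj₁ (crest-injective (run-deterministic rn rn′))

card-X₁ : ∀ w n → HasCard (AfterWest Any w n) (X₁ w n)
card-X₁ zero    n = card-initial tt n
card-X₁ (suc w) n = card-resp
  (card-⊎ (card-columns Any w n (card-X₁ w))
    (card-rise-image (overWalk Any w n) (λ s → strip-horizontal (rest s)) (inverse-over Any w n) (card-F w (card-X₁ w) n))
    (column-not-over Any w n))
  (to-west Any w n) (from-west Any w n)

-- `rise` pays one cell more than the width, and later steps on crests keep the width. This makes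
-- the cutoff in `arounds` exhaustive.
crest-width : ∀ {r i k t n d} → Run r (crest i k t n d) → i ℕ.+ k < n
crest-width (rise {w} {n = n} h ∷ rn) = lin 0 2 (λ m n → ⊢ suc (m ⊕ con 0) :≤ⁿ suc (m ⊕ n)) refl
crest-width (lift {i} {k} {n = n} ∷ rn) = bound (crest-width rn)
  where
  bound : i ℕ.+ k < n → i ℕ.+ k < suc i ℕ.+ n
  bound h = lin 0 3 (λ m n k → suc (m ⊕ n) :≤ⁿ k ⇒ ⊢ suc (m ⊕ n) :≤ⁿ suc (m ⊕ k)) refl h
crest-width (back {i} {k} {n = n} h ∷ rn) = subst (_< n) (sym (ℕ.+-suc i k)) (crest-width rn)
crest-width (forth {i} {k} {n = n} h ∷ rn) = subst (_< n) (ℕ.+-suc i k) (crest-width rn)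

fin-run : ∀ {s y n} → Run s (fin y n) → ∃[ c ] ∃[ k ] ∃[ t ] ∃[ l ] ∃[ s′ ]
          c ℕ.+ y ≡ t × s ≡ replicate c south ++ east ∷ s′ × Run s′ (crest 0 k t n l)
fin-run (exit h ∷ rn) = 0 , _ , _ , _ , _ , refl , refl , rn
fin-run (fall ∷ rn) with fin-run rn
... | c , k , t , l , s′ , e , refl , rn′ = suc c , k , t , l , s′ , lin 0 3 (λ m n k → m ⊕ suc n :≡ⁿ k ⇒ ⊢ suc (m ⊕ n) :≡ⁿ k) refl e , refl , rn′

run-fin : ∀ {s n} c y → Run s (fin (c ℕ.+ y) n) → Run (replicate c south ++ s) (fin y n)
run-fin zero    y rn = rn
run-fin {s} {n} (suc c) y rn = fall ∷ run-fin c (suc y) (subst (λ z → Run s (fin z n)) (sym (ℕ.+-suc c y)) rn)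

module _ (n : ℕ) where

  aroundWalk : ℕ → ℕ → ℕ → List Dir → List Dir
  aroundWalk i k t r = replicate t south ++ east ∷ horizontal i 0 r

  inverse-around : ∀ i k t {r} → heading r ≡ north → strip-horizontal (rest (strip-south (aroundWalk i k t r))) ≡ r
  inverse-around i k t {r} h rewrite strip-south-east t (horizontal i 0 r) = strip-horizontal-horizontal i 0 h

  Around : ℕ → List Dir → Set
  Around w = RiseImage {Any} {w} {n} aroundWalk (λ s → strip-horizontal (rest (strip-south s))) inverse-around

  around-run : ∀ {w s} → Around w s → ∃[ t ] ∃[ l ] ∃[ s′ ] l ≢ west × s ≡ replicate t south ++ east ∷ s′ × Run s′ (crest 0 w t n l)
  around-run {w} (i , k , t , r , e , _ , rn , refl) =
    let l , rn′ , h , _ = run-horizontal 0 w e rn in t , l , _ , h refl , refl , rn′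

  around-unique : ∀ {w w′ s} → Around w s → Around w′ s → w ≡ w′
  around-unique p p′ with around-run p | around-run p′
  ... | t , _ , s₁ , _ , e , rn | t′ , _ , s₂ , _ , e′ , rn′
    with trans (sym (cong rest (strip-south-east t s₁))) (trans (cong (λ s → rest (strip-south s)) (trans (sym e) e′)) (cong rest (strip-south-east t′ s₂)))
  ...   | refl = proj₁ (proj₂ (crest-injective (run-deterministic rn rn′)))

  card-around : HasCard (λ s → Run s (fin 0 n)) (arounds n)
  card-around = card-resp
    (card-∑ (suc n) (λ w _ → card-rise-image aroundWalk (λ s → strip-horizontal (rest (strip-south s))) inverse-around (card-F w (card-X₁ w) n))
      around-unique)
    to-fin from-fin
    where
    to-fin : ∀ {s} → (∃[ w ] w < suc n × Around w s) → Run s (fin 0 n)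
    to-fin (w , _ , p) with around-run p
    ... | t , l , s′ , h , refl , rn = run-fin t 0 (subst (λ z → Run (east ∷ s′) (fin z n)) (sym (ℕ.+-identityʳ t)) (exit h ∷ rn))
    from-fin : ∀ {s} → Run s (fin 0 n) → ∃[ w ] w < suc n × Around w s
    from-fin rn with fin-run rn
    ... | c , w , _ , l , s′ , refl , refl , rn′ with horizontal-run rn′
    ...   | r , i , k , e , rn″ , v = w , ℕ.m≤n⇒m≤1+n (crest-width rn′) , i , k , _ , r , e , tt , rn″ ,
      cong₂ (λ t s → replicate t south ++ east ∷ s) (sym (ℕ.+-identityʳ c)) (horizontal≡ v)

  hangingWalk : ℕ → ℕ → ℕ → List Dir → List Dir
  hangingWalk w t d r = replicate (suc w) east ++ north ∷ vertical d 0 r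

  inverse-hanging : ∀ w t d {r} → heading r ≡ west → strip-vertical (rest (strip-east (hangingWalk w t d r))) ≡ r
  inverse-hanging w t d {r} h rewrite strip-east-north w (vertical d 0 r) = strip-vertical-vertical d 0 h

  Hanging : ℕ → ℕ → List Dir → Set
  Hanging w m = WestImage {Zero} {suc w} {m} (hangingWalk w) (λ s → strip-vertical (rest (strip-east s))) (inverse-hanging w)

  hanging-run : ∀ {w m s} → Hanging w m s → ∃[ l ] ∃[ s′ ] l ≢ south × s ≡ replicate (suc w) east ++ north ∷ s′ × Run s′ (exc (suc w) 0 0 m l)
  hanging-run (t , d , r , refl , rn , refl) = let l , rn′ , h = run-vertical 0 rn in l , _ , h refl , refl , rn′

  Hangings : List Dir → Set
  Hangings s = ∃[ w ] w < n × (∃[ m ] m ℕ.+ suc w ≡ n × Hanging w m s)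

  hanging-unique : ∀ {w w′ s} → (∃[ m ] m ℕ.+ suc w ≡ n × Hanging w m s) → (∃[ m ] m ℕ.+ suc w′ ≡ n × Hanging w′ m s) → w ≡ w′
  hanging-unique {w} {w′} (_ , _ , p) (_ , _ , p′) with hanging-run p | hanging-run p′
  ... | _ , s₁ , _ , e , rn | _ , s₂ , _ , e′ , rn′
    with trans (sym (cong rest (strip-east-north w s₁))) (trans (cong (λ s → rest (strip-east s)) (trans (sym e) e′)) (cong rest (strip-east-north w′ s₂)))
  ...   | refl = ℕ.suc-injective (proj₁ (exc-injective (run-deterministic rn rn′)))

  to-hanging : ∀ {s} → Hangings s → ∃[ k ] Run s (crest 0 k 1 (suc n) east)
  to-hanging (w , _ , m , refl , p) with hanging-run p
  -- `run-east` stops at column 1, so that the last step is visibly east even for w = 0.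
  ... | l , s′ , h , refl , rn = _ , last-east (run-east w 1 (subst₃ (rise h ∷ rn)))
    where
    subst₃ : Run (north ∷ s′) (crest (suc w) 0 1 (suc (suc w) ℕ.+ m) north) → Run (north ∷ s′) (crest (w ℕ.+ 1) 0 1 (suc (m ℕ.+ suc w)) north)
    subst₃ = subst (λ z → Run (north ∷ s′) z) (cong₂ (λ i n → crest i 0 1 n north) (ℕ.+-comm 1 w) (cong suc (ℕ.+-comm (suc w) m)))
    last-east : (∃[ l ] Run (replicate w east ++ north ∷ s′) (crest 1 (w ℕ.+ 0) 1 (suc (m ℕ.+ suc w)) l) × l ≢ west × (w ≡ 0 → l ≡ north)) →
                Run (east ∷ replicate w east ++ north ∷ s′) (crest 0 (suc (w ℕ.+ 0)) 1 (suc (m ℕ.+ suc w)) east)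
    last-east (_ , rn′ , h′ , _) = back h′ ∷ rn′

  from-hanging : ∀ {s k} → Run s (crest 0 k 1 (suc n) east) → Hangings s
  from-hanging rn with horizontal-run rn
  ... | r , _ , k , e , rn′ , easts c refl = last rn′
    where
    last : ∀ {r} → Run r (crest (suc c ℕ.+ 0) k 1 (suc n) north) → Hangings (replicate (suc c) east ++ r)
    last {r} rn″ = go (ℕ.+-identityʳ c) rn″
      where
      go : ∀ {c′ r} → c′ ≡ c → Run r (crest (suc c′) k 1 (suc n) north) → Hangings (replicate (suc c) east ++ r)
      go e (lift ∷ rn‴) = ⊥-elim (ℕ.1+n≰n (Top.positive (proj₂ (run-sound rn‴))))
      go refl (rise {n = m} h ∷ rn‴) with vertical-run rn‴
      ... | r′ , d , rn⁗ , v = c , s≤s (ℕ.m≤m+n c m) , m , ℕ.+-comm m (suc c) , 0 , d , r′ , refl , rn⁗ ,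
        cong (λ s → replicate (suc c) east ++ north ∷ s) (vertical≡ v)

  card-hanging : HasCard (λ s → ∃[ k ] Run s (crest 0 k 1 (suc n) east)) (hangings n)
  card-hanging = card-resp
    (card-∑ n (λ w _ → card-lag (suc w) n λ m _ →
      card-west-image (hangingWalk w) (λ s → strip-vertical (rest (strip-east s))) (inverse-hanging w) (card-X₀ (suc w) m))
      hanging-unique)
    to-hanging (λ (_ , rn) → from-hanging rn)

columnWalk₁ : ℕ → List Dir
columnWalk₁ n = replicate n north ++ west ∷ replicate n south ++ []

start-run : ∀ {s t e n l} → Run s (exc 0 t e n l) → s ≡ replicate e south ++ [] × n ≡ 0
start-run {e = e} rn with vertical-run rn
... | r , d , rn′ , v with initial-only rn′
...   | refl , refl , n≡ = trans (vertical≡ v) (cong (λ k → replicate e south ++ replicate k north ++ []) (ℕ.0∸n≡0 e)) , n≡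

card-column-walks : ∀ n → HasCard (λ s → Run s (exc 1 0 0 n north)) (columns n)
card-column-walks n = go n
  where
  from-column : ∀ {s n} → Run s (exc 1 0 0 n north) → s ≡ columnWalk₁ n × n ≢ 0
  from-column rn with vertical-run rn
  ... | _ , _ , over h ∷ rn′ , _ = ⊥-elim (ℕ.1+n≰n (Top.positive (proj₂ (run-sound rn′))))
  ... | _ , d , col ∷ rn′ , norths c e with start-run rn′
  ...   | refl , refl rewrite trans e (ℕ.+-identityʳ (suc c)) | ℕ.+-identityʳ c = refl , λ ()
  to-column : ∀ c → Run (columnWalk₁ (suc c)) (exc 1 0 0 (suc c) north)
  -- The last climb is split off, so that the final direction is north also for c = 0.
  to-column c = let l , rn , h = run-south (suc c) [] ; l′ , rn′ , h′ = run-north c 1 (start rn) in climb h′ ∷ rn′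
    where
    start : ∀ {l} → Run (replicate (suc c) south ++ []) (exc 0 0 (suc c ℕ.+ 0) 0 l) →
            Run (west ∷ replicate (suc c) south ++ []) (exc 1 0 (c ℕ.+ 1) (suc c) west)
    start rn = subst₂ (λ e n → Run (west ∷ replicate (suc c) south ++ []) (exc 1 0 e n west))
      (trans (ℕ.+-identityʳ (suc c)) (ℕ.+-comm 1 c)) (trans (ℕ.+-identityʳ (suc c ℕ.+ 0)) (ℕ.+-identityʳ (suc c))) (col ∷ rn)
  go : ∀ n → HasCard (λ s → Run s (exc 1 0 0 n north)) (columns n)
  go zero    = card-∅ λ rn → proj₂ (from-column rn) refl
  go (suc c) = card-resp (card-singleton (columnWalk₁ (suc c))) (λ { refl → to-column c }) (λ rn → proj₁ (from-column rn))

card-accepted : ∀ n → HasCard (Accepted n) (polygons n)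
card-accepted n = card-resp
  (card-⊎ (card-around n) (card-⊎ (card-hanging n) (card-column-walks n) λ { (_ , rn) rn′ → crest≢exc (run-deterministic rn rn′) })
    λ { rn (inj₁ (_ , rn′)) → fin≢crest (run-deterministic rn rn′) ; rn (inj₂ rn′) → fin≢exc (run-deterministic rn rn′) })
  (λ { (inj₁ rn) → _ , rn , around ; (inj₂ (inj₁ (_ , rn))) → _ , rn , hanging ; (inj₂ (inj₂ rn)) → _ , rn , column })
  (λ { (_ , rn , around) → inj₁ rn ; (_ , rn , hanging) → inj₂ (inj₁ (_ , rn)) ; (_ , rn , column) → inj₂ (inj₂ rn) })
  where
  crest≢exc : ∀ {i k t n d w t′ e n′ d′} → crest i k t n d ≢ exc w t′ e n′ d′
  crest≢exc ()
  fin≢crest : ∀ {y m i k t n d} → fin y m ≢ crest i k t n d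
  fin≢crest ()
  fin≢exc : ∀ {y m w t e n d} → fin y m ≢ exc w t e n d
  fin≢exc ()

-- End and last direction tell them apart: (1 , 0) going south, (0 , 1) going east, (-1 , 0) going
-- north, against (-1 , 0) going south, (0 , 1) going west, (1 , 0) going north in the mirror.
not-both : ∀ {n n′ r} → Accepted n r → Accepted n′ (mirror r) → ⊥
not-both {r = r} (_ , rn , a) (_ , rn′ , a′) = clash a a′ rn rn′ (proj₂ (run-sound rn)) (proj₂ (run-sound rn′))
  where
  clash : ∀ {n n′ s s′} → Accept s n → Accept s′ n′ → Run r s → Run (mirror r) s′ → Inv s r → Inv s′ (mirror r) → ⊥
  clash around  around  _ _ v v′ = lin 2 0 (λ x y → x :≡ con 1ℤ ⇒ y :≡ con 1ℤ ⇒ y :≡ ⊝ x ⇒ ⊢ absurd) refl (Fin.x≡ v) (Fin.x≡ v′) (X-mirror r)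
  clash around  hanging _ _ v v′ = lin 2 0 (λ x y → x :≡ con 0ℤ ⇒ y :≡ con 1ℤ ⇒ y :≡ x ⇒ ⊢ absurd) refl (Fin.y≡ v) (Top.y≡ v′) (Y-mirror r)
  clash hanging around  _ _ v v′ = lin 2 0 (λ x y → x :≡ con 1ℤ ⇒ y :≡ con 0ℤ ⇒ y :≡ x ⇒ ⊢ absurd) refl (Top.y≡ v) (Fin.y≡ v′) (Y-mirror r)
  clash hanging hanging rn rn′ v v′ = headings r (Top.heading≡ v) (Top.heading≡ v′) (Top.y≡ v)
    where
    headings : ∀ r → heading r ≡ east → heading (mirror r) ≡ east → Y r ≢ 1ℤ
    headings (east ∷ r) _ () _
  clash hanging column  _ _ v v′ = lin 2 0 (λ x y → x :≡ con 1ℤ ⇒ y :≡ con 0ℤ ⊖ con 0ℤ ⇒ y :≡ x ⇒ ⊢ absurd) refl (Top.y≡ v) (Exc.y≡ v′) (Y-mirror r)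
  clash column  hanging _ _ v v′ = lin 2 0 (λ x y → x :≡ con 0ℤ ⊖ con 0ℤ ⇒ y :≡ con 1ℤ ⇒ y :≡ x ⇒ ⊢ absurd) refl (Exc.y≡ v) (Top.y≡ v′) (Y-mirror r)
  clash column  column  _ _ v v′ = lin 2 0 (λ x y → x :≡ ⊝ con 1ℤ ⇒ y :≡ ⊝ con 1ℤ ⇒ y :≡ ⊝ x ⇒ ⊢ absurd) refl (Exc.x≡ v) (Exc.x≡ v′) (X-mirror r)
  clash around  column  rn rn′ v v′ = headings r rn (Exc.heading≡ v′)
    where
    headings : ∀ {n} r → Run r (fin 0 n) → heading (mirror r) ≢ north
    headings (north ∷ r) (() ∷ _) _
    headings (south ∷ r) _ ()
    headings (east ∷ r) _ ()
  clash column  around  rn rn′ v v′ = headings r rn′ (Exc.heading≡ v)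
    where
    headings : ∀ {n} r → Run (mirror r) (fin 0 n) → heading r ≢ north
    headings (north ∷ r) (() ∷ _) _

card-polygons : ∀ n → HasCard (λ r → Accepted n r ⊎ Accepted n (mirror r)) (polygons n ℕ.+ polygons n)
card-polygons n = card-⊎ (card-accepted n)
  (card-resp (card-map mirror mirror mirror-involutive (card-accepted n))
    (λ { (r , a , refl) → subst (Accepted n) (sym (mirror-involutive r)) a })
    (λ {r} a → mirror r , a , mirror-involutive r))
  not-both

-- Power series

neg : ℤ⟦q⟧ → ℤ⟦q⟧
neg f n = ℤ.- f n

-- The inductions below rest on the definitional equality
-- (f * g) (suc n) = f 0 * g (suc n) + (tail f * g) n.

*-cong-≤ : ∀ {f f′ g g′} n → (∀ m → m ≤ n → f m ≡ f′ m) → (∀ m → m ≤ n → g m ≡ g′ m) → (f * g) n ≡ (f′ * g′) n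
*-cong-≤ zero    h k = cong₂ ℤ._*_ (h 0 z≤n) (k 0 z≤n)
*-cong-≤ (suc n) h k = cong₂ ℤ._+_ (cong₂ ℤ._*_ (h 0 z≤n) (k (suc n) ℕ.≤-refl))
  (*-cong-≤ n (λ m l → h (suc m) (s≤s l)) (λ m l → k m (ℕ.m≤n⇒m≤1+n l)))

*-cong-≈ : ∀ {f f′ g g′} → f ≈ f′ → g ≈ g′ → f * g ≈ f′ * g′
*-cong-≈ h k n = *-cong-≤ n (λ m _ → h m) (λ m _ → k m)

*-sucʳ : ∀ f g n → (f * g) (suc n) ≡ f (suc n) ℤ.* g 0 ℤ.+ (f * tail g) n
*-sucʳ f g zero    = ℤ.+-comm (f 0 ℤ.* g 1) (f 1 ℤ.* g 0)
*-sucʳ f g (suc n) = trans (cong (λ z → f 0 ℤ.* g (suc (suc n)) ℤ.+ z) (*-sucʳ (tail f) g n))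
  (swap (f 0 ℤ.* g (suc (suc n))) (f (suc (suc n)) ℤ.* g 0) ((tail f * tail g) n))
  where
  swap : ∀ a b c → a ℤ.+ (b ℤ.+ c) ≡ b ℤ.+ (a ℤ.+ c)
  swap = solve-∀

*-comm : ∀ f g → f * g ≈ g * f
*-comm f g zero    = ℤ.*-comm (f 0) (g 0)
*-comm f g (suc n) = trans (cong₂ ℤ._+_ (ℤ.*-comm (f 0) (g (suc n))) (*-comm (tail f) g n)) (sym (*-sucʳ g f n))

*-distribʳ : ∀ h f g → (f + g) * h ≈ f * h + g * h
*-distribʳ h f g zero    = ℤ.*-distribʳ-+ (h 0) (f 0) (g 0)
*-distribʳ h f g (suc n) = trans (cong (λ z → (f 0 ℤ.+ g 0) ℤ.* h (suc n) ℤ.+ z) (*-distribʳ h (tail f) (tail g) n))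
  (shuffle (f 0) (g 0) (h (suc n)) ((tail f * h) n) ((tail g * h) n))
  where
  shuffle : ∀ a b c x y → (a ℤ.+ b) ℤ.* c ℤ.+ (x ℤ.+ y) ≡ (a ℤ.* c ℤ.+ x) ℤ.+ (b ℤ.* c ℤ.+ y)
  shuffle = solve-∀

scale : ℤ → ℤ⟦q⟧ → ℤ⟦q⟧
scale c f n = c ℤ.* f n

scale-* : ∀ c f g → scale c f * g ≈ scale c (f * g)
scale-* c f g zero    = ℤ.*-assoc c (f 0) (g 0)
scale-* c f g (suc n) = trans (cong (λ z → c ℤ.* f 0 ℤ.* g (suc n) ℤ.+ z) (scale-* c (tail f) g n))
  (factor c (f 0) (g (suc n)) ((tail f * g) n))
  where
  factor : ∀ c a b x → c ℤ.* a ℤ.* b ℤ.+ c ℤ.* x ≡ c ℤ.* (a ℤ.* b ℤ.+ x)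
  factor = solve-∀

*-assoc : ∀ f g h → (f * g) * h ≈ f * (g * h)
*-assoc f g h zero    = ℤ.*-assoc (f 0) (g 0) (h 0)
*-assoc f g h (suc n) = trans
  (cong (λ z → f 0 ℤ.* g 0 ℤ.* h (suc n) ℤ.+ z)
    (trans (*-distribʳ h (scale (f 0) (tail g)) (tail f * g) n)
      (cong₂ ℤ._+_ (scale-* (f 0) (tail g) h n) (*-assoc (tail f) g h n))))
  (shuffle (f 0) (g 0) (h (suc n)) ((tail g * h) n) ((tail f * (g * h)) n))
  where
  shuffle : ∀ a b c x y → a ℤ.* b ℤ.* c ℤ.+ (a ℤ.* x ℤ.+ y) ≡ a ℤ.* (b ℤ.* c ℤ.+ x) ℤ.+ y
  shuffle = solve-∀

*-zeroˡ : ∀ {f} g → (∀ n → f n ≡ 0ℤ) → ∀ n → (f * g) n ≡ 0ℤ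
*-zeroˡ g h zero    rewrite h 0 = refl
*-zeroˡ {f} g h (suc n) rewrite h 0 = trans (ℤ.+-identityˡ _) (*-zeroˡ g (λ m → h (suc m)) n)

#-* : ∀ c f → # c * f ≈ scale c f
#-* c f zero    = refl
#-* c f (suc n) = trans (cong (λ z → c ℤ.* f (suc n) ℤ.+ z) (*-zeroˡ f (λ _ → refl) n)) (ℤ.+-identityʳ _)

*-identityˡ : ∀ f → # 1ℤ * f ≈ f
*-identityˡ f n = trans (#-* 1ℤ f n) (ℤ.*-identityˡ (f n))

q-*-suc : ∀ f n → (q * f) (suc n) ≡ f n
q-*-suc f n = trans (ℤ.+-identityˡ _) (trans (*-cong-≈ {tail q} {# 1ℤ} {f} {f} (λ { zero → refl ; (suc _) → refl }) (λ _ → refl) n) (*-identityˡ f n))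

q^-*-small : ∀ k f {n} → n ℕ.< k → (q ^ k * f) n ≡ 0ℤ
q^-*-small (suc k) f {zero}  _ = *-assoc q (q ^ k) f 0
q^-*-small (suc k) f {suc n} (s≤s l) = trans (*-assoc q (q ^ k) f (suc n)) (trans (q-*-suc (q ^ k * f) n) (q^-*-small k f l))

-- Power series modulo q ^ (N + 1).
module Modulo (N : ℕ) where

  infix 4 _≋_
  record _≋_ (f g : ℤ⟦q⟧) : Set where
    constructor mod
    field
      coefficient : ∀ m → m ≤ N → f m ≡ g m
  open _≋_ public

  exact : ∀ {f g} → f ≈ g → f ≋ g
  exact h = mod λ m _ → h m

  commutativeRing : CommutativeRing 0ℓ 0ℓ
  commutativeRing = record
    { Carrier = ℤ⟦q⟧ ; _≈_ = _≋_ ; _+_ = _+_ ; _*_ = _*_ ; -_ = neg ; 0# = # 0ℤ ; 1# = # 1ℤ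
    ; isCommutativeRing = record
      { isRing = record
        { +-isAbelianGroup = record
          { isGroup = record
            { isMonoid = record
              { isSemigroup = record
                { isMagma = record
                  { isEquivalence = record
                    { refl = mod λ _ _ → refl
                    ; sym = λ e → mod λ m l → sym (coefficient e m l)
                    ; trans = λ e e′ → mod λ m l → trans (coefficient e m l) (coefficient e′ m l) }
                  ; ∙-cong = λ e e′ → mod λ m l → cong₂ ℤ._+_ (coefficient e m l) (coefficient e′ m l) }
                ; assoc = λ f g h → mod λ m _ → ℤ.+-assoc (f m) (g m) (h m) }
              ; identity = (λ f → mod λ { zero _ → ℤ.+-identityˡ _ ; (suc m) _ → ℤ.+-identityˡ _ }) ,
                           (λ f → mod λ { zero _ → ℤ.+-identityʳ _ ; (suc m) _ → ℤ.+-identityʳ _ }) }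
            ; inverse = (λ f → mod λ { zero _ → ℤ.+-inverseˡ (f 0) ; (suc m) _ → ℤ.+-inverseˡ (f (suc m)) }) ,
                        (λ f → mod λ { zero _ → ℤ.+-inverseʳ (f 0) ; (suc m) _ → ℤ.+-inverseʳ (f (suc m)) })
            ; ⁻¹-cong = λ e → mod λ m l → cong ℤ.-_ (coefficient e m l) }
          ; comm = λ f g → mod λ m _ → ℤ.+-comm (f m) (g m) }
        ; *-cong = λ e e′ → mod λ m l → *-cong-≤ m (λ i k → coefficient e i (ℕ.≤-trans k l)) (λ i k → coefficient e′ i (ℕ.≤-trans k l))
        ; *-assoc = λ f g h → exact (*-assoc f g h)
        ; *-identity = (λ f → exact (*-identityˡ f)) , (λ f → exact λ n → trans (*-comm f (# 1ℤ) n) (*-identityˡ f n))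
        ; distrib = (λ f g h → exact λ n → trans (*-comm f (g + h) n) (trans (*-distribʳ f g h n) (cong₂ ℤ._+_ (*-comm g f n) (*-comm h f n)))) ,
                    (λ f g h → exact (*-distribʳ f g h)) }
      ; *-comm = λ f g → exact (*-comm f g) } }

  open CommutativeRing commutativeRing public
    using (+-cong; +-congˡ; +-congʳ; *-congˡ; *-congʳ)
    renaming (refl to ≋-refl; sym to ≋-sym; trans to ≋-trans; zeroˡ to zero-*)

  ring : AlmostCommutativeRing 0ℓ 0ℓ
  ring = fromCommutativeRing commutativeRing

  constants : ℤ.+-*-rawRing -Raw-AlmostCommutative⟶ ring
  constants = record
    { ⟦_⟧ = #_
    ; +-homo = λ a b → mod λ { zero _ → refl ; (suc _) _ → refl }
    ; *-homo = λ a b → mod λ { zero _ → refl ; (suc n) _ → sym (trans (#-* a (# b) (suc n)) (ℤ.*-zeroʳ a)) }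
    ; -‿homo = λ a → mod λ { zero _ → refl ; (suc _) _ → refl }
    ; 0-homo = ≋-refl
    ; 1-homo = ≋-refl }

  constant≟ : ∀ a b → Maybe (# a ≋ # b)
  constant≟ a b with a ℤ.≟ b
  ... | yes refl = just ≋-refl
  ... | no _     = nothing

  open RingSolver ℤ.+-*-rawRing ring constants constant≟ public
    using (solve; _:=_; _:+_; _:*_; _:-_; con)

-- The functional equation

ser : (ℕ → ℕ) → ℤ⟦q⟧
ser f n = + f n

∑ : ℕ → (ℕ → ℤ⟦q⟧) → ℤ⟦q⟧
∑ zero    t = # 0ℤ
∑ (suc k) t = ∑ k t + t k

ser-lag : ∀ k f → q ^ k * ser f ≈ ser (lag k f)
ser-lag zero    f n       = *-identityˡ (ser f) n
ser-lag (suc k) f zero    = q^-*-small (suc k) (ser f) (s≤s z≤n)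
ser-lag (suc k) f (suc n) = trans (*-assoc q (q ^ k) (ser f) (suc n)) (trans (q-*-suc (q ^ k * ser f) n) (ser-lag k f n))

ser-∑ : ∀ k (g : ℕ → ℕ → ℕ) → ser (λ n → ∑< k (λ j → g j n)) ≈ ∑ k (λ j → ser (g j))
ser-∑ zero    g zero    = refl
ser-∑ zero    g (suc n) = refl
ser-∑ (suc k) g n       = cong (λ z → z ℤ.+ + g k n) (ser-∑ k g n)

lag-small : ∀ k f n → (∀ m → m ≤ n → f m ≡ 0) → lag k f n ≡ 0
lag-small zero    f n       h = h n ℕ.≤-refl
lag-small (suc k) f zero    h = refl
lag-small (suc k) f (suc n) h = lag-small k f n λ m l → h m (ℕ.m≤n⇒m≤1+n l)

lag-early : ∀ k f n → n < k → lag k f n ≡ 0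
lag-early (suc k) f zero    _       = refl
lag-early (suc k) f (suc n) (s≤s l) = lag-early k f n l

∑<-extend : ∀ {n k} {f} → n ≤ k → (∀ j → n ≤ j → f j ≡ 0) → ∑< k f ≡ ∑< n f
∑<-extend {n} {k} {f} l h = subst (λ k → ∑< k f ≡ ∑< n f) (ℕ.m∸n+n≡m l) (go (k ∸ n))
  where
  go : ∀ j → ∑< (j ℕ.+ n) f ≡ ∑< n f
  go zero    = refl
  go (suc j) = trans (cong₂ ℕ._+_ (go j) (h (j ℕ.+ n) (ℕ.m≤n+m n j))) (ℕ.+-identityʳ _)

-- In the recurrence the term from `X₁` is shifted beyond w, and the shifted copies of `F w` vanish
-- by induction.
F-small : ∀ w n → n ≤ w → F w n ≡ 0
F-small w = <-rec (λ n → n ≤ w → F w n ≡ 0) λ n ih l → trans (F-recurrence w n)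
  (cong₂ ℕ._+_ (∑<-zero (suc w) λ j → shifted j n ih l) (lag-early (suc w) (X₁ w) n (s≤s l)))
  where
  shifted : ∀ j n → (∀ {m} → m < n → m ≤ w → F w m ≡ 0) → n ≤ w → lag (suc j) (F w) n ≡ 0
  shifted j zero    ih l = refl
  shifted j (suc n) ih l = lag-small j (F w) n λ m l′ → ih (s≤s l′) (ℕ.≤-trans l′ (ℕ.≤-trans (ℕ.n≤1+n n) l))

F̂ X̂ X̂₀ : ℕ → ℤ⟦q⟧
F̂ w  = ser (F w)
X̂ w  = ser (X₁ w)
X̂₀ w = ser (X₀ w)

-- Φ k x and Ψ k x are truncations of ∑ F̂ w x^w and ∑ X̂ w x^w.
Φ Ψ : ℕ → ℤ⟦q⟧ → ℤ⟦q⟧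
Φ k x = ∑ k (λ w → x ^ w * F̂ w)
Ψ k x = ∑ k (λ w → x ^ w * X̂ w)

d : ℤ⟦q⟧
d = # 1ℤ - # (+ 2) * q

D ν ratio : ℕ → ℤ⟦q⟧
D k = # 1ℤ - q - q ^ (k ℕ.+ 1)
ν k = # 1ℤ - q - q ^ k + q ^ (k ℕ.+ 1) - q ^ (k ℕ.+ 2)
ratio k = ν k / D k

-- `term m` is `summand m` without its product. `σ m` times the first m ratios is the coefficient
-- with which φ(q^(m+1)) remains when the equation for φ(q) has been iterated m times.
E term σ : ℕ → ℤ⟦q⟧
E m = (# -1ℤ) ^ m * q ^ (2 ℕ.* m)
term m = E m / (d ^ m * D m)
σ m = E m / d ^ m

D-unit : ∀ k → D k 0 ≡ 1ℤ
D-unit k = subst (λ j → 1ℤ ℤ.- (q ^ j) 0 ≡ 1ℤ) (ℕ.+-comm 1 k) (cong (λ z → 1ℤ ℤ.- z) (ℤ.*-zeroˡ ((q ^ k) 0)))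

d^-unit : ∀ m → (d ^ m) 0 ≡ 1ℤ
d^-unit zero    = refl
d^-unit (suc m) = trans (ℤ.*-identityˡ _) (d^-unit m)

module _ (N : ℕ) where
  open Modulo N
  private module G = GroupProperties (CommutativeRing.+-group commutativeRing)

  -- An equation with its coefficient in a linear combination.
  record Equation : Set where
    constructor _·_
    field
      c : ℤ⟦q⟧
      {u v} : ℤ⟦q⟧
      equation : u ≋ v

  infix 6 _·_

  lhs rhs : List Equation → ℤ⟦q⟧
  lhs []       = # 0ℤ
  lhs (e ∷ es) = Equation.c e * Equation.u e + lhs es
  rhs []       = # 0ℤ
  rhs (e ∷ es) = Equation.c e * Equation.v e + rhs es

  lhs≋rhs : ∀ es → lhs es ≋ rhs es
  lhs≋rhs []       = ≋-refl
  lhs≋rhs (e ∷ es) = +-cong (*-congˡ {Equation.c e} (Equation.equation e)) (lhs≋rhs es)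

  -- An equation that is a linear combination of known ones reduces to a polynomial identity, which
  -- the ring solver decides; the coefficients in `es` are the content of each application.
  by : ∀ {a b} es → a + rhs es ≋ b + lhs es → a ≋ b
  by {a} {b} es h = G.∙-cancelʳ (rhs es) a b (≋-trans h (+-congˡ {b} (lhs≋rhs es)))

  divide : ∀ f g → g 0 ≡ 1ℤ → (f / g) * g ≋ f
  divide f g u = exact (/-*-cancel f g u)

  cancel : ∀ {f h} g → g 0 ≡ 1ℤ → f * g ≋ h * g → f ≋ h
  cancel {f} {h} g u e = by ((h - f) · divide (# 1ℤ) g u ∷ (# 1ℤ / g) · e ∷ [])
    (solve 4 (λ f g h i → f :+ ((h :- f) :* con 1ℤ :+ (i :* (h :* g) :+ con 0ℤ)) :=
                          h :+ ((h :- f) :* (i :* g) :+ (i :* (f :* g) :+ con 0ℤ))) ≋-refl f g h (# 1ℤ / g))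

  small : ∀ k f → N < k → q ^ k * f ≋ # 0ℤ
  small k f l = mod λ { zero m → q^-*-small k f (ℕ.≤-<-trans m l) ; (suc _) m → q^-*-small k f (ℕ.≤-<-trans m l) }

  geometric : ∀ k f → (# 1ℤ - q) * ∑ k (λ j → q ^ suc j * f) ≋ (q - q ^ suc k) * f
  geometric zero    f = solve 2 (λ q f → (con 1ℤ :- q) :* con 0ℤ := (q :- q :* con 1ℤ) :* f) ≋-refl q f
  geometric (suc k) f = by (# 1ℤ · geometric k f ∷ [])
    (solve 4 (λ q f p s → (con 1ℤ :- q) :* (s :+ p :* f) :+ (con 1ℤ :* ((q :- p) :* f) :+ con 0ℤ) :=
                          (q :- q :* p) :* f :+ (con 1ℤ :* ((con 1ℤ :- q) :* s) :+ con 0ℤ))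
      ≋-refl q f (q ^ suc k) (∑ k (λ j → q ^ suc j * f)))

  ∑-cong : ∀ k {t t′} → (∀ j → t j ≋ t′ j) → ∑ k t ≋ ∑ k t′
  ∑-cong zero    h = ≋-refl
  ∑-cong (suc k) h = +-cong (∑-cong k h) (h k)

  F-equation : ∀ w → (# 1ℤ - q) * F̂ w ≋ (q - q * q ^ suc w) * F̂ w + (# 1ℤ - q) * (q ^ suc w * X̂ w)
  F-equation w = by ((# 1ℤ - q) · recurrence ∷ # 1ℤ · geometric (suc w) (F̂ w) ∷ [])
    (solve 5 (λ q f p s x → (con 1ℤ :- q) :* f :+ ((con 1ℤ :- q) :* (s :+ p :* x) :+ (con 1ℤ :* ((q :- q :* p) :* f) :+ con 0ℤ)) :=
        (q :- q :* p) :* f :+ (con 1ℤ :- q) :* (p :* x) :+ ((con 1ℤ :- q) :* f :+ (con 1ℤ :* ((con 1ℤ :- q) :* s) :+ con 0ℤ)))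
      ≋-refl q (F̂ w) (q ^ suc w) (∑ (suc w) (λ j → q ^ suc j * F̂ w)) (X̂ w))
    where
    recurrence : F̂ w ≋ ∑ (suc w) (λ j → q ^ suc j * F̂ w) + q ^ suc w * X̂ w
    recurrence = ≋-trans lagged (+-congʳ (∑-cong (suc w) λ j → exact λ n → sym (ser-lag (suc j) (F w) n)))
      where
      lagged : F̂ w ≋ ∑ (suc w) (λ j → ser (lag (suc j) (F w))) + q ^ suc w * X̂ w
      lagged = exact λ n → trans (cong +_ (F-recurrence w n))
        (cong₂ ℤ._+_ (ser-∑ (suc w) (λ j → lag (suc j) (F w)) n) (sym (ser-lag (suc w) (X₁ w) n)))

  prefix-sums : ∀ f → (# 1ℤ - q) * ser (λ n → ∑< (suc n) f) ≋ ser f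
  prefix-sums f = by (# 1ℤ · recurrence ∷ [])
    (solve 3 (λ q s f → (con 1ℤ :- q) :* s :+ (con 1ℤ :* (f :+ q :* s) :+ con 0ℤ) := f :+ (con 1ℤ :* s :+ con 0ℤ))
      ≋-refl q (ser λ n → ∑< (suc n) f) (ser f))
    where
    recurrence : ser (λ n → ∑< (suc n) f) ≋ ser f + q * ser (λ n → ∑< (suc n) f)
    recurrence = mod λ { zero _ → sym (ℤ.+-identityʳ _)
      ; (suc n) _ → trans (ℤ.+-comm (+ ∑< (suc n) f) (+ f (suc n))) (cong (λ z → + f (suc n) ℤ.+ z) (sym (q-*-suc (ser λ n → ∑< (suc n) f) n))) }

  X-equation : ∀ w → (# 1ℤ - q) * X̂ (suc w) ≋ X̂ w + (# 1ℤ - q) * F̂ w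
  X-equation w = ≋-trans
    (solve 3 (λ q s f → (con 1ℤ :- q) :* (s :+ f) := (con 1ℤ :- q) :* s :+ (con 1ℤ :- q) :* f) ≋-refl q (ser λ n → ∑< (suc n) (X₁ w)) (F̂ w))
    (+-congʳ (prefix-sums (X₁ w)))

  X-initial : ser (X₀ 0) ≋ # 1ℤ
  X-initial = mod λ { zero _ → refl ; (suc _) _ → refl }

  q*-^ : ∀ x w → (q * x) ^ w ≋ q ^ w * x ^ w
  q*-^ x zero    = solve 0 (con 1ℤ := con 1ℤ :* con 1ℤ) ≋-refl
  q*-^ x (suc w) = by ((q * x) · q*-^ x w ∷ [])
    (solve 5 (λ q x a b c → (q :* x) :* a :+ ((q :* x) :* (b :* c) :+ con 0ℤ) := (q :* b) :* (x :* c) :+ ((q :* x) :* a :+ con 0ℤ))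
      ≋-refl q x ((q * x) ^ w) (q ^ w) (x ^ w))

  -- The factor q^w in `F-equation` replaces x by qx under the sum. Each w contributes its own
  -- equation, so cutting off the sums leaves no remainder.
  Φ-equation : ∀ k x → d * Φ k x + q * (q * Φ k (q * x)) ≋ (# 1ℤ - q) * (q * Ψ k (q * x))
  Φ-equation zero    x = solve 1 (λ q → (con 1ℤ :- con (+ 2) :* q) :* con 0ℤ :+ q :* (q :* con 0ℤ) := (con 1ℤ :- q) :* (q :* con 0ℤ)) ≋-refl q
  Φ-equation (suc k) x = by (# 1ℤ · Φ-equation k x ∷ x ^ k · F-equation k ∷ (q * q * F̂ k - (# 1ℤ - q) * q * X̂ k) · q*-^ x k ∷ [])
    (solve 9 (λ q p p′ z a b Q f g →
        (con 1ℤ :- con (+ 2) :* q) :* (p :+ a :* f) :+ q :* (q :* (p′ :+ b :* f))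
        :+ (con 1ℤ :* ((con 1ℤ :- q) :* (q :* z)) :+ (a :* ((q :- q :* (q :* Q)) :* f :+ (con 1ℤ :- q) :* ((q :* Q) :* g))
             :+ ((q :* q :* f :- (con 1ℤ :- q) :* q :* g) :* (Q :* a) :+ con 0ℤ)))
      := (con 1ℤ :- q) :* (q :* (z :+ b :* g))
        :+ (con 1ℤ :* ((con 1ℤ :- con (+ 2) :* q) :* p :+ q :* (q :* p′)) :+ (a :* ((con 1ℤ :- q) :* f)
             :+ ((q :* q :* f :- (con 1ℤ :- q) :* q :* g) :* b :+ con 0ℤ))))
      ≋-refl q (Φ k x) (Φ k (q * x)) (Ψ k (q * x)) (x ^ k) ((q * x) ^ k) (q ^ k) (F̂ k) (X̂ k))

  -- Here the index is shifted by one, whence the boundary term; at y = qx it contains q^k and is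
  -- removed by `vanishing`.
  Ψ-equation : ∀ k y → (# 1ℤ - q - y) * Ψ k y ≋ (# 1ℤ - q) + (# 1ℤ - q) * (y * Φ k y) - (# 1ℤ - q) * (y ^ k * X̂ k)
  Ψ-equation zero    y = by (((# 1ℤ - q)) · X-initial ∷ [])
    (solve 3 (λ q y x → (con 1ℤ :- q :- y) :* con 0ℤ :+ ((con 1ℤ :- q) :* con 1ℤ :+ con 0ℤ) :=
        (con 1ℤ :- q) :+ (con 1ℤ :- q) :* (y :* con 0ℤ) :- (con 1ℤ :- q) :* (con 1ℤ :* x) :+ ((con 1ℤ :- q) :* x :+ con 0ℤ))
      ≋-refl q y (X̂ 0))
  Ψ-equation (suc k) y = by (# 1ℤ · Ψ-equation k y ∷ (y * y ^ k) · X-equation k ∷ [])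
    (solve 8 (λ q y z p b x x′ f →
        (con 1ℤ :- q :- y) :* (z :+ b :* x)
        :+ (con 1ℤ :* ((con 1ℤ :- q) :+ (con 1ℤ :- q) :* (y :* p) :- (con 1ℤ :- q) :* (b :* x)) :+ ((y :* b) :* (x :+ (con 1ℤ :- q) :* f) :+ con 0ℤ))
      := (con 1ℤ :- q) :+ (con 1ℤ :- q) :* (y :* (p :+ b :* f)) :- (con 1ℤ :- q) :* ((y :* b) :* x′)
        :+ (con 1ℤ :* ((con 1ℤ :- q :- y) :* z) :+ ((y :* b) :* ((con 1ℤ :- q) :* x′) :+ con 0ℤ)))
      ≋-refl q y (Ψ k y) (Φ k y) (y ^ k) (X̂ k) (X̂ (suc k)) (F̂ k))

  module _ (K : ℕ) (N<K : N < K) where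

    y : ℕ → ℤ⟦q⟧
    y j = Φ K (q ^ j)

    vanishing : ∀ x → (q * x) ^ K * X̂ K ≋ # 0ℤ
    vanishing x = ≋-trans (*-congʳ {X̂ K} (q*-^ x K))
      (≋-trans (solve 3 (λ a b c → a :* b :* c := a :* (b :* c)) ≋-refl (q ^ K) (x ^ K) (X̂ K)) (small K (x ^ K * X̂ K) N<K))

    -- The multipliers of `Φ-equation` and `Ψ-equation` are chosen so that the terms in
    -- `Ψ K (q * x)` cancel.
    functional-equation : ∀ x → d * ((# 1ℤ - q - q * x) * Φ K x) ≋
      q * ((# 1ℤ - q) * (# 1ℤ - q)) - q * (q * ((# 1ℤ - q - x + q * x - q * (q * x)) * Φ K (q * x)))
    functional-equation x = by
      ((# 1ℤ - q - q * x) · Φ-equation K x ∷ ((# 1ℤ - q) * q) · Ψ-equation K (q * x) ∷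
       (# 0ℤ - (# 1ℤ - q) * (# 1ℤ - q) * q) · vanishing x ∷ [])
      (solve 6 (λ q x p p′ z e →
          (con 1ℤ :- con (+ 2) :* q) :* ((con 1ℤ :- q :- q :* x) :* p)
          :+ ((con 1ℤ :- q :- q :* x) :* ((con 1ℤ :- q) :* (q :* z))
              :+ (((con 1ℤ :- q) :* q) :* ((con 1ℤ :- q) :+ (con 1ℤ :- q) :* ((q :* x) :* p′) :- (con 1ℤ :- q) :* e)
              :+ ((con 0ℤ :- (con 1ℤ :- q) :* (con 1ℤ :- q) :* q) :* con 0ℤ :+ con 0ℤ)))
        := q :* ((con 1ℤ :- q) :* (con 1ℤ :- q)) :- q :* (q :* ((con 1ℤ :- q :- x :+ q :* x :- q :* (q :* x)) :* p′))
          :+ ((con 1ℤ :- q :- q :* x) :* ((con 1ℤ :- con (+ 2) :* q) :* p :+ q :* (q :* p′))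
              :+ (((con 1ℤ :- q) :* q) :* ((con 1ℤ :- q :- q :* x) :* z)
              :+ ((con 0ℤ :- (con 1ℤ :- q) :* (con 1ℤ :- q) :* q) :* e :+ con 0ℤ))))
        ≋-refl q x (Φ K x) (Φ K (q * x)) (Ψ K (q * x)) ((q * x) ^ K * X̂ K))

    q^+1 : ∀ k → q ^ (k ℕ.+ 1) ≋ q * q ^ k
    q^+1 k = subst (λ j → q ^ j ≋ q * q ^ k) (ℕ.+-comm 1 k) ≋-refl

    q^+2 : ∀ k → q ^ (k ℕ.+ 2) ≋ q * (q * q ^ k)
    q^+2 k = subst (λ j → q ^ j ≋ q * (q * q ^ k)) (ℕ.+-comm 2 k) ≋-refl

    y-equation : ∀ j → d * (D j * y j) ≋ q * ((# 1ℤ - q) * (# 1ℤ - q)) - q * (q * (ν j * y (suc j)))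
    y-equation j = by (# 1ℤ · functional-equation (q ^ j) ∷ (# 0ℤ - d * y j + q * q * y (suc j)) · q^+1 j ∷ (# 0ℤ - q * q * y (suc j)) · q^+2 j ∷ [])
      (solve 6 (λ q x x₁ x₂ u v →
          (con 1ℤ :- con (+ 2) :* q) :* ((con 1ℤ :- q :- x₁) :* u)
          :+ (con 1ℤ :* (q :* ((con 1ℤ :- q) :* (con 1ℤ :- q)) :- q :* (q :* ((con 1ℤ :- q :- x :+ q :* x :- q :* (q :* x)) :* v)))
              :+ ((con 0ℤ :- (con 1ℤ :- con (+ 2) :* q) :* u :+ q :* q :* v) :* (q :* x)
              :+ ((con 0ℤ :- q :* q :* v) :* (q :* (q :* x)) :+ con 0ℤ)))
        := q :* ((con 1ℤ :- q) :* (con 1ℤ :- q)) :- q :* (q :* ((con 1ℤ :- q :- x :+ x₁ :- x₂) :* v))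
          :+ (con 1ℤ :* ((con 1ℤ :- con (+ 2) :* q) :* ((con 1ℤ :- q :- q :* x) :* u))
              :+ ((con 0ℤ :- (con 1ℤ :- con (+ 2) :* q) :* u :+ q :* q :* v) :* x₁
              :+ ((con 0ℤ :- q :* q :* v) :* x₂ :+ con 0ℤ))))
        ≋-refl q (q ^ j) (q ^ (j ℕ.+ 1)) (q ^ (j ℕ.+ 2)) (y j) (y (suc j)))

    E-suc : ∀ m → E (suc m) ≋ # -1ℤ * (q * q) * E m
    E-suc m = subst (λ j → (# -1ℤ * (# -1ℤ) ^ m) * q ^ j ≋ # -1ℤ * (q * q) * E m) (sym (ℕ.*-suc 2 m))
      (solve 3 (λ q s p → (con -1ℤ :* s) :* (q :* (q :* p)) := con -1ℤ :* (q :* q) :* (s :* p)) ≋-refl q ((# -1ℤ) ^ m) (q ^ (2 ℕ.* m)))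

    unit-product : ∀ m → (d ^ suc m * D (suc m)) 0 ≡ 1ℤ
    unit-product m = cong₂ ℤ._*_ (d^-unit (suc m)) (D-unit (suc m))

    -- This is `y-equation` at m + 1, multiplied by q E(m) and divided by (1 - 2q)^(m+1) D(m+1). The
    -- factor q turns q E(m) into q² E(m) = -E(m+1), and thus produces the next summand and the next
    -- σ together.
    summand-step : ∀ m → q * (σ m * y (suc m)) ≋
      q * (σ (suc m) * (ratio (suc m) * y (suc (suc m)))) - (# 1ℤ - q) * ((# 1ℤ - q) * term (suc m))
    summand-step m = cancel (d ^ suc m * D (suc m)) (unit-product m) (by
      ( (q * (d * (D (suc m) * y (suc m)))) · divide (E m) (d ^ m) (d^-unit m)
      ∷ (q * E m) · y-equation (suc m)
      ∷ ((# 1ℤ - q) * (# 1ℤ - q)) · divide (E (suc m)) (d ^ suc m * D (suc m)) (unit-product m)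
      ∷ (# 0ℤ - q * (ratio (suc m) * (y (suc (suc m)) * D (suc m)))) · divide (E (suc m)) (d ^ suc m) (d^-unit (suc m))
      ∷ (# 0ℤ - q * (y (suc (suc m)) * E (suc m))) · divide (ν (suc m)) (D (suc m)) (D-unit (suc m))
      ∷ ((# 1ℤ - q) * (# 1ℤ - q) - q * (ν (suc m) * y (suc (suc m)))) · E-suc m ∷ [])
      (solve 13 (λ q d δ D s s′ t r e e′ n u v →
          (q :* (s :* u)) :* ((d :* δ) :* D)
          :+ ((q :* (d :* (D :* u))) :* e
             :+ ((q :* e) :* (q :* ((con 1ℤ :- q) :* (con 1ℤ :- q)) :- q :* (q :* (n :* v)))
             :+ (((con 1ℤ :- q) :* (con 1ℤ :- q)) :* e′
             :+ ((con 0ℤ :- q :* (r :* (v :* D))) :* e′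
             :+ ((con 0ℤ :- q :* (v :* e′)) :* n
             :+ (((con 1ℤ :- q) :* (con 1ℤ :- q) :- q :* (n :* v)) :* (con -1ℤ :* (q :* q) :* e) :+ con 0ℤ))))))
        := (q :* (s′ :* (r :* v)) :- (con 1ℤ :- q) :* ((con 1ℤ :- q) :* t)) :* ((d :* δ) :* D)
          :+ ((q :* (d :* (D :* u))) :* (s :* δ)
             :+ ((q :* e) :* (d :* (D :* u))
             :+ (((con 1ℤ :- q) :* (con 1ℤ :- q)) :* (t :* ((d :* δ) :* D))
             :+ ((con 0ℤ :- q :* (r :* (v :* D))) :* (s′ :* (d :* δ))
             :+ ((con 0ℤ :- q :* (v :* e′)) :* (r :* D)
             :+ (((con 1ℤ :- q) :* (con 1ℤ :- q) :- q :* (n :* v)) :* e′ :+ con 0ℤ)))))))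
        ≋-refl q d (d ^ m) (D (suc m)) (σ m) (σ (suc m)) (term (suc m)) (ratio (suc m)) (E m) (E (suc m)) (ν (suc m)) (y (suc m)) (y (suc (suc m)))))

    -- Each `summand-step`, multiplied by the product so far, moves one summand from the remainder
    -- on the right to the sum on the left.
    partial-sum : ∀ m → q * y 1 + (# 1ℤ - q) * ((# 1ℤ - q) * ∑₁ m summand) ≋ q * ((σ m * ∏₁ m ratio) * y (suc m))
    partial-sum zero = by ((# 0ℤ - q * y 1) · divide (E 0) (d ^ 0) refl ∷ [])
      (solve 3 (λ q s u → q :* u :+ (con 1ℤ :- q) :* ((con 1ℤ :- q) :* con 0ℤ) :+ ((con 0ℤ :- q :* u) :* (con 1ℤ :* con 1ℤ) :+ con 0ℤ) :=
          q :* ((s :* con 1ℤ) :* u) :+ ((con 0ℤ :- q :* u) :* (s :* con 1ℤ) :+ con 0ℤ))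
        ≋-refl q (σ 0) (y 1))
    partial-sum (suc m) = by (# 1ℤ · partial-sum m ∷ ∏₁ m ratio · summand-step m ∷ [])
      (solve 10 (λ q y₁ S t s s′ π r u v →
          q :* y₁ :+ (con 1ℤ :- q) :* ((con 1ℤ :- q) :* (S :+ t :* π))
          :+ (con 1ℤ :* (q :* ((s :* π) :* u)) :+ (π :* (q :* (s′ :* (r :* v)) :- (con 1ℤ :- q) :* ((con 1ℤ :- q) :* t)) :+ con 0ℤ))
        := q :* ((s′ :* (π :* r)) :* v)
          :+ (con 1ℤ :* (q :* y₁ :+ (con 1ℤ :- q) :* ((con 1ℤ :- q) :* S)) :+ (π :* (q :* (s :* u)) :+ con 0ℤ)))
        ≋-refl q (y 1) (∑₁ m summand) (term (suc m)) (σ m) (σ (suc m)) (∏₁ m ratio) (ratio (suc m)) (y (suc m)) (y (suc (suc m))))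

    E-small : ∀ m → N < m → E m ≋ # 0ℤ
    E-small m l = ≋-trans (solve 2 (λ a b → a :* b := b :* a) ≋-refl ((# -1ℤ) ^ m) (q ^ (2 ℕ.* m)))
      (small (2 ℕ.* m) ((# -1ℤ) ^ m) (ℕ.≤-trans l (ℕ.m≤m+n m (m ℕ.+ 0))))

    quotient-small : ∀ f g → g 0 ≡ 1ℤ → f ≋ # 0ℤ → f / g ≋ # 0ℤ
    quotient-small f g u e = cancel g u (≋-trans (divide f g u) (≋-trans e (≋-sym (zero-* g))))

    summand-small : ∀ m → N < suc m → summand (suc m) ≋ # 0ℤ
    summand-small m l = ≋-trans
      (*-congʳ {∏₁ m ratio} (quotient-small (E (suc m)) (d ^ suc m * D (suc m)) (unit-product m) (E-small (suc m) l)))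
      (zero-* (∏₁ m ratio))

    -- After N + 1 iterations the remainder carries q^(2N+2), so it vanishes modulo q^(N+1).
    y-one : q * y 1 ≋ # 0ℤ - (# 1ℤ - q) * ((# 1ℤ - q) * ∑₁ (suc N) summand)
    y-one = by (# 1ℤ · partial-sum (suc N) ∷
                (q * (∏₁ (suc N) ratio * y (suc (suc N)))) · quotient-small (E (suc N)) (d ^ suc N) (d^-unit (suc N)) (E-small (suc N) ℕ.≤-refl) ∷ [])
      (solve 6 (λ q y₁ S s π v →
          q :* y₁ :+ (con 1ℤ :* (q :* ((s :* π) :* v)) :+ ((q :* (π :* v)) :* con 0ℤ :+ con 0ℤ))
        := con 0ℤ :- (con 1ℤ :- q) :* ((con 1ℤ :- q) :* S)
          :+ (con 1ℤ :* (q :* y₁ :+ (con 1ℤ :- q) :* ((con 1ℤ :- q) :* S)) :+ ((q :* (π :* v)) :* s :+ con 0ℤ)))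
        ≋-refl q (y 1) (∑₁ (suc N) summand) (σ (suc N)) (∏₁ (suc N) ratio) (y (suc (suc N))))

    -- At x = 1 the coefficient 1 - q - qx is 1 - 2q, and 1 - q - x + qx - q²x is -q². Hence the
    -- square of 1 - 2q in the prefactor, and its q³ once q φ(q) is expressed by the sum.
    y-zero : d * (d * y 0) ≋ q * ((# 1ℤ - q) * (# 1ℤ - q)) + q * (q * (q * (q * y 1)))
    y-zero = by (# 1ℤ · functional-equation (# 1ℤ) ∷ [])
      (solve 3 (λ q u v →
          (con 1ℤ :- con (+ 2) :* q) :* ((con 1ℤ :- con (+ 2) :* q) :* u)
          :+ (con 1ℤ :* (q :* ((con 1ℤ :- q) :* (con 1ℤ :- q)) :-
                q :* (q :* ((con 1ℤ :- q :- con 1ℤ :+ q :* con 1ℤ :- q :* (q :* con 1ℤ)) :* v))) :+ con 0ℤ)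
        := q :* ((con 1ℤ :- q) :* (con 1ℤ :- q)) :+ q :* (q :* (q :* (q :* v)))
          :+ (con 1ℤ :* ((con 1ℤ :- con (+ 2) :* q) :* ((con 1ℤ :- q :- q :* con 1ℤ) :* u)) :+ con 0ℤ))
        ≋-refl q (y 0) (y 1))

    -- The hanging bargraphs: a truncation of ∑ q^w X̂₀ w over w ≥ 1.
    H : ℕ → ℤ⟦q⟧
    H k = ∑ k (λ w → q ^ suc w * X̂₀ (suc w))

    -- By `prefix-sums` each further column divides by 1 - q, so the terms form a geometric
    -- progression of ratio q/(1 - q), whose full sum is q/(1 - 2q).
    H-equation : ∀ k → (# 1ℤ - q) * H k ≋ q * (# 1ℤ + H k - q ^ k * X̂₀ k)
    H-equation zero = by (q · X-initial ∷ [])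
      (solve 2 (λ q x → (con 1ℤ :- q) :* con 0ℤ :+ (q :* con 1ℤ :+ con 0ℤ) :=
          q :* (con 1ℤ :+ con 0ℤ :- con 1ℤ :* x) :+ (q :* x :+ con 0ℤ)) ≋-refl q (X̂₀ 0))
    H-equation (suc k) = by (# 1ℤ · H-equation k ∷ (q * q ^ k) · prefix-sums (X₀ k) ∷ [])
      (solve 5 (λ q h a x x′ →
          (con 1ℤ :- q) :* (h :+ (q :* a) :* x′)
          :+ (con 1ℤ :* (q :* (con 1ℤ :+ h :- a :* x)) :+ ((q :* a) :* x :+ con 0ℤ))
        := q :* (con 1ℤ :+ (h :+ (q :* a) :* x′) :- (q :* a) :* x′)
          :+ (con 1ℤ :* ((con 1ℤ :- q) :* h) :+ ((q :* a) :* ((con 1ℤ :- q) :* x′) :+ con 0ℤ)))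
        ≋-refl q (H k) (q ^ k) (X̂₀ k) (X̂₀ (suc k)))

    arounds-series : ser arounds ≋ y 0
    arounds-series = mod λ n n≤N → trans
      (cong +_ (sym (∑<-extend {suc n} {K} {λ w → F w n} (ℕ.≤-<-trans n≤N N<K) λ w l → F-small w n (ℕ.≤-trans (ℕ.n≤1+n n) l))))
      (trans (ser-∑ K F n) (coefficient (∑-cong K λ w → power-one w) n n≤N))
      where
      power-one : ∀ w → F̂ w ≋ (# 1ℤ) ^ w * F̂ w
      power-one zero    = solve 1 (λ f → f := con 1ℤ :* f) ≋-refl (F̂ 0)
      power-one (suc w) = ≋-trans (one-power w (F̂ (suc w))) (solve 2 (λ a f → a :* f := con 1ℤ :* a :* f) ≋-refl ((# 1ℤ) ^ w) (F̂ (suc w)))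
        where
        one-power : ∀ w f → f ≋ (# 1ℤ) ^ w * f
        one-power zero    f = solve 1 (λ f → f := con 1ℤ :* f) ≋-refl f
        one-power (suc w) f = ≋-trans (one-power w f) (solve 2 (λ a f → a :* f := con 1ℤ :* a :* f) ≋-refl ((# 1ℤ) ^ w) f)

    hangings-series : d * ser hangings ≋ q
    hangings-series = by (d · truncated ∷ # 1ℤ · H-equation K ∷ (# 0ℤ - q) · small K (X̂₀ K) N<K ∷ [])
      (solve 4 (λ q s h e →
          (con 1ℤ :- con (+ 2) :* q) :* s
          :+ ((con 1ℤ :- con (+ 2) :* q) :* h :+ (con 1ℤ :* (q :* (con 1ℤ :+ h :- e)) :+ ((con 0ℤ :- q) :* con 0ℤ :+ con 0ℤ)))
        := q
          :+ ((con 1ℤ :- con (+ 2) :* q) :* s :+ (con 1ℤ :* ((con 1ℤ :- q) :* h) :+ ((con 0ℤ :- q) :* e :+ con 0ℤ))))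
        ≋-refl q (ser hangings) (H K) (q ^ K * X̂₀ K))
      where
      truncated : ser hangings ≋ H K
      truncated = mod λ n n≤N → trans
        (cong +_ (sym (∑<-extend {n} {K} {λ w → lag (suc w) (X₀ (suc w)) n} (ℕ.<⇒≤ (ℕ.≤-<-trans n≤N N<K)) λ w l → lag-early (suc w) (X₀ (suc w)) n (s≤s l))))
        (trans (ser-∑ K (λ w → lag (suc w) (X₀ (suc w))) n)
          (coefficient (∑-cong K λ w → exact λ m → sym (ser-lag (suc w) (X₀ (suc w)) m)) n n≤N))

    columns-series : (# 1ℤ - q) * ser columns ≋ q
    columns-series = by (# 1ℤ · recurrence ∷ [])
      (solve 2 (λ q c → (con 1ℤ :- q) :* c :+ (con 1ℤ :* (q :+ q :* c) :+ con 0ℤ) := q :+ (con 1ℤ :* c :+ con 0ℤ)) ≋-refl q (ser columns))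
      where
      recurrence : ser columns ≋ q + q * ser columns
      recurrence = mod λ { zero _ → refl ; (suc zero) _ → sym (cong (λ z → 1ℤ ℤ.+ z) (q-*-suc (ser columns) 0))
        ; (suc (suc n)) _ → sym (trans (ℤ.+-identityˡ _) (q-*-suc (ser columns) (suc n))) }

    -- The left side is 2 (φ(1) + q/(1 - 2q) + q/(1 - q)). The part of φ(1) without the sum is q (1
    -- - q)²/(1 - 2q)², and (1 - q)³ + (1 - 2q)(1 - q) + (1 - 2q)² = 3 - 10q + 9q² - q³ is the
    -- numerator in `rationalPart`.
    total-series : ser (λ n → polygons n ℕ.+ polygons n) ≋ prefactor * ∑₁ (suc N) summand + rationalPart
    total-series = cancel (d ^ 2 * (# 1ℤ - q)) refl (by
      ( (# (+ 2) * (d * (d * (# 1ℤ - q)))) · arounds-series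
      ∷ (# (+ 2) * (# 1ℤ - q)) · y-zero
      ∷ (# (+ 2) * ((# 1ℤ - q) * (q * (q * q)))) · y-one
      ∷ (# (+ 2) * (d * (# 1ℤ - q))) · hangings-series
      ∷ (# (+ 2) * (d * d)) · columns-series
      ∷ (# 0ℤ - ∑₁ (suc N) summand * (# 1ℤ - q)) · divide (# (ℤ.- + 2) * q ^ 3 * (# 1ℤ - q) ^ 2) (d ^ 2) refl
      ∷ (# 0ℤ - # 1ℤ) · divide (# (+ 2) * q * (# (+ 3) - # (+ 10) * q + # (+ 9) * q ^ 2 - q ^ 3)) (d ^ 2 * (# 1ℤ - q)) refl ∷ [])
      (solve 9 (λ q a h c y₀ y₁ S p r → let d = con 1ℤ :- con (+ 2) :* q ; o = con 1ℤ :- q ; dd = d :* (d :* con 1ℤ) in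
          ((a :+ (h :+ c)) :+ (a :+ (h :+ c))) :* (dd :* o)
          :+ ((con (+ 2) :* (d :* (d :* o))) :* y₀
             :+ ((con (+ 2) :* o) :* (q :* (o :* o) :+ q :* (q :* (q :* (q :* y₁))))
             :+ ((con (+ 2) :* (o :* (q :* (q :* q)))) :* (con 0ℤ :- o :* (o :* S))
             :+ ((con (+ 2) :* (d :* o)) :* q
             :+ ((con (+ 2) :* (d :* d)) :* q
             :+ ((con 0ℤ :- S :* o) :* (con (ℤ.- + 2) :* (q :* (q :* (q :* con 1ℤ))) :* (o :* (o :* con 1ℤ)))
             :+ ((con 0ℤ :- con 1ℤ) :* (con (+ 2) :* q :* (con (+ 3) :- con (+ 10) :* q :+ con (+ 9) :* (q :* (q :* con 1ℤ)) :- q :* (q :* (q :* con 1ℤ)))) :+ con 0ℤ)))))))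
        := (p :* S :+ r) :* (dd :* o)
          :+ ((con (+ 2) :* (d :* (d :* o))) :* a
             :+ ((con (+ 2) :* o) :* (d :* (d :* y₀))
             :+ ((con (+ 2) :* (o :* (q :* (q :* q)))) :* (q :* y₁)
             :+ ((con (+ 2) :* (d :* o)) :* (d :* h)
             :+ ((con (+ 2) :* (d :* d)) :* (o :* c)
             :+ ((con 0ℤ :- S :* o) :* (p :* dd)
             :+ ((con 0ℤ :- con 1ℤ) :* (r :* (dd :* o)) :+ con 0ℤ))))))))
        ≋-refl q (ser arounds) (ser hangings) (ser columns) (y 0) (y 1) (∑₁ (suc N) summand) prefactor rationalPart))

∑₁-stable : ∀ n j → ∑₁ (j ℕ.+ n) summand n ≡ ∑₁ n summand n
∑₁-stable n zero    = refl
∑₁-stable n (suc j) = trans (cong₂ ℤ._+_ (∑₁-stable n j)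
    (trans (Modulo.coefficient (summand-small n (suc n) ℕ.≤-refl (j ℕ.+ n) (s≤s (ℕ.m≤n+m n j))) n ℕ.≤-refl) (zero-series n)))
  (ℤ.+-identityʳ _)
  where
  zero-series : ∀ n → (# 0ℤ) n ≡ 0ℤ
  zero-series zero    = refl
  zero-series (suc n) = refl

sumOfSummands : ℤ⟦q⟧
sumOfSummands n = ∑₁ n summand n

∑₁-large : ∀ n M → n ≤ M → ∑₁ M summand n ≡ sumOfSummands n
∑₁-large n M l = subst (λ M → ∑₁ M summand n ≡ sumOfSummands n) (ℕ.m∸n+n≡m l) (∑₁-stable n (M ∸ n))

summand-sums : summand SumsTo sumOfSummands
summand-sums n = n , ∑₁-large n

formula : generatingFunction (λ n → polygons n ℕ.+ polygons n) ≈ prefactor * sumOfSummands + rationalPart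
formula n = trans (coefficients n) (Modulo.coefficient total n ℕ.≤-refl)
  where
  open Modulo n
  coefficients : ∀ n → generatingFunction (λ n → polygons n ℕ.+ polygons n) n ≡ ser (λ n → polygons n ℕ.+ polygons n) n
  coefficients zero    = refl
  coefficients (suc n) = refl
  total : ser (λ n → polygons n ℕ.+ polygons n) ≋ prefactor * sumOfSummands + rationalPart
  total = ≋-trans (total-series n (suc n) ℕ.≤-refl)
    (+-congʳ (*-congˡ {prefactor} (mod λ m l → ∑₁-large m (suc n) (ℕ.m≤n⇒m≤1+n l))))

-- Accepted walks and three-sided prudent polygons

accepted-long : ∀ {n s r} → Accept s n → Run r s → 1 < length r
accepted-long _ (_ ∷ _ ∷ _) = s≤s (s≤s z≤n)
accepted-long () []
accepted-long () (col ∷ [])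
accepted-long () (dig _ ∷ [])
accepted-long () (rise _ ∷ [])

accepted-adjacent : ∀ {n s r} → Accept s n → Inv s r → Adjacent (pos r) origin
accepted-adjacent around  v = west  , cong₂ _,_ (lin 1 0 (λ x → x :≡ con 1ℤ ⇒ ⊢ x ⊖ con 1ℤ :≡ con 0ℤ) refl (Fin.x≡ v)) (Fin.y≡ v)
accepted-adjacent hanging v = south , cong₂ _,_ (Top.x≡ v) (lin 1 0 (λ x → x :≡ con 1ℤ ⇒ ⊢ x ⊖ con 1ℤ :≡ con 0ℤ) refl (Top.y≡ v))
accepted-adjacent column  v = east  , cong₂ _,_ (lin 1 0 (λ x → x :≡ ⊝ con 1ℤ ⇒ ⊢ x ⊕ con 1ℤ :≡ con 0ℤ) refl (Exc.x≡ v)) (lin 1 0 (λ x → x :≡ con 0ℤ ⊖ con 0ℤ ⇒ ⊢ x :≡ con 0ℤ) refl (Exc.y≡ v))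

adjacent-mirror : ∀ r → Adjacent (pos (mirror r)) origin → Adjacent (pos r) origin
adjacent-mirror r (d , e) = flip d , trans (cong (λ p → step p (flip d)) (trans (sym (reflect-involutive (pos r))) (cong reflect (sym (pos-mirror r)))))
  (trans (step-reflect (pos (mirror r)) d) (cong reflect e))

record Polygon (r : List Dir) (n : ℕ) : Set where
  constructor polygon
  field
    legal    : Legal r
    long     : 1 < length r
    adjacent : Adjacent (pos r) origin
    area     : HasCard (True (inside r)) n

accepted-polygon : ∀ {n r} → Accepted n r → Polygon r n
accepted-polygon a@(s , rn , acc) =
  polygon (proj₁ (run-sound rn)) (accepted-long acc rn) (accepted-adjacent acc (proj₂ (run-sound rn))) (accepted-area a)

mirror-polygon : ∀ {n r} → Polygon (mirror r) n → Polygon r n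
mirror-polygon {n} {r} (polygon l g a c) = polygon
  (subst Legal (mirror-involutive r) (legal-mirror l)) (subst (1 <_) (length-map flip r) g) (adjacent-mirror r a)
  (subst (λ r → HasCard (True (inside r)) n) (mirror-involutive r) (inside-card-mirror (mirror r) c))

either-polygon : ∀ {n r} → Accepted n r ⊎ Accepted n (mirror r) → Polygon r n
either-polygon (inj₁ a) = accepted-polygon a
either-polygon (inj₂ a) = mirror-polygon (accepted-polygon a)

sound : ∀ {n r} → Polygon r n → ThreeSidedPrudentPolygon (reverse r) × HasArea (reverse r) n
sound {n} {r} (polygon l g a c) =
  ((prudent-from (reverse r) l′ , subst (1 <_) (sym (length-reverse r)) g , subst (λ p → Adjacent p origin) (sym (end-pos r)) a) ,
   three-sided-from (reverse r) l′) ,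
  has-area {r} a c
  where
  l′ : Legal (reverse (reverse r))
  l′ = subst Legal (sym (reverse-involutive r)) l

-- The classification yields acceptance with some area m; both m and n count the enclosed cells, so
-- `card-unique` identifies them.
complete : ∀ {n w} → ThreeSidedPrudentPolygon w × HasArea w n → Accepted n (reverse w) ⊎ Accepted n (mirror (reverse w))
complete {n} {w} (((p , g , a) , t) , c)
  with classify (legal-to w p t) (subst (1 <_) (sym (length-reverse w)) g) (subst (λ p → Adjacent p origin) (end≡ w) a)
... | m , x = subst (λ n → Accepted n (reverse w) ⊎ Accepted n (mirror (reverse w)))
  (card-unique (subst (λ w → HasArea w m) (reverse-involutive w) (proj₂ (sound (either-polygon x)))) c) x

theorem1 : ∃[ PA ]
    ( (∀ n → 1 ≤ n → HasCard (λ w → ThreeSidedPrudentPolygon w × HasArea w n) (PA n))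
    × (∃[ S ] (summand SumsTo S × generatingFunction PA ≈ prefactor * S + rationalPart))
    × applyUpTo (λ i → PA (suc i)) 10
    ≡ 6 ∷ 10 ∷ 20 ∷ 42 ∷ 92 ∷ 204 ∷ 454 ∷ 1010 ∷ 2242 ∷ 4962 ∷ [] )
theorem1 = (λ n → polygons n ℕ.+ polygons n) ,
  (λ n _ → card-resp (card-map reverse reverse reverse-involutive (card-polygons n))
    (λ { (r , a , refl) → sound (either-polygon a) })
    (λ {w} p → reverse w , complete p , reverse-involutive w)) ,
  (sumOfSummands , summand-sums , formula) ,
  -- The ten values come out by evaluating the recurrences for `X₀`, `X₁` and `F`.
  refl
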